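{- (i) For every integer $d$ with $1\leq d\leq 13$, the $f^*$-vector of every $d$-dimensional lattice polytope $P\subset\mathbb{R}^d$ is unimodal. (ii) There exists a $15$-dimensional lattice simplex whose $f^*$-vector is not unimodal.
   Context: A lattice polytope is the convex hull of finitely many points of $\mathbb{Z}^d$; a lattice simplex is a lattice polytope that is a simplex. For a $d$-dimensional lattice polytope $P\subset\mathbb{R}^d$ and a positive integer $n$, let $\operatorname{ehr}_P(n)=|nP\cap\mathbb{Z}^d|$ (a polynomial in $n$ of degree $d$). The $f^*$-vector $(f^*_0,\dots,f^*_d)$ of $P$ is defined by $\operatorname{ehr}_P(n)=\sum_{k=0}^d f^*_k\binom{n-1}{k}$ for all positive integers $n$. A sequence $(a_0,\dots,a_d)$ is unimodal if there is an index $p$ with $a_0\leq a_1\leq\cdots\leq a_p\geq a_{p+1}\geq\cdots\geq a_d$. -}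

module Defs where

open import Data.Nat as ℕ using (ℕ; zero; suc; _∸_)
open import Data.Nat.Combinatorics using (_C_)
open import Data.Integer as ℤ using (ℤ; +_)
open import Data.Rational as ℚ using (ℚ; 0ℚ; 1ℚ)
open import Data.Fin using (Fin; zero; suc; toℕ; inject₁)
open import Data.Vec using (Vec; lookup)
open import Data.List using (List; length)
open import Data.List.Membership.Propositional using (_∈_)
open import Data.List.Relation.Unary.Unique.Propositional using (Unique)
open import Data.Product using (Σ; ∃; _×_)
open import Function.Bundles using (_⇔_)
open import Relation.Binary.PropositionalEquality using (_≡_)

sumℚ : {n : ℕ} → (Fin n → ℚ) → ℚ
sumℚ {zero}  f = 0ℚ
sumℚ {suc n} f = f zero ℚ.+ sumℚ (λ i → f (suc i))

sumℤ : {n : ℕ} → (Fin n → ℤ) → ℤ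
sumℤ {zero}  f = + 0
sumℤ {suc n} f = f zero ℤ.+ sumℤ (λ i → f (suc i))

toℚ : ℤ → ℚ
toℚ z = z ℚ./ 1

-- A lattice polytope P ⊂ ℝ^d is given by finitely many generators V : Fin m → ℤ^d,
-- P = conv(V).  A lattice point x lies in nP iff it is a convex combination of the
-- points n·V i (coefficients may be taken rational since all data are rational).
InDilate : {m d : ℕ} → (Fin m → Vec ℤ d) → ℕ → Vec ℤ d → Set
InDilate {m} {d} V n x =
  Σ (Fin m → ℚ) λ c →
    (∀ i → 0ℚ ℚ.≤ c i) ×
    (sumℚ c ≡ 1ℚ) ×
    (∀ (j : Fin d) →
       sumℚ (λ i → c i ℚ.* toℚ (+ n ℤ.* lookup (V i) j)) ≡ toℚ (lookup x j))

AffIndep : {d : ℕ} → (Fin (suc d) → Vec ℤ d) → Set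
AffIndep {d} W =
  (c : Fin d → ℚ) →
  (∀ (j : Fin d) →
     sumℚ (λ i → c i ℚ.* toℚ (lookup (W (suc i)) j ℤ.- lookup (W zero) j)) ≡ 0ℚ) →
  ∀ i → c i ≡ 0ℚ

FullDim : {m d : ℕ} → (Fin m → Vec ℤ d) → Set
FullDim {m} {d} V = Σ (Fin (suc d) → Fin m) λ ι → AffIndep (λ k → V (ι k))

IsFStar : {m d : ℕ} → (Fin m → Vec ℤ d) → (Fin (suc d) → ℤ) → Set
IsFStar {m} {d} V f =
  ∀ (n : ℕ) → 1 ℕ.≤ n →
  Σ (List (Vec ℤ d)) λ L →
    Unique L ×
    (∀ x → (x ∈ L) ⇔ InDilate V n x) ×
    (+ length L ≡ sumℤ (λ k → f k ℤ.* + ((n ∸ 1) C toℕ k)))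

Unimodal : {d : ℕ} → (Fin (suc d) → ℤ) → Set
Unimodal {d} a =
  Σ (Fin (suc d)) λ p →
    (∀ (i : Fin d) → toℕ i ℕ.< toℕ p → a (inject₁ i) ℤ.≤ a (suc i)) ×
    (∀ (i : Fin d) → toℕ p ℕ.≤ toℕ i → a (suc i) ℤ.≤ a (inject₁ i))

{-# OPTIONS --safe #-}

-- Part (i). Place P at height 1 and let q be an infinitesimal generic vector in the interior of the cone over P. A lattice point
-- x at height n lies in nP iff x + q lies in the cone, and in the interior of nP iff x − q does. Among the representations of
-- x + q by generators the lexicographically largest one is supported on d + 1 independent generators, and only on the support
-- does this maximality depend; so adding a generator of the support is reversible, and peeling generators off one at a time
-- shows that |nP ∩ ℤ^d| is the (d+1)-fold partial sum of the numbers h_n of points with all coefficients below 1 (Stanley's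
-- nonnegativity). Reflecting x to Σ v_i − x gives h_{d+1−n} for the interior. For boundary points one pulls an interior apex
-- first and peels only the other d generators, so that Σ_{j ≤ t} (h_j − h_{d+1−j}) counts points (Hibi's inequality); it is
-- at least 1, because q may be tilted so that the sum of t chosen generators is counted. Taking differences, f*_k is the
-- (d+1−k)-fold partial sum of h at k + 1, and for d ≤ 13 these linear inequalities exclude a strict descent of f* followed
-- by a strict ascent.
--
-- Part (ii). A simplex whose lattice is generated over its vertices by one point with barycentric coordinates 1/q and −1/q,
-- eight times each, has h* = 1 + (q − 1) z⁸; for q = 192 this gives f*₇ > f*₈ < f*₉.

module Submission where

open import Defs
open import Data.Nat as ℕ using (ℕ; zero; suc; _∸_; _≤_; _<_; z≤n; s≤s)
import Data.Nat.Properties as ℕP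
import Data.Nat.DivMod as DivMod
open import Data.Nat.Combinatorics using (_C_; nCk≡nC[n∸k]; nCn≡1; nCk+nC[k+1]≡[n+1]C[k+1]; k>n⇒nCk≡0)
open import Data.Integer as ℤ using (ℤ; 0ℤ; -[1+_])
import Data.Integer.Properties as ℤP
open import Algebra.Properties.AbelianGroup ℤP.+-0-abelianGroup using () renaming (∙-cancelʳ to ℤ-+-cancelʳ)
open import Data.Rational as ℚ using (ℚ; 0ℚ; 1ℚ; 1/_)
open import Algebra.Structures using (IsCommutativeRing)
import Data.Rational.Properties as ℚP
open import Data.Rational.Unnormalised as ℚᵘ using (mkℚᵘ)
import Data.Rational.Unnormalised.Properties as ℚᵘP
open import Data.Bool using (Bool; T; true; false; not; if_then_else_; _∧_)
import Data.Bool.Properties as BoolP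
open import Data.Fin as Fin using (Fin; zero; suc; toℕ; fromℕ<; inject₁; punchIn; cast)
import Data.Fin.Properties as FinP
open import Data.Vec as Vec using (Vec; []; _∷_; lookup; tabulate)
import Data.Vec.Properties as VecP
open import Data.List as List using (List; []; _∷_; _++_; length; filter)
import Data.List.Properties as ListP
open import Data.List.Membership.Propositional using (_∈_)
import Data.List.Membership.Propositional.Properties as MemP
open import Data.List.Relation.Unary.Any using (Any; here; there)
open import Data.List.Relation.Unary.All as All using (All; []; _∷_)
import Data.List.Relation.Unary.All.Properties as AllP
open import Data.List.Relation.Unary.AllPairs using ([]; _∷_)
open import Data.List.Relation.Unary.Unique.Propositional using (Unique)
import Data.List.Relation.Unary.Unique.Propositional.Properties as UniqueP
open import Data.Product using (Σ; ∃-syntax; _×_; _,_; proj₁; proj₂)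
open import Data.Sum using (_⊎_; inj₁; inj₂)
open import Data.Empty using (⊥; ⊥-elim)
open import Data.Unit using (⊤; tt)
open import Function using (_∘_; _$_)
open import Function.Bundles using (mk⇔; Equivalence)
open import Relation.Nullary using (¬_; Dec; yes; no; contradiction; does)
open import Relation.Nullary.Decidable using (_×-dec_; _→-dec_; ¬?; map′; dec⇒maybe)
open import Relation.Binary.PropositionalEquality using (_≡_; _≢_; refl; sym; trans; cong; cong₂; subst; subst₂; module ≡-Reasoning)
open import Relation.Binary.Definitions using (tri<; tri≈; tri>)
open import Tactic.RingSolver using (solve-∀)
open import Tactic.RingSolver.Core.AlmostCommutativeRing using (AlmostCommutativeRing; fromCommutativeRing)

-- Lexicographic tuples replace topology: a generic direction is a finite list of rational vectors,
-- and only ℚ-linear operations on such tuples occur. If d + 1 of the listed vectors are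
-- independent, no perturbed point can be carried by fewer than d + 1 generators; this is what
-- genericity has to provide. Maximality is encoded as `Good`, a condition on the support over
-- rational dependencies. The simplices of a triangulation are therefore never listed, and their
-- covering the cone without overlap becomes existence and uniqueness of a canonical representation.
-- Counts are compared through iterated partial sums, which differencing undoes. This resolves the
-- main obstacle: the extra 1 in Hibi's inequality requires a different q for every t, yet all these
-- q must give the same h. They do, because the lattice point counts do not involve q. For d ≤ 13 a
-- descent at k followed by an ascent at l is refuted by a Farkas certificate, chosen by (d, k, l)
-- and checked by evaluation. In part (ii) the dilates are parametrised explicitly.

infixl 6 _+_ _-_
infixl 7 _*_
infix  8 -_

-- Making the arithmetic of ℚ opaque turns its operations into injective symbols for unification.
opaque
  _+_ _*_ : ℚ → ℚ → ℚ
  _+_ = ℚ._+_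
  _*_ = ℚ._*_

  -_ : ℚ → ℚ
  -_ = ℚ.-_

  0# 1# : ℚ
  0# = 0ℚ
  1# = 1ℚ

  ι : ℤ → ℚ
  ι = toℚ

_-_ : ℚ → ℚ → ℚ
x - y = x + - y

_≤ᵣ_ _<ᵣ_ : ℚ → ℚ → Set
_≤ᵣ_ = ℚ._≤_
_<ᵣ_ = ℚ._<_

infix 4 _≤ᵣ_ _<ᵣ_

opaque
  unfolding _+_

  isCommutativeRing : IsCommutativeRing _≡_ _+_ _*_ -_ 0# 1#
  isCommutativeRing = ℚP.+-*-isCommutativeRing

  +-mono-≤ : ∀ {x y u v} → x ≤ᵣ y → u ≤ᵣ v → x + u ≤ᵣ y + v
  +-mono-≤ = ℚP.+-mono-≤

  +-mono-<-≤ : ∀ {x y u v} → x <ᵣ y → u ≤ᵣ v → x + u <ᵣ y + v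
  +-mono-<-≤ = ℚP.+-mono-<-≤

  +-mono-≤-< : ∀ {x y u v} → x ≤ᵣ y → u <ᵣ v → x + u <ᵣ y + v
  +-mono-≤-< = ℚP.+-mono-≤-<

  *-pos : ∀ {x y} → 0# <ᵣ x → 0# <ᵣ y → 0# <ᵣ x * y
  *-pos {x} {y} x>0 y>0 = subst (_<ᵣ x * y) (ℚP.*-zeroʳ x) (ℚP.*-monoʳ-<-pos x {{ℚ.positive x>0}} y>0)

  *-nonneg : ∀ {x y} → 0# ≤ᵣ x → 0# ≤ᵣ y → 0# ≤ᵣ x * y
  *-nonneg {x} {y} x≥0 y≥0 = subst (_≤ᵣ x * y) (ℚP.*-zeroʳ x) (ℚP.*-monoˡ-≤-nonNeg x {{ℚ.nonNegative x≥0}} y≥0)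

  inverse : ∀ x → x ≢ 0# → ∃[ y ] y * x ≡ 1#
  inverse x x≢0 = (1/ x) {{ℚ.≢-nonZero x≢0}} , ℚP.*-inverseˡ x {{ℚ.≢-nonZero x≢0}}

  inverse-pos : ∀ x → 0# <ᵣ x → ∃[ y ] y * x ≡ 1# × 0# <ᵣ y
  inverse-pos x x>0 = (1/ x) {{nz}} , ℚP.*-inverseˡ x {{nz}} , ℚP.positive⁻¹ _ {{ℚP.1/pos⇒pos x {{ℚ.positive x>0}}}}
    where
    nz : ℚ.NonZero x
    nz = ℚP.pos⇒nonZero x {{ℚ.positive x>0}}

  0<1 : 0# <ᵣ 1#
  0<1 = ℚP.positive⁻¹ 1ℚ

  ι-ᵘ : ∀ z → ℚ.toℚᵘ (ι z) ℚᵘ.≃ mkℚᵘ z 0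
  ι-ᵘ z = ℚP.toℚᵘ-fromℚᵘ (mkℚᵘ z 0)

  ι-+ : ∀ x y → ι (x ℤ.+ y) ≡ ι x + ι y
  ι-+ x y = ℚP.toℚᵘ-injective (ℚᵘP.≃-trans (ι-ᵘ (x ℤ.+ y)) (ℚᵘP.≃-sym (ℚᵘP.≃-trans (ℚP.toℚᵘ-homo-+ (ι x) (ι y))
    (ℚᵘP.≃-trans (ℚᵘP.+-cong (ι-ᵘ x) (ι-ᵘ y)) (ℚᵘ.*≡* (cong (ℤ._* ℤ.1ℤ) (cong₂ ℤ._+_ (ℤP.*-identityʳ x) (ℤP.*-identityʳ y))))))))

  ι-* : ∀ x y → ι (x ℤ.* y) ≡ ι x * ι y
  ι-* x y = ℚP.toℚᵘ-injective (ℚᵘP.≃-trans (ι-ᵘ (x ℤ.* y)) (ℚᵘP.≃-sym (ℚᵘP.≃-trans (ℚP.toℚᵘ-homo-* (ι x) (ι y))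
    (ℚᵘP.≃-trans (ℚᵘP.*-cong (ι-ᵘ x) (ι-ᵘ y)) (ℚᵘ.*≡* refl)))))

  ι-neg : ∀ x → ι (ℤ.- x) ≡ - ι x
  ι-neg x = ℚP.toℚᵘ-injective (ℚᵘP.≃-trans (ι-ᵘ (ℤ.- x)) (ℚᵘP.≃-sym (ℚᵘP.≃-trans (ℚP.toℚᵘ-homo‿- (ι x)) (ℚᵘP.-‿cong (ι-ᵘ x)))))

  ι-injective : ∀ {x y} → ι x ≡ ι y → x ≡ y
  ι-injective {x} {y} e with ℚᵘP.≃-trans (ℚᵘP.≃-sym (ι-ᵘ x)) (ℚᵘP.≃-trans (ℚᵘP.≃-reflexive (cong ℚ.toℚᵘ e)) (ι-ᵘ y))
  ... | ℚᵘ.*≡* p = trans (sym (ℤP.*-identityʳ x)) (trans p (ℤP.*-identityʳ y))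

  ι-mono : ∀ {x y} → x ℤ.≤ y → ι x ≤ᵣ ι y
  ι-mono {x} {y} x≤y = ℚP.toℚᵘ-cancel-≤ (ℚᵘP.≤-respˡ-≃ (ℚᵘP.≃-sym (ι-ᵘ x)) (ℚᵘP.≤-respʳ-≃ (ℚᵘP.≃-sym (ι-ᵘ y))
    (ℚᵘ.*≤* (subst₂ ℤ._≤_ (sym (ℤP.*-identityʳ x)) (sym (ℤP.*-identityʳ y)) x≤y))))

  ι-cancel-≤ : ∀ {x y} → ι x ≤ᵣ ι y → x ℤ.≤ y
  ι-cancel-≤ {x} {y} h with ℚᵘP.≤-respˡ-≃ (ι-ᵘ x) (ℚᵘP.≤-respʳ-≃ (ι-ᵘ y) (ℚP.toℚᵘ-mono-≤ h))
  ... | ℚᵘ.*≤* p = subst₂ ℤ._≤_ (ℤP.*-identityʳ x) (ℤP.*-identityʳ y) p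

  ι-0 : ι (ℤ.+ 0) ≡ 0#
  ι-0 = refl

  ι-1 : ι (ℤ.+ 1) ≡ 1#
  ι-1 = refl

ℚ-ring : AlmostCommutativeRing _ _
ℚ-ring = fromCommutativeRing ℚP.+-*-commutativeRing λ x → dec⇒maybe (0ℚ ℚP.≟ x)

open ≡-Reasoning
open IsCommutativeRing isCommutativeRing public using (*-assoc; *-comm; *-identityˡ; *-identityʳ; +-assoc; +-comm; +-identityˡ; +-identityʳ; distribˡ; distribʳ; zeroˡ; zeroʳ) renaming (-‿inverseʳ to +-inverseʳ)

ℤ-ring : AlmostCommutativeRing _ _
ℤ-ring = fromCommutativeRing ℤP.+-*-commutativeRing λ x → dec⇒maybe (0ℤ ℤP.≟ x)

-- Order and sign rules for the opaque rationals

+-nonneg : ∀ {x y} → 0# ≤ᵣ x → 0# ≤ᵣ y → 0# ≤ᵣ x + y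
+-nonneg {x} {y} p q = subst (_≤ᵣ x + y) (+-identityʳ 0#) (+-mono-≤ p q)

+-pos-nonneg : ∀ {x y} → 0# <ᵣ x → 0# ≤ᵣ y → 0# <ᵣ x + y
+-pos-nonneg {x} {y} p q = subst (_<ᵣ x + y) (+-identityʳ 0#) (+-mono-<-≤ p q)

+-nonneg-pos : ∀ {x y} → 0# ≤ᵣ x → 0# <ᵣ y → 0# <ᵣ x + y
+-nonneg-pos {x} {y} p q = subst (_<ᵣ x + y) (+-identityʳ 0#) (+-mono-≤-< p q)

<⇒≱ᵣ : ∀ {x y} → x <ᵣ y → ¬ y ≤ᵣ x
<⇒≱ᵣ x<y y≤x = ℚP.<-irrefl refl (ℚP.<-≤-trans x<y y≤x)

1≢0 : 1# ≢ 0#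
1≢0 e = ℚP.<-irrefl (sym e) 0<1

opaque
  unfolding _+_

  neg-distrib-+ : ∀ x y → - (x + y) ≡ - x + - y
  neg-distrib-+ = solve-∀ ℚ-ring

  neg-distribˡ-* : ∀ x y → - (x * y) ≡ - x * y
  neg-distribˡ-* = solve-∀ ℚ-ring

neg-0 : - 0# ≡ 0#
neg-0 = trans (sym (+-identityˡ (- 0#))) (+-inverseʳ 0#)

minus-zero : ∀ {x y} → y ≡ 0# → x - y ≡ x
minus-zero {x} {y} e = trans (cong (λ y → x - y) e) (trans (cong (x +_) neg-0) (+-identityʳ x))

opaque
  unfolding _+_

  neg-involutive : ∀ x → - - x ≡ x
  neg-involutive = solve-∀ ℚ-ring

diff-nonneg : ∀ {x y} → x ≤ᵣ y → 0# ≤ᵣ y - x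
diff-nonneg {x} {y} x≤y = subst (_≤ᵣ y - x) (+-inverseʳ x) (+-mono-≤ x≤y ℚP.≤-refl)

diff-pos : ∀ {x y} → x <ᵣ y → 0# <ᵣ y - x
diff-pos {x} {y} x<y = subst (_<ᵣ y - x) (+-inverseʳ x) (+-mono-<-≤ x<y ℚP.≤-refl)

neg-pos : ∀ {x} → x <ᵣ 0# → 0# <ᵣ - x
neg-pos {x} x<0 = subst (0# <ᵣ_) (+-identityˡ (- x)) (diff-pos x<0)

neg-neg : ∀ {x} → 0# <ᵣ x → - x <ᵣ 0#
neg-neg {x} x>0 = subst₂ _<ᵣ_ (+-identityˡ (- x)) (+-inverseʳ x) (+-mono-<-≤ x>0 ℚP.≤-refl)

nonneg-diff : ∀ {x y} → 0# ≤ᵣ y - x → x ≤ᵣ y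
nonneg-diff {x} {y} h = subst (x ≤ᵣ_) (eq x y) (subst (_≤ᵣ x + (y - x)) (+-identityʳ x) (+-mono-≤ (ℚP.≤-refl {x}) h))
  where
  opaque
    unfolding _+_
    eq : ∀ x y → x + (y - x) ≡ y
    eq = solve-∀ ℚ-ring

diff≡0 : ∀ {x y} → x - y ≡ 0# → x ≡ y
diff≡0 {x} {y} h = trans (eq x y) (trans (cong (_+ y) h) (+-identityˡ y))
  where
  opaque
    unfolding _+_
    eq : ∀ x y → x ≡ (x - y) + y
    eq = solve-∀ ℚ-ring

cancel-nonzero : ∀ {x y} → x ≢ 0# → y * x ≡ 0# → y ≡ 0#
cancel-nonzero {x} {y} x≢0 yx≡0 with inverse x x≢0
... | u , ux≡1 = begin
  y             ≡⟨ sym (*-identityʳ y) ⟩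
  y * 1#        ≡⟨ cong (y *_) (sym ux≡1) ⟩
  y * (u * x)   ≡⟨ eq y u x ⟩
  u * (y * x)   ≡⟨ cong (u *_) yx≡0 ⟩
  u * 0#        ≡⟨ zeroʳ u ⟩
  0#            ∎
  where
  opaque
    unfolding _+_
    eq : ∀ y u x → y * (u * x) ≡ u * (y * x)
    eq = solve-∀ ℚ-ring

-- Finite sums, linear combinations and elimination

sum : ∀ {n} → (Fin n → ℚ) → ℚ
sum {zero}  f = 0#
sum {suc n} f = f zero + sum (f ∘ suc)

sum-cong : ∀ {n} {f g : Fin n → ℚ} → (∀ i → f i ≡ g i) → sum f ≡ sum g
sum-cong {zero}  e = refl
sum-cong {suc n} e = cong₂ _+_ (e zero) (sum-cong (e ∘ suc))

sum-0 : ∀ {n} {f : Fin n → ℚ} → (∀ i → f i ≡ 0#) → sum f ≡ 0#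
sum-0 {zero}  e = refl
sum-0 {suc n} e = trans (cong₂ _+_ (e zero) (sum-0 (e ∘ suc))) (+-identityʳ 0#)

sum-+ : ∀ {n} (f g : Fin n → ℚ) → sum (λ i → f i + g i) ≡ sum f + sum g
sum-+ {zero}  f g = sym (+-identityʳ 0#)
sum-+ {suc n} f g = trans (cong (f zero + g zero +_) (sum-+ (f ∘ suc) (g ∘ suc))) (eq _ _ _ _)
  where
  opaque
    unfolding _+_
    eq : ∀ a b c d → a + b + (c + d) ≡ a + c + (b + d)
    eq = solve-∀ ℚ-ring

sum-*ˡ : ∀ {n} x (f : Fin n → ℚ) → sum (λ i → x * f i) ≡ x * sum f
sum-*ˡ {zero}  x f = sym (zeroʳ x)
sum-*ˡ {suc n} x f = trans (cong (x * f zero +_) (sum-*ˡ x (f ∘ suc))) (sym (distribˡ x _ _))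

sum-*ʳ : ∀ {n} x (f : Fin n → ℚ) → sum (λ i → f i * x) ≡ sum f * x
sum-*ʳ x f = trans (sum-cong λ i → *-comm (f i) x) (trans (sum-*ˡ x f) (*-comm x _))

sum-neg : ∀ {n} (f : Fin n → ℚ) → sum (λ i → - f i) ≡ - sum f
sum-neg {zero}  f = sym neg-0
sum-neg {suc n} f = trans (cong (- f zero +_) (sum-neg (f ∘ suc))) (sym (neg-distrib-+ _ _))

sum-comm : ∀ {m n} (f : Fin m → Fin n → ℚ) → sum (λ i → sum (f i)) ≡ sum (λ j → sum (λ i → f i j))
sum-comm {zero} {n} f = sym (sum-0 {n} λ _ → refl)
sum-comm {suc m} f = trans (cong (sum (f zero) +_) (sum-comm (f ∘ suc))) (sym (sum-+ (f zero) _))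

sum-nonneg : ∀ {n} {f : Fin n → ℚ} → (∀ i → 0# ≤ᵣ f i) → 0# ≤ᵣ sum f
sum-nonneg {zero}  h = ℚP.≤-refl
sum-nonneg {suc n} h = +-nonneg (h zero) (sum-nonneg (h ∘ suc))

sum-nonneg-≡0 : ∀ {n} {f : Fin n → ℚ} → (∀ i → 0# ≤ᵣ f i) → sum f ≡ 0# → ∀ i → f i ≡ 0#
sum-nonneg-≡0 {suc n} {f} h s zero with ℚP.<-cmp 0# (f zero)
... | tri< p _ _ = contradiction (sym s) (ℚP.<⇒≢ (+-pos-nonneg p (sum-nonneg (h ∘ suc))))
... | tri≈ _ e _ = sym e
... | tri> _ _ q = contradiction (h zero) (<⇒≱ᵣ q)
sum-nonneg-≡0 {suc n} {f} h s (suc i) = sum-nonneg-≡0 (h ∘ suc) s′ i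
  where
  s′ : sum (f ∘ suc) ≡ 0#
  s′ = trans (sym (+-identityˡ _)) (trans (cong (_+ sum (f ∘ suc)) (sym (sum-nonneg-≡0 h s zero))) s)

δ : ∀ {n} → Fin n → Fin n → ℚ
δ zero    zero    = 1#
δ zero    (suc j) = 0#
δ (suc i) zero    = 0#
δ (suc i) (suc j) = δ i j

δ-refl : ∀ {n} (i : Fin n) → δ i i ≡ 1#
δ-refl zero    = refl
δ-refl (suc i) = δ-refl i

δ-≢ : ∀ {n} {i j : Fin n} → i ≢ j → δ i j ≡ 0#
δ-≢ {i = zero}  {zero}  ne = contradiction refl ne
δ-≢ {i = zero}  {suc j} ne = refl
δ-≢ {i = suc i} {zero}  ne = refl
δ-≢ {i = suc i} {suc j} ne = δ-≢ (ne ∘ cong suc)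

sum-δ : ∀ {n} (i : Fin n) (f : Fin n → ℚ) → sum (λ j → δ i j * f j) ≡ f i
sum-δ zero f = begin
  1# * f zero + sum (λ j → 0# * f (suc j))
    ≡⟨ cong₂ _+_ (*-identityˡ _) (sum-0 λ j → zeroˡ (f (suc j))) ⟩
  f zero + 0#
    ≡⟨ +-identityʳ _ ⟩
  f zero ∎
sum-δ (suc i) f = begin
  0# * f zero + sum (λ j → δ i j * f (suc j))
    ≡⟨ cong₂ _+_ (zeroˡ (f zero)) (sum-δ i (f ∘ suc)) ⟩
  0# + f (suc i)
    ≡⟨ +-identityˡ _ ⟩
  f (suc i) ∎

module _ {m D : ℕ} where

  comb : (Fin m → ℚ) → (Fin m → Fin D → ℚ) → Fin D → ℚ
  comb z a j = sum (λ i → z i * a i j)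

  Dependency : (Fin m → Fin D → ℚ) → (Fin m → ℚ) → Set
  Dependency a z = ∀ j → comb z a j ≡ 0#

  Nontrivial : (Fin m → ℚ) → Set
  Nontrivial z = ∃[ i ] z i ≢ 0#

  SupportedIn : Vec Bool m → (Fin m → ℚ) → Set
  SupportedIn S z = ∀ i → lookup S i ≡ false → z i ≡ 0#

  Independent : (Fin m → Fin D → ℚ) → Vec Bool m → Set
  Independent a S = ∀ z → SupportedIn S z → Dependency a z → ∀ i → z i ≡ 0#

  comb-+ : ∀ z z′ a j → comb (λ i → z i + z′ i) a j ≡ comb z a j + comb z′ a j
  comb-+ z z′ a j = trans (sum-cong λ i → distribʳ (a i j) (z i) (z′ i)) (sum-+ (λ i → z i * a i j) (λ i → z′ i * a i j))

  comb-neg : ∀ z a j → comb (λ i → - z i) a j ≡ - comb z a j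
  comb-neg z a j = trans (sum-cong λ i → sym (neg-distribˡ-* (z i) (a i j))) (sum-neg (λ i → z i * a i j))

  comb-- : ∀ z z′ a j → comb (λ i → z i - z′ i) a j ≡ comb z a j - comb z′ a j
  comb-- z z′ a j = trans (comb-+ z (λ i → - z′ i) a j) (cong (comb z a j +_) (comb-neg z′ a j))

  comb-* : ∀ x z a j → comb (λ i → x * z i) a j ≡ x * comb z a j
  comb-* x z a j = trans (sum-cong λ i → *-assoc x (z i) (a i j)) (sum-*ˡ x (λ i → z i * a i j))

  comb-cong : ∀ {z z′} a → (∀ i → z i ≡ z′ i) → ∀ j → comb z a j ≡ comb z′ a j
  comb-cong a e j = sum-cong λ i → cong (_* a i j) (e i)

  comb-congʳ : ∀ z {a a′ : Fin m → Fin D → ℚ} j → (∀ i → a i j ≡ a′ i j) → comb z a j ≡ comb z a′ j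
  comb-congʳ z j e = sum-cong λ i → cong (z i *_) (e i)

comb-comb : ∀ {n m D} (z : Fin n → ℚ) (γ : Fin n → Fin m → ℚ) (a : Fin m → Fin D → ℚ) j →
            comb z (λ k → comb (γ k) a) j ≡ comb (comb z γ) a j
comb-comb z γ a j = begin
  sum (λ k → z k * sum (λ i → γ k i * a i j))    ≡⟨ sum-cong (λ k → sym (sum-*ˡ (z k) λ i → γ k i * a i j)) ⟩
  sum (λ k → sum (λ i → z k * (γ k i * a i j)))  ≡⟨ sum-comm (λ k i → z k * (γ k i * a i j)) ⟩
  sum (λ i → sum (λ k → z k * (γ k i * a i j)))  ≡⟨ sum-cong (λ i → trans (sum-cong λ k → sym (*-assoc (z k) (γ k i) (a i j))) (sum-*ʳ (a i j) λ k → z k * γ k i)) ⟩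
  sum (λ i → comb z γ i * a i j)                  ∎

-- Elimination at a coordinate `p` where the first vector is nonzero: subtracting multiples of that
-- vector clears `p` from the others, which leaves `n` vectors with one coordinate fewer.
dependent : ∀ {n r} → r < n → (γ : Fin n → Fin r → ℚ) → ∃[ z ] Nontrivial {D = r} z × Dependency γ z
dependent {suc n} {zero} _ γ = δ zero , (zero , 1≢0) , λ ()
dependent {suc n} {suc r} (s≤s r<n) γ with FinP.all? (λ j → γ zero j ℚP.≟ 0#)
... | yes γ₀≡0 = δ zero , (zero , 1≢0) , λ j → trans (sum-δ zero (λ i → γ i j)) (γ₀≡0 j)
... | no γ₀≢0 = z , (suc i , zi≢0) , dep
  where
  found = FinP.¬∀⟶∃¬ (suc r) _ (λ j → γ zero j ℚP.≟ 0#) γ₀≢0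
  p = proj₁ found
  inv = inverse (γ zero p) (proj₂ found)
  u = proj₁ inv
  ρ : Fin n → ℚ
  ρ k = γ (suc k) p * u
  γ′ : Fin n → Fin r → ℚ
  γ′ k l = γ (suc k) (punchIn p l) - ρ k * γ zero (punchIn p l)
  ih = dependent r<n γ′
  z′ = proj₁ ih
  i = proj₁ (proj₁ (proj₂ ih))
  zi≢0 = proj₂ (proj₁ (proj₂ ih))
  z : Fin (suc n) → ℚ
  z zero    = - sum (λ k → z′ k * ρ k)
  z (suc k) = z′ k
  split : ∀ j → comb z γ j ≡ sum (λ k → z′ k * (γ (suc k) j - ρ k * γ zero j))
  split j = sym $ begin
    sum (λ k → z′ k * (γ (suc k) j - ρ k * γ zero j))
      ≡⟨ sum-cong (λ k → distr (z′ k) (γ (suc k) j) (ρ k) (γ zero j)) ⟩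
    sum (λ k → - ((z′ k * ρ k) * γ zero j) + z′ k * γ (suc k) j)
      ≡⟨ sum-+ (λ k → - ((z′ k * ρ k) * γ zero j)) (λ k → z′ k * γ (suc k) j) ⟩
    sum (λ k → - ((z′ k * ρ k) * γ zero j)) + sum (λ k → z′ k * γ (suc k) j)
      ≡⟨ cong (_+ sum (λ k → z′ k * γ (suc k) j)) (trans (sum-neg λ k → (z′ k * ρ k) * γ zero j)
           (trans (cong -_ (sum-*ʳ (γ zero j) λ k → z′ k * ρ k)) (neg-distribˡ-* _ (γ zero j)))) ⟩
    comb z γ j ∎
    where
    opaque
      unfolding _+_
      distr : ∀ z g r h → z * (g - r * h) ≡ - ((z * r) * h) + z * g
      distr = solve-∀ ℚ-ring
  opaque
    unfolding _+_
    cancel : ∀ g u h → g - (g * u) * h ≡ g * (1# - u * h)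
    cancel = solve-∀ ℚ-ring
  dep : Dependency γ z
  dep j with p Fin.≟ j
  ... | yes refl = trans (split p) (sum-0 λ k → trans (cong (z′ k *_) (begin
          γ (suc k) p - ρ k * γ zero p         ≡⟨ cancel (γ (suc k) p) u (γ zero p) ⟩
          γ (suc k) p * (1# - u * γ zero p)    ≡⟨ cong (λ e → γ (suc k) p * (1# - e)) (proj₂ inv) ⟩
          γ (suc k) p * (1# - 1#)              ≡⟨ cong (γ (suc k) p *_) (+-inverseʳ 1#) ⟩
          γ (suc k) p * 0#                     ≡⟨ zeroʳ _ ⟩
          0# ∎)) (zeroʳ _))
  ... | no p≢j = subst (λ j → comb z γ j ≡ 0#) (FinP.punchIn-punchOut p≢j)
                   (trans (split _) (proj₂ (proj₂ ih) (Fin.punchOut p≢j)))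

-- Either a dependency inside S, or functionals ℓ reading off the coefficients of any combination of S.
gauss : ∀ {m D} (a : Fin m → Fin D → ℚ) (S : Vec Bool m) →
        (∃[ z ] SupportedIn {D = D} S z × Nontrivial {D = D} z × Dependency a z) ⊎
        (Σ (Fin m → Fin D → ℚ) λ ℓ → (∀ i → lookup S i ≡ false → ∀ j → ℓ i j ≡ 0#) ×
                (∀ z → SupportedIn {D = D} S z → ∀ i → sum (λ j → ℓ i j * comb z a j) ≡ z i))
gauss {zero} a [] = inj₂ ((λ ()) , (λ ()) , λ z _ ())
gauss {suc m} {D} a (s ∷ S) with gauss (a ∘ suc) S
... | inj₁ (z , sup , (i , zi≢0) , dep) = inj₁ (z⁺ , sup⁺ , (suc i , zi≢0) , λ j →
        trans (cong (_+ comb z (a ∘ suc) j) (zeroˡ (a zero j))) (trans (+-identityˡ _) (dep j)))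
  where
  z⁺ : Fin (suc m) → ℚ
  z⁺ zero    = 0#
  z⁺ (suc i) = z i
  sup⁺ : SupportedIn {D = D} (s ∷ S) z⁺
  sup⁺ zero    _ = refl
  sup⁺ (suc i) e = sup i e
gauss {suc m} {D} a (false ∷ S) | inj₂ (ℓ , off , dual) = inj₂ (ℓ⁺ , off⁺ , dual⁺)
  where
  ℓ⁺ : Fin (suc m) → Fin D → ℚ
  ℓ⁺ zero    j = 0#
  ℓ⁺ (suc i) j = ℓ i j
  off⁺ : ∀ i → lookup (false ∷ S) i ≡ false → ∀ j → ℓ⁺ i j ≡ 0#
  off⁺ zero    _ j = refl
  off⁺ (suc i) e j = off i e j
  dual⁺ : ∀ z → SupportedIn {D = D} (false ∷ S) z → ∀ i → sum (λ j → ℓ⁺ i j * comb z a j) ≡ z i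
  dual⁺ z sup zero    = trans (sum-0 λ j → zeroˡ (comb z a j)) (sym (sup zero refl))
  dual⁺ z sup (suc i) = trans (sum-cong λ j → cong (ℓ i j *_)
    (trans (cong (λ e → e * a zero j + comb (z ∘ suc) (a ∘ suc) j) (sup zero refl))
      (trans (cong (_+ comb (z ∘ suc) (a ∘ suc) j) (zeroˡ (a zero j))) (+-identityˡ _))))
    (dual (z ∘ suc) (sup ∘ suc) i)
gauss {suc m} {D} a (true ∷ S) | inj₂ (ℓ , off , dual) with FinP.all? (λ j → comb (λ i → - sum (λ j → ℓ i j * a zero j)) (a ∘ suc) j + a zero j ℚP.≟ 0#)
... | yes r≡0 = inj₁ (z⁺ , sup⁺ , (zero , 1≢0) , λ j →
        trans (trans (cong (_+ comb (λ i → - sum (λ j → ℓ i j * a zero j)) (a ∘ suc) j) (*-identityˡ (a zero j))) (+-comm (a zero j) _)) (r≡0 j))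
  where
  z⁺ : Fin (suc m) → ℚ
  z⁺ zero    = 1#
  z⁺ (suc i) = - sum (λ j → ℓ i j * a zero j)
  sup⁺ : SupportedIn {D = D} (true ∷ S) z⁺
  sup⁺ (suc i) e = trans (cong -_ (sum-0 λ j → trans (cong (_* a zero j) (off i e j)) (zeroˡ _))) neg-0
... | no r≢0 = inj₂ (ℓ⁺ , off⁺ , dual⁺)
  where
  τ : Fin m → ℚ
  τ i = sum (λ j → ℓ i j * a zero j)
  r : Fin D → ℚ
  r j = comb (λ i → - τ i) (a ∘ suc) j + a zero j
  found = FinP.¬∀⟶∃¬ D _ (λ j → r j ℚP.≟ 0#) r≢0
  p = proj₁ found
  inv = inverse (r p) (proj₂ found)
  u = proj₁ inv
  -- Coordinate `p` of the residual v - Σ (ℓ_i v) a_i, divided by its value `r p` at the new vector;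
  -- it vanishes on the old vectors of S and is 1 on the new one.
  ℓ₀ : Fin D → ℚ
  ℓ₀ j = u * (δ p j - sum (λ i → a (suc i) p * ℓ i j))
  ℓ⁺ : Fin (suc m) → Fin D → ℚ
  ℓ⁺ zero    j = ℓ₀ j
  ℓ⁺ (suc i) j = ℓ i j - τ i * ℓ₀ j
  off⁺ : ∀ i → lookup (true ∷ S) i ≡ false → ∀ j → ℓ⁺ i j ≡ 0#
  off⁺ (suc i) e j = begin
    ℓ i j - τ i * ℓ₀ j   ≡⟨ cong₂ (λ x t → x - t * ℓ₀ j) (off i e j) (sum-0 λ j → trans (cong (_* a zero j) (off i e j)) (zeroˡ _)) ⟩
    0# - 0# * ℓ₀ j       ≡⟨ eq (ℓ₀ j) ⟩
    0#                   ∎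
    where
    opaque
      unfolding _+_
      eq : ∀ x → 0# - 0# * x ≡ 0#
      eq = solve-∀ ℚ-ring
  dual⁺ : ∀ z → SupportedIn {D = D} (true ∷ S) z → ∀ i → sum (λ j → ℓ⁺ i j * comb z a j) ≡ z i
  dual⁺ z sup = λ { zero → on₀ ; (suc i) → onₛ i }
    where
    v = comb z a
    z′ = z ∘ suc
    onℓ : ∀ i → sum (λ j → ℓ i j * v j) ≡ z zero * τ i + z′ i
    onℓ i = begin
      sum (λ j → ℓ i j * (z zero * a zero j + comb z′ (a ∘ suc) j))
        ≡⟨ sum-cong (λ j → eq (ℓ i j) (z zero) (a zero j) _) ⟩
      sum (λ j → z zero * (ℓ i j * a zero j) + ℓ i j * comb z′ (a ∘ suc) j)
        ≡⟨ sum-+ (λ j → z zero * (ℓ i j * a zero j)) (λ j → ℓ i j * comb z′ (a ∘ suc) j) ⟩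
      sum (λ j → z zero * (ℓ i j * a zero j)) + sum (λ j → ℓ i j * comb z′ (a ∘ suc) j)
        ≡⟨ cong₂ _+_ (sum-*ˡ (z zero) λ j → ℓ i j * a zero j) (dual z′ (sup ∘ suc) i) ⟩
      z zero * τ i + z′ i ∎
      where
      opaque
        unfolding _+_
        eq : ∀ l z a c → l * (z * a + c) ≡ z * (l * a) + l * c
        eq = solve-∀ ℚ-ring
    on₀ : sum (λ j → ℓ₀ j * v j) ≡ z zero
    on₀ = begin
      sum (λ j → u * (δ p j - sum (λ i → a (suc i) p * ℓ i j)) * v j)
        ≡⟨ sum-cong (λ j → trans (eq₁ u (δ p j) _ (v j))
             (cong (λ e → u * (δ p j * v j + - e)) (trans (sym (sum-*ʳ (v j) λ i → a (suc i) p * ℓ i j)) (sum-cong λ i → *-assoc (a (suc i) p) (ℓ i j) (v j))))) ⟩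
      sum (λ j → u * (δ p j * v j + - sum (λ i → a (suc i) p * (ℓ i j * v j))))
        ≡⟨ sum-*ˡ u (λ j → δ p j * v j + - sum (λ i → a (suc i) p * (ℓ i j * v j))) ⟩
      u * sum (λ j → δ p j * v j + - sum (λ i → a (suc i) p * (ℓ i j * v j)))
        ≡⟨ cong (u *_) (trans (sum-+ (λ j → δ p j * v j) (λ j → - sum (λ i → a (suc i) p * (ℓ i j * v j))))
             (cong₂ _+_ (sum-δ p v) (trans (sum-neg λ j → sum (λ i → a (suc i) p * (ℓ i j * v j)))
               (cong -_ (trans (sum-comm λ j i → a (suc i) p * (ℓ i j * v j))
                 (sum-cong λ i → trans (sum-*ˡ (a (suc i) p) λ j → ℓ i j * v j) (cong (a (suc i) p *_) (onℓ i)))))))) ⟩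
      u * (v p - sum (λ i → a (suc i) p * (z zero * τ i + z′ i)))
        ≡⟨ cong (λ e → u * (v p - e)) (trans (sum-cong λ i → eq₂ (a (suc i) p) (z zero) (τ i) (z′ i))
             (trans (sum-+ (λ i → - z zero * (- τ i * a (suc i) p)) (λ i → z′ i * a (suc i) p))
               (cong (_+ comb z′ (a ∘ suc) p) (sum-*ˡ (- z zero) λ i → - τ i * a (suc i) p)))) ⟩
      u * (v p - (- z zero * comb (λ i → - τ i) (a ∘ suc) p + comb z′ (a ∘ suc) p))
        ≡⟨ eq₃ u (z zero) (a zero p) _ _ ⟩
      z zero * (u * r p)
        ≡⟨ trans (cong (z zero *_) (proj₂ inv)) (*-identityʳ _) ⟩
      z zero ∎
      where
      opaque
        unfolding _+_
        eq₁ : ∀ u d s v → u * (d - s) * v ≡ u * (d * v + - (s * v))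
        eq₁ = solve-∀ ℚ-ring
        eq₂ : ∀ a z t z′ → a * (z * t + z′) ≡ - z * (- t * a) + z′ * a
        eq₂ = solve-∀ ℚ-ring
        eq₃ : ∀ u z a c c′ → u * (z * a + c′ - (- z * c + c′)) ≡ z * (u * (c + a))
        eq₃ = solve-∀ ℚ-ring
    onₛ : ∀ i → sum (λ j → (ℓ i j - τ i * ℓ₀ j) * v j) ≡ z′ i
    onₛ i = begin
      sum (λ j → (ℓ i j - τ i * ℓ₀ j) * v j)
        ≡⟨ sum-cong (λ j → eq₁ (ℓ i j) (τ i) (ℓ₀ j) (v j)) ⟩
      sum (λ j → ℓ i j * v j + - τ i * (ℓ₀ j * v j))
        ≡⟨ trans (sum-+ (λ j → ℓ i j * v j) (λ j → - τ i * (ℓ₀ j * v j))) (cong₂ _+_ (onℓ i) (trans (sum-*ˡ (- τ i) λ j → ℓ₀ j * v j) (cong (- τ i *_) on₀))) ⟩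
      z zero * τ i + z′ i + - τ i * z zero
        ≡⟨ eq₂ (z zero) (τ i) (z′ i) ⟩
      z′ i ∎
      where
      opaque
        unfolding _+_
        eq₁ : ∀ l t l₀ v → (l - t * l₀) * v ≡ l * v + - t * (l₀ * v)
        eq₁ = solve-∀ ℚ-ring
        eq₂ : ∀ z t z′ → z * t + z′ + - t * z ≡ z′
        eq₂ = solve-∀ ℚ-ring

-- Lexicographically ordered tuples: a tuple w stands for Σ w_k ε^k with ε infinitesimal.

Pos : ∀ {N} → (Fin N → ℚ) → Set
Pos {zero}  w = ⊥
Pos {suc N} w = 0# <ᵣ w zero ⊎ (w zero ≡ 0# × Pos (w ∘ suc))

IsZero : ∀ {N} → (Fin N → ℚ) → Set
IsZero w = ∀ k → w k ≡ 0#

NonNeg : ∀ {N} → (Fin N → ℚ) → Set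
NonNeg w = IsZero w ⊎ Pos w

pos-cong : ∀ {N} {w v : Fin N → ℚ} → (∀ k → w k ≡ v k) → Pos w → Pos v
pos-cong {suc N} e (inj₁ p)       = inj₁ (subst (0# <ᵣ_) (e zero) p)
pos-cong {suc N} e (inj₂ (z , p)) = inj₂ (trans (sym (e zero)) z , pos-cong (e ∘ suc) p)

nonneg-cong : ∀ {N} {w v : Fin N → ℚ} → (∀ k → w k ≡ v k) → NonNeg w → NonNeg v
nonneg-cong e (inj₁ z) = inj₁ λ k → trans (sym (e k)) (z k)
nonneg-cong e (inj₂ p) = inj₂ (pos-cong e p)

pos-≢0 : ∀ {N} {w : Fin N → ℚ} → Pos w → ¬ IsZero w
pos-≢0 {suc N} (inj₁ p)       z = ℚP.<-irrefl (sym (z zero)) p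
pos-≢0 {suc N} (inj₂ (_ , p)) z = pos-≢0 p (z ∘ suc)

pos-+ : ∀ {N} {w v : Fin N → ℚ} → Pos w → Pos v → Pos (λ k → w k + v k)
pos-+ {suc N} (inj₁ p)       (inj₁ q)       = inj₁ (+-pos-nonneg p (ℚP.<⇒≤ q))
pos-+ {suc N} (inj₁ p)       (inj₂ (z , _)) = inj₁ (+-pos-nonneg p (ℚP.≤-reflexive (sym z)))
pos-+ {suc N} (inj₂ (z , _)) (inj₁ q)       = inj₁ (+-nonneg-pos (ℚP.≤-reflexive (sym z)) q)
pos-+ {suc N} (inj₂ (z , p)) (inj₂ (y , q)) = inj₂ (trans (cong₂ _+_ z y) (+-identityʳ 0#) , pos-+ p q)

pos-+-nonneg : ∀ {N} {w v : Fin N → ℚ} → Pos w → NonNeg v → Pos (λ k → w k + v k)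
pos-+-nonneg {w = w} p (inj₁ z) = pos-cong (λ k → sym (trans (cong (w k +_) (z k)) (+-identityʳ (w k)))) p
pos-+-nonneg p (inj₂ q) = pos-+ p q

nonneg-+ : ∀ {N} {w v : Fin N → ℚ} → NonNeg w → NonNeg v → NonNeg (λ k → w k + v k)
nonneg-+ (inj₂ p) q = inj₂ (pos-+-nonneg p q)
nonneg-+ {v = v} (inj₁ z) q = nonneg-cong (λ k → sym (trans (cong (_+ v k) (z k)) (+-identityˡ (v k)))) q

pos-* : ∀ {N x} {w : Fin N → ℚ} → 0# <ᵣ x → Pos w → Pos (λ k → w k * x)
pos-* {suc N}     x>0 (inj₁ p)       = inj₁ (*-pos p x>0)
pos-* {suc N} {x} x>0 (inj₂ (z , p)) = inj₂ (trans (cong (_* x) z) (zeroˡ x) , pos-* x>0 p)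

nonneg-* : ∀ {N x} {w : Fin N → ℚ} → 0# ≤ᵣ x → NonNeg w → NonNeg (λ k → w k * x)
nonneg-* {x = x} x≥0 (inj₁ z) = inj₁ λ k → trans (cong (_* x) (z k)) (zeroˡ x)
nonneg-* {x = x} {w} x≥0 (inj₂ p) with ℚP.<-cmp 0# x
... | tri< x>0 _ _ = inj₂ (pos-* x>0 p)
... | tri≈ _ x≡0 _ = inj₁ λ k → trans (cong (w k *_) (sym x≡0)) (zeroʳ (w k))
... | tri> _ _ x<0 = contradiction x≥0 (<⇒≱ᵣ x<0)

pos-tri : ∀ {N} (w : Fin N → ℚ) → Pos w ⊎ IsZero w ⊎ Pos (λ k → - w k)
pos-tri {zero}  w = inj₂ (inj₁ λ ())
pos-tri {suc N} w with ℚP.<-cmp 0# (w zero)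
... | tri< p _ _ = inj₁ (inj₁ p)
... | tri> _ _ n = inj₂ (inj₂ (inj₁ (neg-pos n)))
... | tri≈ _ z _ with pos-tri (w ∘ suc)
...   | inj₁ p        = inj₁ (inj₂ (sym z , p))
...   | inj₂ (inj₁ y) = inj₂ (inj₁ λ { zero → sym z ; (suc k) → y k })
...   | inj₂ (inj₂ n) = inj₂ (inj₂ (inj₂ (trans (cong -_ (sym z)) neg-0 , n)))

pos-asym : ∀ {N} {w : Fin N → ℚ} → Pos w → ¬ NonNeg (λ k → - w k)
pos-asym {w = w} p q = pos-≢0 (pos-+-nonneg p q) λ k → +-inverseʳ (w k)

pos? : ∀ {N} (w : Fin N → ℚ) → Dec (Pos w)
pos? w with pos-tri w
... | inj₁ p        = yes p
... | inj₂ (inj₁ z) = no λ p → pos-≢0 p z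
... | inj₂ (inj₂ n) = no λ p → pos-asym p (inj₂ n)

nonneg? : ∀ {N} (w : Fin N → ℚ) → Dec (NonNeg w)
nonneg? w with pos-tri w
... | inj₁ p        = yes (inj₂ p)
... | inj₂ (inj₁ z) = yes (inj₁ z)
... | inj₂ (inj₂ n) = no λ { (inj₁ z) → pos-≢0 n (λ k → trans (cong -_ (z k)) neg-0)
                           ; (inj₂ p) → pos-asym p (inj₂ n) }

¬nonneg⇒pos-neg : ∀ {N} {w : Fin N → ℚ} → ¬ NonNeg w → Pos (λ k → - w k)
¬nonneg⇒pos-neg {w = w} ¬nn with pos-tri w
... | inj₁ p        = contradiction (inj₂ p) ¬nn
... | inj₂ (inj₁ z) = contradiction (inj₁ z) ¬nn
... | inj₂ (inj₂ n) = n

-- Once M u + e is positive with u > 0, it stays positive when M grows, so the larger of two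
-- thresholds serves both. The threshold `M₀` makes the first value equal to 1.
large-multiplier : ∀ {n} (u e : Fin n → ℚ) → ∃[ M ] ∀ i → 0# <ᵣ u i → 0# <ᵣ M * u i + e i
large-multiplier {zero}  u e = 0# , λ ()
large-multiplier {suc n} u e with large-multiplier (u ∘ suc) (e ∘ suc) | ℚP.<-cmp 0# (u zero)
... | M , ok | tri≈ ¬u>0 _ _ = M , λ { zero u>0 → contradiction u>0 ¬u>0 ; (suc i) → ok i }
... | M , ok | tri> ¬u>0 _ _ = M , λ { zero u>0 → contradiction u>0 ¬u>0 ; (suc i) → ok i }
... | M , ok | tri< u₀>0 _ _ = choose (ℚP.≤-total M M₀)
  where
  y : ℚ
  y = proj₁ (inverse-pos (u zero) u₀>0)
  M₀ : ℚ
  M₀ = (1# - e zero) * y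
  grow : ∀ {M M′ x e} → M ≤ᵣ M′ → 0# <ᵣ x → 0# <ᵣ M * x + e → 0# <ᵣ M′ * x + e
  grow {M} {M′} {x} {e} M≤M′ x>0 h = subst (0# <ᵣ_) (eq M M′ x e) (+-pos-nonneg h (*-nonneg (diff-nonneg M≤M′) (ℚP.<⇒≤ x>0)))
    where
    opaque
      unfolding _+_
      eq : ∀ M M′ x e → M * x + e + (M′ - M) * x ≡ M′ * x + e
      eq = solve-∀ ℚ-ring
  at₀ : 0# <ᵣ M₀ * u zero + e zero
  at₀ = subst (0# <ᵣ_) (sym (trans (eq (e zero) y (u zero)) (trans (cong (λ q → (1# - e zero) * q + e zero) (proj₁ (proj₂ (inverse-pos (u zero) u₀>0)))) (eq₂ (e zero))))) 0<1
    where
    opaque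
      unfolding _+_
      eq : ∀ e y u → (1# - e) * y * u + e ≡ (1# - e) * (y * u) + e
      eq = solve-∀ ℚ-ring
      eq₂ : ∀ e → (1# - e) * 1# + e ≡ 1#
      eq₂ = solve-∀ ℚ-ring
  choose : M ≤ᵣ M₀ ⊎ M₀ ≤ᵣ M → ∃[ M ] ∀ i → 0# <ᵣ u i → 0# <ᵣ M * u i + e i
  choose (inj₁ M≤M₀) = M₀ , λ { zero _ → at₀ ; (suc i) ui>0 → grow M≤M₀ ui>0 (ok i ui>0) }
  choose (inj₂ M₀≤M) = M , λ { zero ui>0 → grow M₀≤M ui>0 at₀ ; (suc i) → ok i }

-- Substituting a small rational for ε, up to a positive factor.
positive-functional : ∀ {n N} (w : Fin n → Fin N → ℚ) → Σ (Fin N → ℚ) λ p → ∀ i → Pos (w i) → 0# <ᵣ sum (λ k → p k * w i k)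
positive-functional {n} {zero}  w = (λ ()) , λ i ()
positive-functional {n} {suc N} w with positive-functional (λ i → w i ∘ suc)
... | p , ok with large-multiplier (λ i → w i zero) (λ i → sum (λ k → p k * w i (suc k)))
...   | M , big = p⁺ , ok⁺
  where
  p⁺ : Fin (suc N) → ℚ
  p⁺ zero    = M
  p⁺ (suc k) = p k
  ok⁺ : ∀ i → Pos (w i) → 0# <ᵣ sum (λ k → p⁺ k * w i k)
  ok⁺ i (inj₁ q)       = big i q
  ok⁺ i (inj₂ (z , q)) = +-nonneg-pos (ℚP.≤-reflexive (sym (trans (cong (M *_) z) (zeroʳ M)))) (ok i q)

-- Lexicographic comparison of coefficient vectors

LexPos : ∀ {m N} → (Fin m → Fin N → ℚ) → Set
LexPos {zero}  z = ⊥
LexPos {suc m} z = Pos (z zero) ⊎ (IsZero (z zero) × LexPos (z ∘ suc))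

_≽_ : ∀ {m N} (c c′ : Fin m → Fin N → ℚ) → Set
c ≽ c′ = (∀ i → IsZero (λ k → c i k - c′ i k)) ⊎ LexPos (λ i k → c i k - c′ i k)

lexpos-cong : ∀ {m N} {z z′ : Fin m → Fin N → ℚ} → (∀ i k → z i k ≡ z′ i k) → LexPos z → LexPos z′
lexpos-cong {suc m} e (inj₁ p)       = inj₁ (pos-cong (e zero) p)
lexpos-cong {suc m} e (inj₂ (y , p)) = inj₂ ((λ k → trans (sym (e zero k)) (y k)) , lexpos-cong (e ∘ suc) p)

lexpos-+ : ∀ {m N} {z z′ : Fin m → Fin N → ℚ} → LexPos z → LexPos z′ → LexPos (λ i k → z i k + z′ i k)
lexpos-+ {suc m} (inj₁ p)       (inj₁ q)       = inj₁ (pos-+ p q)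
lexpos-+ {suc m} (inj₁ p)       (inj₂ (y , _)) = inj₁ (pos-+-nonneg p (inj₁ y))
lexpos-+ {suc m} {z = z} {z′} (inj₂ (y , _)) (inj₁ q) = inj₁ (pos-cong (λ k → +-comm (z′ zero k) (z zero k)) (pos-+-nonneg q (inj₁ y)))
lexpos-+ {suc m} (inj₂ (y , p)) (inj₂ (x , q)) = inj₂ ((λ k → trans (cong₂ _+_ (y k) (x k)) (+-identityʳ 0#)) , lexpos-+ p q)

lexpos-tri : ∀ {m N} (z : Fin m → Fin N → ℚ) → LexPos z ⊎ (∀ i → IsZero (z i)) ⊎ LexPos (λ i k → - z i k)
lexpos-tri {zero}  z = inj₂ (inj₁ λ ())
lexpos-tri {suc m} z with pos-tri (z zero)
... | inj₁ p        = inj₁ (inj₁ p)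
... | inj₂ (inj₂ n) = inj₂ (inj₂ (inj₁ n))
... | inj₂ (inj₁ y) with lexpos-tri (z ∘ suc)
...   | inj₁ p        = inj₁ (inj₂ (y , p))
...   | inj₂ (inj₁ x) = inj₂ (inj₁ λ { zero → y ; (suc i) → x i })
...   | inj₂ (inj₂ n) = inj₂ (inj₂ (inj₂ ((λ k → trans (cong -_ (y k)) neg-0) , n)))

lexpos-≢0 : ∀ {m N} {z : Fin m → Fin N → ℚ} → LexPos z → ¬ (∀ i → IsZero (z i))
lexpos-≢0 {suc m} (inj₁ p)       y = pos-≢0 p (y zero)
lexpos-≢0 {suc m} (inj₂ (_ , p)) y = lexpos-≢0 p (y ∘ suc)

-- The first nonzero row of this rank-one array is the positive tuple `w` scaled by the first
-- nonzero entry of `ζ`, which is positive.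
lexpos-⊗ : ∀ {m N} {w : Fin N → ℚ} {ζ : Fin m → ℚ} → Pos w → Pos ζ → LexPos (λ i k → w k * ζ i)
lexpos-⊗ {suc m}         p (inj₁ q)       = inj₁ (pos-* q p)
lexpos-⊗ {suc m} {w = w} p (inj₂ (z , q)) = inj₂ ((λ k → trans (cong (w k *_) z) (zeroʳ (w k))) , lexpos-⊗ p q)

≽-trans : ∀ {m N} {a b c : Fin m → Fin N → ℚ} → a ≽ b → b ≽ c → a ≽ c
≽-trans {a = a} {b} {c} = λ
  { (inj₁ p) (inj₁ q) → inj₁ λ i k → trans (telescope (a i k) (b i k) (c i k)) (trans (cong₂ _+_ (p i k) (q i k)) (+-identityʳ 0#))
  ; (inj₁ p) (inj₂ q) → inj₂ (lexpos-cong (λ i k → trans (sym (+-identityˡ _)) (trans (cong (_+ (b i k - c i k)) (sym (p i k))) (sym (telescope (a i k) (b i k) (c i k))))) q)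
  ; (inj₂ p) (inj₁ q) → inj₂ (lexpos-cong (λ i k → trans (sym (+-identityʳ _)) (trans (cong (a i k - b i k +_) (sym (q i k))) (sym (telescope (a i k) (b i k) (c i k))))) p)
  ; (inj₂ p) (inj₂ q) → inj₂ (lexpos-cong (λ i k → sym (telescope (a i k) (b i k) (c i k))) (lexpos-+ p q)) }
  where
  opaque
    unfolding _+_

    telescope : ∀ x y z → x - z ≡ (x - y) + (y - z)
    telescope = solve-∀ ℚ-ring

opaque
  unfolding _+_

  neg-diff : ∀ x y → - (x - y) ≡ y - x
  neg-diff = solve-∀ ℚ-ring

≽-total : ∀ {m N} (c c′ : Fin m → Fin N → ℚ) → c ≽ c′ ⊎ c′ ≽ c
≽-total c c′ with lexpos-tri (λ i k → c i k - c′ i k)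
... | inj₁ p        = inj₁ (inj₂ p)
... | inj₂ (inj₁ y) = inj₁ (inj₁ y)
... | inj₂ (inj₂ n) = inj₂ (inj₂ (lexpos-cong (λ i k → neg-diff (c i k) (c′ i k)) n))

≽-antisym : ∀ {m N} {c c′ : Fin m → Fin N → ℚ} → c ≽ c′ → ¬ LexPos (λ i k → c′ i k - c i k)
≽-antisym {c = c} {c′} (inj₁ z) n = lexpos-≢0 n λ i k → trans (sym (neg-diff (c i k) (c′ i k))) (trans (cong -_ (z i k)) neg-0)
≽-antisym {c = c} {c′} (inj₂ p) n = lexpos-≢0 (lexpos-+ p n) λ i k → cancel (c i k) (c′ i k)
  where
  opaque
    unfolding _+_

    cancel : ∀ x y → (x - y) + (y - x) ≡ 0#
    cancel = solve-∀ ℚ-ring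

maximum : ∀ {m N} (cs : List (Fin m → Fin N → ℚ)) → cs ≡ [] ⊎ ∃[ c ] c ∈ cs × (∀ {c′} → c′ ∈ cs → c ≽ c′)
maximum [] = inj₁ refl
maximum (c ∷ cs) with maximum cs
... | inj₁ refl = inj₂ (c , here refl , λ { (here refl) → inj₁ λ i k → +-inverseʳ (c i k) })
... | inj₂ (b , b∈cs , b-max) with ≽-total b c
...   | inj₁ b≽c = inj₂ (b , there b∈cs , λ { (here refl) → b≽c ; (there h) → b-max h })
...   | inj₂ c≽b = inj₂ (c , here refl , λ { (here refl) → inj₁ λ i k → +-inverseʳ (c i k) ; (there h) → ≽-trans c≽b (b-max h) })

-- Supports

count : ∀ {m} → Vec Bool m → ℕ
count []          = 0
count (true  ∷ S) = suc (count S)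
count (false ∷ S) = count S

count-mono : ∀ {m} (S S′ : Vec Bool m) → (∀ i → lookup S′ i ≡ true → lookup S i ≡ true) → count S′ ≤ count S
count-mono []          []           _ = z≤n
count-mono (true  ∷ S) (true  ∷ S′) h = s≤s (count-mono S S′ (h ∘ suc))
count-mono (true  ∷ S) (false ∷ S′) h = ℕP.m≤n⇒m≤1+n (count-mono S S′ (h ∘ suc))
count-mono (false ∷ S) (true  ∷ S′) h = contradiction (h zero refl) λ ()
count-mono (false ∷ S) (false ∷ S′) h = count-mono S S′ (h ∘ suc)

count-strict : ∀ {m} (S S′ : Vec Bool m) → (∀ i → lookup S′ i ≡ true → lookup S i ≡ true) →
               ∀ i → lookup S i ≡ true → lookup S′ i ≡ false → count S′ < count S
count-strict (true  ∷ S) (false ∷ S′) h zero    _ _ = s≤s (count-mono S S′ (h ∘ suc))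
count-strict (true  ∷ S) (true  ∷ S′) h (suc i) p q = s≤s (count-strict S S′ (h ∘ suc) i p q)
count-strict (true  ∷ S) (false ∷ S′) h (suc i) p q = ℕP.m≤n⇒m≤1+n (count-strict S S′ (h ∘ suc) i p q)
count-strict (false ∷ S) (true  ∷ S′) h (suc i) p q = contradiction (h zero refl) λ ()
count-strict (false ∷ S) (false ∷ S′) h (suc i) p q = count-strict S S′ (h ∘ suc) i p q

enum : ∀ {m} (S : Vec Bool m) → Fin (count S) → Fin m
enum (true  ∷ S) zero    = zero
enum (true  ∷ S) (suc k) = suc (enum S k)
enum (false ∷ S) k       = suc (enum S k)

enum-∈ : ∀ {m} (S : Vec Bool m) k → lookup S (enum S k) ≡ true
enum-∈ (true  ∷ S) zero    = refl
enum-∈ (true  ∷ S) (suc k) = enum-∈ S k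
enum-∈ (false ∷ S) k       = enum-∈ S k

enum-onto : ∀ {m} (S : Vec Bool m) i → lookup S i ≡ true → ∃[ k ] enum S k ≡ i
enum-onto (true  ∷ S) zero    _ = zero , refl
enum-onto (true  ∷ S) (suc i) p with enum-onto S i p
... | k , e = suc k , cong suc e
enum-onto (false ∷ S) (suc i) p with enum-onto S i p
... | k , e = k , cong suc e

enum-injective : ∀ {m} (S : Vec Bool m) {k l} → enum S k ≡ enum S l → k ≡ l
enum-injective (true  ∷ S) {zero}  {zero}  _ = refl
enum-injective (true  ∷ S) {suc k} {suc l} e = cong suc (enum-injective S (FinP.suc-injective e))
enum-injective (false ∷ S) e = enum-injective S (FinP.suc-injective e)

spread : ∀ {m} (S : Vec Bool m) → (Fin (count S) → ℚ) → Fin m → ℚ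
spread (true  ∷ S) z zero    = z zero
spread (true  ∷ S) z (suc i) = spread S (z ∘ suc) i
spread (false ∷ S) z zero    = 0#
spread (false ∷ S) z (suc i) = spread S z i

spread-enum : ∀ {m} (S : Vec Bool m) z k → spread S z (enum S k) ≡ z k
spread-enum (true  ∷ S) z zero    = refl
spread-enum (true  ∷ S) z (suc k) = spread-enum S (z ∘ suc) k
spread-enum (false ∷ S) z k       = spread-enum S z k

spread-off : ∀ {m} (S : Vec Bool m) z i → lookup S i ≡ false → spread S z i ≡ 0#
spread-off (true  ∷ S) z (suc i) p = spread-off S (z ∘ suc) i p
spread-off (false ∷ S) z zero    p = refl
spread-off (false ∷ S) z (suc i) p = spread-off S z i p

sum-spread : ∀ {m} (S : Vec Bool m) z (g : Fin m → ℚ) → sum (λ i → spread S z i * g i) ≡ sum (λ k → z k * g (enum S k))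
sum-spread []          z g = refl
sum-spread (true  ∷ S) z g = cong (z zero * g zero +_) (sum-spread S (z ∘ suc) (g ∘ suc))
sum-spread (false ∷ S) z g = trans (cong₂ _+_ (zeroˡ (g zero)) (sum-spread S z (g ∘ suc))) (+-identityˡ _)

sum-restrict : ∀ {m} (S : Vec Bool m) (z g : Fin m → ℚ) → (∀ i → lookup S i ≡ false → z i ≡ 0#) →
               sum (λ i → z i * g i) ≡ sum (λ k → z (enum S k) * g (enum S k))
sum-restrict []          z g sup = refl
sum-restrict (true  ∷ S) z g sup = cong (z zero * g zero +_) (sum-restrict S (z ∘ suc) (g ∘ suc) (sup ∘ suc))
sum-restrict (false ∷ S) z g sup = trans (cong₂ _+_ (trans (cong (_* g zero) (sup zero refl)) (zeroˡ (g zero)))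
                                     (sum-restrict S (z ∘ suc) (g ∘ suc) (sup ∘ suc))) (+-identityˡ _)

subsets : ∀ m → List (Vec Bool m)
subsets zero    = [] ∷ []
subsets (suc m) = List.map (true ∷_) (subsets m) ++ List.map (false ∷_) (subsets m)

∈-subsets : ∀ {m} (S : Vec Bool m) → S ∈ subsets m
∈-subsets []          = here refl
∈-subsets (true  ∷ S) = MemP.∈-++⁺ˡ (MemP.∈-map⁺ (true ∷_) (∈-subsets S))
∈-subsets (false ∷ S) = MemP.∈-++⁺ʳ (List.map (true ∷_) (subsets _)) (MemP.∈-map⁺ (false ∷_) (∈-subsets S))

lookup-injective : ∀ {A : Set} {m} (S S′ : Vec A m) → (∀ i → lookup S i ≡ lookup S′ i) → S ≡ S′
lookup-injective []      []        e = refl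
lookup-injective (_ ∷ S) (_ ∷ S′) e = cong₂ _∷_ (e zero) (lookup-injective S S′ (e ∘ suc))

-- Canonical representations of a point of a cone, i.e. the faces of a pulling triangulation.

module Cone {m D : ℕ} (a : Fin m → Fin D → ℚ) where

  -- No dependency leads from the cone over S to a lexicographically larger coefficient vector.
  Good : Vec Bool m → Set
  Good S = ∀ ζ → Dependency a ζ → (∀ i → lookup S i ≡ false → 0# ≤ᵣ ζ i) → ¬ Pos ζ

  -- `Good` speaks about rational dependencies only. A functional that is positive on all positive
  -- rows contracts a tuple-valued dependency to a rational one and keeps its lexicographic sign.
  good-lex : ∀ {N S} {z : Fin m → Fin N → ℚ} → Good S → (∀ k → Dependency a (λ i → z i k)) →
             (∀ i → lookup S i ≡ false → NonNeg (z i)) → ¬ LexPos z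
  good-lex {N} {S} {z} good dep off lp = good ζ dep-ζ off-ζ (pos-ζ z positive lp)
    where
    p : Fin N → ℚ
    p = proj₁ (positive-functional z)
    positive : ∀ i → Pos (z i) → 0# <ᵣ sum (λ k → p k * z i k)
    positive = proj₂ (positive-functional z)
    ζ : Fin m → ℚ
    ζ i = sum (λ k → p k * z i k)
    vanish : ∀ {w : Fin N → ℚ} → IsZero w → sum (λ k → p k * w k) ≡ 0#
    vanish y = sum-0 λ k → trans (cong (p k *_) (y k)) (zeroʳ (p k))
    dep-ζ : Dependency a ζ
    dep-ζ j = trans (sym (comb-comb p (λ k i → z i k) a j)) (vanish λ k → dep k j)
    off-ζ : ∀ i → lookup S i ≡ false → 0# ≤ᵣ ζ i
    off-ζ i e with off i e
    ... | inj₁ y = ℚP.≤-reflexive (sym (vanish y))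
    ... | inj₂ q = ℚP.<⇒≤ (positive i q)
    pos-ζ : ∀ {n} (z : Fin n → Fin N → ℚ) → (∀ i → Pos (z i) → 0# <ᵣ sum (λ k → p k * z i k)) →
            LexPos z → Pos (λ i → sum (λ k → p k * z i k))
    pos-ζ {suc n} z positive (inj₁ q)       = inj₁ (positive zero q)
    pos-ζ {suc n} z positive (inj₂ (y , q)) = inj₂ (vanish y , pos-ζ (z ∘ suc) (positive ∘ suc) q)

  -- A dependency inside S vanishes off S, so both `z` and its negative satisfy the sign condition
  -- of `Good`; unless `z` is zero, one of them is positive.
  good⇒independent : ∀ {S} → Good S → Independent a S
  good⇒independent {S} good z sup dep with pos-tri z
  ... | inj₁ p        = ⊥-elim (good z dep (λ i e → ℚP.≤-reflexive (sym (sup i e))) p)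
  ... | inj₂ (inj₁ y) = y
  ... | inj₂ (inj₂ n) = ⊥-elim (good (λ i → - z i) (λ j → trans (comb-neg z a j) (trans (cong -_ (dep j)) neg-0))
                          (λ i e → ℚP.≤-reflexive (sym (trans (cong -_ (sup i e)) neg-0))) n)

  record IsRep {N} (x : Fin N → Fin D → ℚ) (c : Fin m → Fin N → ℚ) : Set where
    constructor isRep
    field
      nonneg : ∀ i → NonNeg (c i)
      sums   : ∀ k j → comb (λ i → c i k) a j ≡ x k j

  open IsRep public

  record Canonical {N} (x : Fin N → Fin D → ℚ) : Set where
    field
      support : Vec Bool m
      coeff   : Fin m → Fin N → ℚ
      rep     : ∀ k j → comb (λ i → coeff i k) a j ≡ x k j
      good    : Good support
      inside  : ∀ i → lookup support i ≡ true → Pos (coeff i)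
      outside : ∀ i → lookup support i ≡ false → IsZero (coeff i)

    coeff-nonneg : ∀ i → NonNeg (coeff i)
    coeff-nonneg i with lookup support i in e
    ... | true  = inj₂ (inside i e)
    ... | false = inj₁ (outside i e)

    canonical-rep : IsRep x coeff
    canonical-rep = isRep coeff-nonneg rep

  open Canonical

  module _ {N} {x x′ : Fin N → Fin D → ℚ} (x≡x′ : ∀ k j → x k j ≡ x′ k j) (K : Canonical x) (K′ : Canonical x′) where

    private
      lex-≤ : ∀ {x x′ : Fin N → Fin D → ℚ} → (∀ k j → x k j ≡ x′ k j) → (K : Canonical x) (K′ : Canonical x′) →
              ¬ LexPos (λ i k → coeff K′ i k - coeff K i k)
      lex-≤ {x} {x′} x≡x′ K K′ = good-lex {S = support K} (good K)
        (λ k j → trans (comb-- (λ i → coeff K′ i k) (λ i → coeff K i k) a j)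
                   (trans (cong₂ _-_ (rep K′ k j) (trans (rep K k j) (x≡x′ k j))) (+-inverseʳ (x′ k j))))
        (λ i e → nonneg-cong (λ k → sym (minus-zero (outside K i e k))) (coeff-nonneg K′ i))

    -- Either difference is a dependency and is nonnegative off the support of the subtrahend, so
    -- `Good` forbids it to be lexicographically positive. Forbidding both directions leaves
    -- equality.
    canonical-unique : ∀ i k → coeff K i k ≡ coeff K′ i k
    canonical-unique i k with lexpos-tri (λ i k → coeff K i k - coeff K′ i k)
    ... | inj₁ p        = ⊥-elim (lex-≤ (λ k j → sym (x≡x′ k j)) K′ K p)
    ... | inj₂ (inj₁ y) = diff≡0 (y i k)
    ... | inj₂ (inj₂ n) = ⊥-elim (lex-≤ x≡x′ K K′ (lexpos-cong (λ i k → neg-diff (coeff K i k) (coeff K′ i k)) n))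

    support-unique : support K ≡ support K′
    support-unique = lookup-injective (support K) (support K′) λ i → same i
      where
      same : ∀ i → lookup (support K) i ≡ lookup (support K′) i
      same i with lookup (support K) i in e | lookup (support K′) i in e′
      ... | true  | true  = refl
      ... | false | false = refl
      ... | true  | false = contradiction (λ k → trans (canonical-unique i k) (outside K′ i e′ k)) (pos-≢0 (inside K i e))
      ... | false | true  = contradiction (λ k → trans (sym (canonical-unique i k)) (outside K i e k)) (pos-≢0 (inside K′ i e′))

  -- Fewer than `D` generators cannot span the `D` independent components selected by `φ`, and more
  -- than `D` generators in dimension `D` cannot be independent, as a good support is.
  support-size : ∀ {N} {x : Fin N → Fin D → ℚ} (K : Canonical x) (φ : Fin D → Fin N) →
                 (∀ z → (∀ j → comb z (x ∘ φ) j ≡ 0#) → ∀ k → z k ≡ 0#) → count (support K) ≡ D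
  support-size {N} {x} K φ generic with ℕP.<-cmp (count S) D
    where S = support K
  ... | tri≈ _ e _ = e
  ... | tri< S<D _ _ with dependent S<D (λ k l → coeff K (enum (support K) l) (φ k))
  ...   | z , (k , zk≢0) , dep = contradiction (generic z vanish k) zk≢0
    where
    S = support K
    expand : ∀ k j → x k j ≡ comb (λ l → coeff K (enum S l) k) (a ∘ enum S) j
    expand k j = trans (sym (rep K k j)) (sum-restrict S (λ i → coeff K i k) (λ i → a i j) (λ i e → outside K i e k))
    vanish : ∀ j → comb z (x ∘ φ) j ≡ 0#
    vanish j = trans (comb-congʳ z {x ∘ φ} {λ k → comb (λ l → coeff K (enum S l) (φ k)) (a ∘ enum S)} j (λ k → expand (φ k) j))
      (trans (comb-comb z (λ k l → coeff K (enum S l) (φ k)) (a ∘ enum S) j)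
        (sum-0 λ l → trans (cong (_* a (enum S l) j) (dep l)) (zeroˡ _)))
  support-size {N} {x} K φ generic | tri> _ _ D<S with dependent D<S (a ∘ enum (support K))
  ...   | z , (k , zk≢0) , dep = contradiction (trans (sym (spread-enum S z k)) (independent (enum S k))) zk≢0
    where
    S = support K
    independent : ∀ i → spread S z i ≡ 0#
    independent = good⇒independent {support K} (good K) (spread S z) (spread-off S z) λ j → trans (sum-spread S z (λ i → a i j)) (dep j)

  module Existence (h : Fin D) (a>0 : ∀ i → 0# <ᵣ a i h) where

    -- In coordinate `h` the dependency is a vanishing sum of nonnegative terms with positive
    -- weights. Hence every positive direction has a negative entry, which bounds how far one can
    -- move along it.
    not-nonneg : ∀ ζ → Dependency a ζ → (∀ i → 0# ≤ᵣ ζ i) → ¬ Pos ζ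
    not-nonneg ζ dep ζ≥0 p = pos-≢0 p λ i → cancel-nonzero (λ e → ℚP.<-irrefl (sym e) (a>0 i))
      (sum-nonneg-≡0 (λ i → *-nonneg (ζ≥0 i) (ℚP.<⇒≤ (a>0 i))) (dep h) i)

    module _ {N : ℕ} where

      -- The largest multiple of ζ that can be added to c inside the nonnegative orthant.
      BoundaryStep : ∀ {n} → (Fin n → Fin N → ℚ) → (Fin n → ℚ) → Set
      BoundaryStep c ζ = Σ (Fin N → ℚ) λ w → Pos w × (∀ i → NonNeg (λ k → c i k + w k * ζ i)) × ∃[ i ] ζ i <ᵣ 0# × IsZero (λ k → c i k + w k * ζ i)

      -- The ratio test of the simplex method with ratios that are ε-tuples: an entry with `ζ i` < 0
      -- blocks at c_i / (-ζ_i), and the smallest blocking tuple is taken. It is positive since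
      -- `neg` makes the blocking entries of `c` positive.
      step : ∀ {n} (c : Fin n → Fin N → ℚ) (ζ : Fin n → ℚ) → (∀ i → NonNeg (c i)) → (∀ i → ζ i <ᵣ 0# → Pos (c i)) →
             (∀ i → 0# ≤ᵣ ζ i) ⊎ BoundaryStep c ζ
      step {zero}  c ζ c≥0 neg = inj₁ λ ()
      step {suc n} c ζ c≥0 neg with step (c ∘ suc) (ζ ∘ suc) (c≥0 ∘ suc) (neg ∘ suc) | ℚP.<-cmp 0# (ζ zero)
      ... | inj₁ ζ≥0 | tri< p _ _ = inj₁ λ { zero → ℚP.<⇒≤ p ; (suc i) → ζ≥0 i }
      ... | inj₁ ζ≥0 | tri≈ _ e _ = inj₁ λ { zero → ℚP.≤-reflexive e ; (suc i) → ζ≥0 i }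
      ... | inj₂ (w , w>0 , ok , i , ζi<0 , z) | tri< p _ _ =
              inj₂ (w , w>0 , (λ { zero → nonneg-+ (c≥0 zero) (nonneg-* (ℚP.<⇒≤ p) (inj₂ w>0)) ; (suc i) → ok i }) , suc i , ζi<0 , z)
      ... | inj₂ (w , w>0 , ok , i , ζi<0 , z) | tri≈ _ e _ =
              inj₂ (w , w>0 , (λ { zero → nonneg-+ (c≥0 zero) (nonneg-* (ℚP.≤-reflexive e) (inj₂ w>0)) ; (suc i) → ok i }) , suc i , ζi<0 , z)
      ... | tail | tri> _ _ ζ₀<0 = combine tail
        where
        inv = inverse-pos (- ζ zero) (neg-pos ζ₀<0)
        y = proj₁ inv
        w₀ : Fin N → ℚ
        w₀ k = c zero k * y
        w₀>0 : Pos w₀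
        w₀>0 = pos-* (proj₂ (proj₂ inv)) (neg zero ζ₀<0)
        at₀ : IsZero (λ k → c zero k + w₀ k * ζ zero)
        at₀ k = trans (eq (c zero k) y (ζ zero)) (trans (cong (λ q → c zero k * (1# - q)) (proj₁ (proj₂ inv)))
                  (trans (cong (c zero k *_) (+-inverseʳ 1#)) (zeroʳ _)))
          where
          opaque
            unfolding _+_
            eq : ∀ c y z → c + c * y * z ≡ c * (1# - y * - z)
            eq = solve-∀ ℚ-ring
        -- Every step shorter than a feasible one is feasible: compare with the starting value `c`
        -- if z ≥ 0 and with the value at `w′` if z ≤ 0.
        shrink : ∀ {w w′ : Fin N → ℚ} {c z} → NonNeg c → Pos w → NonNeg (λ k → w′ k - w k) → NonNeg (λ k → c k + w′ k * z) → NonNeg (λ k → c k + w k * z)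
        shrink {w} {w′} {c} {z} c≥0 w>0 w≤w′ ok with ℚP.≤-total 0# z
        ... | inj₁ z≥0 = nonneg-+ c≥0 (nonneg-* z≥0 (inj₂ w>0))
        ... | inj₂ z≤0 = nonneg-cong (λ k → eq (c k) (w k) (w′ k) z)
              (nonneg-+ ok (nonneg-* (subst (0# ≤ᵣ_) (+-identityˡ (- z)) (diff-nonneg z≤0)) w≤w′))
          where
          opaque
            unfolding _+_
            eq : ∀ c w w′ z → c + w′ * z + (w′ - w) * - z ≡ c + w * z
            eq = solve-∀ ℚ-ring
        combine : (∀ i → 0# ≤ᵣ ζ (suc i)) ⊎ BoundaryStep (c ∘ suc) (ζ ∘ suc) →
                  (∀ i → 0# ≤ᵣ ζ i) ⊎ BoundaryStep c ζ
        combine (inj₁ ζ≥0) = inj₂ (w₀ , w₀>0 ,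
          (λ { zero → inj₁ at₀ ; (suc i) → nonneg-+ (c≥0 (suc i)) (nonneg-* (ζ≥0 i) (inj₂ w₀>0)) }) , zero , ζ₀<0 , at₀)
        combine (inj₂ (w₁ , w₁>0 , ok , i , ζi<0 , z)) with nonneg? (λ k → w₁ k - w₀ k)
        ... | yes w₀≤w₁ = inj₂ (w₀ , w₀>0 ,
                (λ { zero → inj₁ at₀ ; (suc i) → shrink {w₀} {w₁} (c≥0 (suc i)) w₀>0 w₀≤w₁ (ok i) }) , zero , ζ₀<0 , at₀)
        ... | no w₀≰w₁ = inj₂ (w₁ , w₁>0 ,
                (λ { zero → shrink {w₁} {w₀} (c≥0 zero) w₁>0 (inj₂ (pos-cong (λ k → neg-diff (w₁ k) (w₀ k)) (¬nonneg⇒pos-neg w₀≰w₁))) (inj₁ at₀)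
                   ; (suc i) → ok i }) , suc i , ζi<0 , z)

      supp : (Fin m → Fin N → ℚ) → Vec Bool m
      supp c = tabulate (λ i → does (pos? (c i)))

      supp-true : ∀ c i → lookup (supp c) i ≡ true → Pos (c i)
      supp-true c i e with pos? (c i) | trans (sym (VecP.lookup∘tabulate (λ i → does (pos? (c i))) i)) e
      ... | yes p | _ = p

      supp-false : ∀ c i → lookup (supp c) i ≡ false → ¬ Pos (c i)
      supp-false c i e with pos? (c i) | trans (sym (VecP.lookup∘tabulate (λ i → does (pos? (c i))) i)) e
      ... | no ¬p | _ = ¬p

      ¬pos⇒supp : ∀ c i → ¬ Pos (c i) → lookup (supp c) i ≡ false
      ¬pos⇒supp c i ¬p with lookup (supp c) i in e
      ... | true  = contradiction (supp-true c i e) ¬p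
      ... | false = refl

      supp-zero : ∀ {c} → (∀ i → NonNeg (c i)) → ∀ i → lookup (supp c) i ≡ false → IsZero (c i)
      supp-zero {c} c≥0 i e with c≥0 i
      ... | inj₁ z = z
      ... | inj₂ p = contradiction p (supp-false c i e)

      move : ∀ {x c} → IsRep x c → ∀ ζ → Dependency a ζ → Pos ζ → (∀ i → lookup (supp c) i ≡ false → 0# ≤ᵣ ζ i) →
             Σ (Fin N → ℚ) λ w → Pos w × IsRep x (λ i k → c i k + w k * ζ i) × ∃[ i ] ζ i <ᵣ 0# × IsZero (λ k → c i k + w k * ζ i)
      move {x} {c} r ζ dep ζ>0 off with step c ζ (nonneg r) neg
        where
        neg : ∀ i → ζ i <ᵣ 0# → Pos (c i)
        neg i ζi<0 with lookup (supp c) i in e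
        ... | true  = supp-true c i e
        ... | false = contradiction (off i e) (<⇒≱ᵣ ζi<0)
      ... | inj₁ ζ≥0 = ⊥-elim (not-nonneg ζ dep ζ≥0 ζ>0)
      ... | inj₂ (w , w>0 , ok , i , ζi<0 , z) = w , w>0 , isRep ok sums′ , i , ζi<0 , z
        where
        sums′ : ∀ k j → comb (λ i → c i k + w k * ζ i) a j ≡ x k j
        sums′ k j = trans (comb-+ (λ i → c i k) (λ i → w k * ζ i) a j) (trans (cong₂ _+_ (sums r k j)
          (trans (comb-* (w k) ζ a j) (trans (cong (w k *_) (dep j)) (zeroʳ (w k))))) (+-identityʳ _))

      move-lex : ∀ {c : Fin m → Fin N → ℚ} {w ζ} → Pos w → Pos ζ → LexPos (λ i k → (c i k + w k * ζ i) - c i k)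
      move-lex {c} {w} {ζ} w>0 ζ>0 = lexpos-cong (λ i k → eq (c i k) (w k * ζ i)) (lexpos-⊗ w>0 ζ>0)
        where
        opaque
          unfolding _+_
          eq : ∀ c d → d ≡ (c + d) - c
          eq = solve-∀ ℚ-ring

      Improvement : (Fin N → Fin D → ℚ) → (Fin m → Fin N → ℚ) → Set
      Improvement x c = Σ (Fin m → Fin N → ℚ) λ c′ → IsRep x c′ × c′ ≽ c × Independent a (supp c′)

      -- A dependency inside the support, taken with positive sign, gives an improving move that
      -- stops when an entry of the support reaches 0. The support shrinks strictly, so the process
      -- ends at an independent one; `n` bounds its size.
      improve : ∀ n {x c} → count (supp c) < n → IsRep x c → Improvement x c
      improve (suc n) {x} {c} (s≤s c≤n) r with gauss a (supp c)
      ... | inj₂ (ℓ , _ , dual) = c , r , inj₁ (λ i k → +-inverseʳ (c i k)) , λ z sup dep i →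
              trans (sym (dual z sup i)) (sum-0 λ j → trans (cong (ℓ i j *_) (dep j)) (zeroʳ _))
      ... | inj₁ (z , sup , (i₀ , nt) , dep) = choose (pos-tri z)
        where
        go : ∀ ζ → SupportedIn {D = D} (supp c) ζ → Dependency a ζ → Pos ζ →
             Improvement x c
        go ζ sup dep ζ>0 with move r ζ dep ζ>0 (λ i e → ℚP.≤-reflexive (sym (sup i e)))
        ... | w , w>0 , r′ , i , ζi<0 , at-i = recurse (improve n {x} {c₁} (ℕP.≤-trans smaller c≤n) r′)
          where
          c₁ : Fin m → Fin N → ℚ
          c₁ i k = c i k + w k * ζ i
          shrinks : ∀ i → lookup (supp c₁) i ≡ true → lookup (supp c) i ≡ true
          shrinks i p with lookup (supp c) i in e
          ... | true  = refl
          ... | false = contradiction (λ k → trans (cong₂ (λ u v → u + w k * v) (supp-zero (nonneg r) i e k) (sup i e))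
                          (trans (+-identityˡ _) (zeroʳ (w k)))) (pos-≢0 (supp-true c₁ i p))
          i∈ : lookup (supp c) i ≡ true
          i∈ with lookup (supp c) i in e
          ... | true  = refl
          ... | false = contradiction (ℚP.≤-reflexive (sym (sup i e))) (<⇒≱ᵣ ζi<0)
          smaller : count (supp c₁) < count (supp c)
          smaller = count-strict (supp c) (supp c₁) shrinks i i∈ (¬pos⇒supp c₁ i λ p → pos-≢0 p at-i)
          recurse : Improvement x c₁ → Improvement x c
          recurse (c′ , r″ , c′≽c₁ , ind) = c′ , r″ , ≽-trans c′≽c₁ (inj₂ (move-lex w>0 ζ>0)) , ind
        choose : Pos z ⊎ IsZero z ⊎ Pos (λ i → - z i) → Improvement x c
        choose (inj₁ p)        = go z sup dep p
        choose (inj₂ (inj₁ y)) = contradiction (y i₀) nt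
        choose (inj₂ (inj₂ n)) = go (λ i → - z i) (λ i e → trans (cong -_ (sup i e)) neg-0)
                                   (λ j → trans (comb-neg z a j) (trans (cong -_ (dep j)) neg-0)) n

      rep-cong : ∀ {x} {c c′ : Fin m → Fin N → ℚ} → (∀ i k → c i k ≡ c′ i k) → IsRep x c → IsRep x c′
      rep-cong e r = isRep (λ i → nonneg-cong (e i) (nonneg r i)) λ k j → trans (comb-cong a (λ i → sym (e i k)) j) (sums r k j)

      isRep? : ∀ (x : Fin N → Fin D → ℚ) c → Dec (IsRep x c)
      isRep? x c = map′ (λ (p , q) → isRep p q) (λ r → nonneg r , sums r)
        (FinP.all? (λ i → nonneg? (c i)) ×-dec FinP.all? λ k → FinP.all? λ j → comb (λ i → c i k) a j ℚP.≟ x k j)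

      -- The functionals of `gauss` leave a single possible coefficient vector on an independent
      -- support, so these representations come from a finite list. On a dependent set the value is
      -- a dummy; all candidates are tested by `isRep?` later.
      candidate : (x : Fin N → Fin D → ℚ) → Vec Bool m → Fin m → Fin N → ℚ
      candidate x S with gauss a S
      ... | inj₁ _       = λ _ _ → 0#
      ... | inj₂ (ℓ , _) = λ i k → sum (λ j → ℓ i j * x k j)

      candidate-complete : ∀ {x c} → IsRep x c → Independent a (supp c) → ∀ i k → c i k ≡ candidate x (supp c) i k
      candidate-complete {x} {c} r ind i k with gauss a (supp c)
      ... | inj₁ (z , sup , (i₀ , nt) , dep) = contradiction (ind z sup dep i₀) nt
      ... | inj₂ (ℓ , _ , dual) = trans (sym (dual (λ i → c i k) (λ i e → supp-zero (nonneg r) i e k) i))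
                                    (sum-cong λ j → cong (ℓ i j *_) (sums r k j))

      candidates : (x : Fin N → Fin D → ℚ) → List (Fin m → Fin N → ℚ)
      candidates x = filter (isRep? x) (List.map (candidate x) (subsets m))

      dominated : ∀ {x c} → IsRep x c → Σ (Fin m → Fin N → ℚ) λ c′ → c′ ∈ candidates x × c′ ≽ c
      dominated {x} {c} r with improve (suc (count (supp c))) ℕP.≤-refl r
      ... | c₁ , r₁ , c₁≽c , ind = candidate x (supp c₁) ,
            MemP.∈-filter⁺ (isRep? x) (MemP.∈-map⁺ (candidate x) (∈-subsets (supp c₁))) (rep-cong (candidate-complete r₁ ind) r₁) ,
            ≽-trans (inj₁ λ i k → trans (cong (_- c₁ i k) (sym (candidate-complete r₁ ind i k))) (+-inverseʳ (c₁ i k))) c₁≽c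

      -- Maximising over infinitely many representations reduces to a finite list, since every
      -- representation is dominated by a candidate. The maximum is good because a forbidden
      -- dependency would move it to something larger.
      canonical? : ∀ (x : Fin N → Fin D → ℚ) → Canonical x ⊎ (∀ c → ¬ IsRep x c)
      canonical? x with maximum (candidates x)
      ... | inj₁ none = inj₂ λ c r → nothing-in (subst (proj₁ (dominated r) ∈_) none (proj₁ (proj₂ (dominated r))))
        where
        nothing-in : ∀ {c : Fin m → Fin N → ℚ} → ¬ c ∈ []
        nothing-in ()
      ... | inj₂ (c , c∈ , c-max) = inj₁ (record
              { support = supp c ; coeff = c ; rep = sums r ; good = good-c
              ; inside = supp-true c ; outside = supp-zero (nonneg r) })
        where
        r : IsRep x c
        r = proj₂ (MemP.∈-filter⁻ (isRep? x) {xs = List.map (candidate x) (subsets m)} c∈)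
        good-c : Good (supp c)
        good-c ζ dep off ζ>0 with move r ζ dep ζ>0 off
        ... | w , w>0 , r′ , _ = ≽-antisym (≽-trans (c-max (proj₁ (proj₂ (dominated r′)))) (proj₂ (proj₂ (dominated r′)))) (move-lex w>0 ζ>0)

      canonical : ∀ {x c} → IsRep x c → Canonical x
      canonical {x} {c} r with canonical? x
      ... | inj₁ K    = K
      ... | inj₂ none = ⊥-elim (none c r)

-- Counting by peeling

record Enumeration {A : Set} (P : A → Set) : Set where
  field
    list     : List A
    unique   : Unique list
    sound    : ∀ {x} → x ∈ list → P x
    complete : ∀ {x} → P x → x ∈ list

  size : ℕ
  size = length list

open Enumeration

-- A relation stands in for an injection, because the partner of a point is available only together
-- with a proof of membership. Each matched `y` is cut out of the list before the recursion.
length-≤ : ∀ {A B : Set} {xs : List A} (ys : List B) (R : A → B → Set) → Unique xs →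
           (∀ {x} → x ∈ xs → ∃[ y ] y ∈ ys × R x y) →
           (∀ {x x′ y} → x ∈ xs → x′ ∈ xs → R x y → R x′ y → x ≡ x′) → length xs ≤ length ys
length-≤ {xs = []}     ys R u total inj = z≤n
length-≤ {xs = x ∷ xs} ys R (x∉xs ∷ u) total inj with total (here refl)
... | y , y∈ys , Rxy with MemP.∈-∃++ y∈ys
...   | us , vs , refl = subst (suc (length xs) ≤_) (sym longer) (s≤s (length-≤ (us ++ vs) R u total′ λ p q → inj (there p) (there q)))
  where
  longer : length (us ++ y ∷ vs) ≡ suc (length (us ++ vs))
  longer = trans (ListP.length-++ us) (trans (ℕP.+-suc _ _) (cong suc (sym (ListP.length-++ us))))
  total′ : ∀ {x′} → x′ ∈ xs → ∃[ y′ ] y′ ∈ us ++ vs × R x′ y′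
  total′ x′∈ with total (there x′∈)
  ... | y′ , y′∈ , Rx′y′ with MemP.∈-++⁻ us y′∈
  ...   | inj₁ p           = y′ , MemP.∈-++⁺ˡ p , Rx′y′
  ...   | inj₂ (there p)   = y′ , MemP.∈-++⁺ʳ us p , Rx′y′
  ...   | inj₂ (here refl) = contradiction (inj (here refl) (there x′∈) Rxy Rx′y′) (All.lookup x∉xs x′∈)

module _ {A B : Set} {P : A → Set} {Q : B → Set} (E : Enumeration P) (F : Enumeration Q) where

  size-≤ : (R : A → B → Set) → (∀ {x} → P x → ∃[ y ] Q y × R x y) →
           (∀ {x x′ y} → P x → P x′ → R x y → R x′ y → x ≡ x′) → size E ≤ size F
  size-≤ R total inj = length-≤ (list F) R (unique E)
    (λ x∈ → let y , q , r = total (sound E x∈) in y , complete F q , r)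
    (λ x∈ x′∈ → inj (sound E x∈) (sound E x′∈))

size-cong : ∀ {A : Set} {P Q : A → Set} (E : Enumeration P) (F : Enumeration Q) →
            (∀ {x} → P x → Q x) → (∀ {x} → Q x → P x) → size E ≡ size F
size-cong E F f g = ℕP.≤-antisym (size-≤ E F _≡_ (λ p → _ , f p , refl) (λ { _ _ refl refl → refl }))
                                 (size-≤ F E _≡_ (λ q → _ , g q , refl) (λ { _ _ refl refl → refl }))

size-pos : ∀ {A : Set} {P : A → Set} (E : Enumeration P) {x} → P x → 1 ≤ size E
size-pos E p with list E | complete E p
... | _ ∷ _ | _ = s≤s z≤n

size-empty : ∀ {A : Set} {P : A → Set} (E : Enumeration P) → (∀ x → ¬ P x) → size E ≡ 0
size-empty E none with list E | sound E
... | []    | _  = refl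
... | x ∷ _ | s = contradiction (s (here refl)) (none x)

restrict : ∀ {A : Set} {P Q : A → Set} → Enumeration P → (∀ x → Dec (Q x)) → Enumeration (λ x → P x × Q x)
restrict E Q? = record
  { list     = filter Q? (list E)
  ; unique   = UniqueP.filter⁺ Q? (unique E)
  ; sound    = λ x∈ → let p , q = MemP.∈-filter⁻ Q? {xs = list E} x∈ in sound E p , q
  ; complete = λ (p , q) → MemP.∈-filter⁺ Q? (complete E p) q
  }

size-restrict : ∀ {A : Set} {P Q : A → Set} (E : Enumeration P) (Q? : ∀ x → Dec (Q x)) →
                size E ≡ size (restrict E Q?) ℕ.+ size (restrict E (λ x → ¬? (Q? x)))
size-restrict E Q? = go (list E)
  where
  go : ∀ xs → length xs ≡ length (filter Q? xs) ℕ.+ length (filter (λ x → ¬? (Q? x)) xs)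
  go []       = refl
  go (x ∷ xs) with Q? x
  ... | yes _ = cong suc (go xs)
  ... | no  _ = trans (cong suc (go xs)) (sym (ℕP.+-suc _ _))

psum : (ℕ → ℕ) → ℕ → ℕ
psum h zero    = h zero
psum h (suc n) = psum h n ℕ.+ h (suc n)

psums : ℕ → (ℕ → ℕ) → ℕ → ℕ
psums zero    h = h
psums (suc r) h = psum (psums r h)

psum-cong : ∀ {h h′} → (∀ n → h n ≡ h′ n) → ∀ n → psum h n ≡ psum h′ n
psum-cong e zero    = e zero
psum-cong e (suc n) = cong₂ ℕ._+_ (psum-cong e n) (e (suc n))

-- Elements of X n carry r coordinates; Big p says that the p-th one is at least 1, and Shift p adds 1 to it.
record Peeling {A : Set} (X : ℕ → A → Set) (r : ℕ) : Set₁ where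
  field
    Big      : Fin r → ℕ → A → Set
    big?     : ∀ p n x → Dec (Big p n x)
    big-zero : ∀ {p x} → X 0 x → ¬ Big p 0 x
    Shift    : Fin r → ℕ → A → A → Set
    up       : ∀ p {n x} → X n x → ∃[ y ] X (suc n) y × Big p (suc n) y × Shift p n x y
    down     : ∀ p {n y} → X (suc n) y → Big p (suc n) y → ∃[ x ] X n x × Shift p n x y
    injective  : ∀ {p n x x′ y} → Shift p n x y → Shift p n x′ y → x ≡ x′
    functional : ∀ {p n x y y′} → Shift p n x y → Shift p n x y′ → y ≡ y′
    big-up   : ∀ {p n x y} → Shift p n x y → ∀ j → j ≢ p → Big j n x → Big j (suc n) y
    big-down : ∀ {p n x y} → Shift p n x y → ∀ j → j ≢ p → Big j (suc n) y → Big j n x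

  -- The state of the induction: the first `k` coordinates have been peeled and are confined below
  -- 1.
  Small : ℕ → ℕ → A → Set
  Small k n x = ∀ j → toℕ j < k → ¬ Big j n x

  Box : ℕ → A → Set
  Box n x = X n x × (∀ j → ¬ Big j n x)

  small? : ∀ k n x → Dec (Small k n x)
  small? k n x = FinP.all? λ j → (toℕ j ℕ.<? k) →-dec ¬? (big? j n x)

  box : (∀ n → Enumeration (X n)) → ∀ n → Enumeration (Box n)
  box E n = restrict (E n) λ x → FinP.all? λ j → ¬? (big? j n x)

  module _ (E : ∀ n → Enumeration (X n)) where

    small : ∀ k n → Enumeration (λ x → X n x × Small k n x)
    small k n = restrict (E n) (small? k n)

    grow : ∀ {p n x} → Small (toℕ p) n x → ¬ Big p n x → Small (suc (toℕ p)) n x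
    grow {p} s ¬b j (s≤s j≤p) with j Fin.≟ p
    ... | yes refl = ¬b
    ... | no j≢p   = s j (ℕP.≤∧≢⇒< j≤p (j≢p ∘ FinP.toℕ-injective))

    peel-zero : ∀ p → size (small (toℕ p) 0) ≡ size (small (suc (toℕ p)) 0)
    peel-zero p = size-cong (small (toℕ p) 0) (small (suc (toℕ p)) 0)
      (λ (x , s) → x , grow s (big-zero x))
      (λ (x , s) → x , λ j j<p → s j (ℕP.m≤n⇒m≤1+n j<p))

    ≢-lt : ∀ {p j : Fin r} → toℕ j < toℕ p → j ≢ p
    ≢-lt j<p refl = ℕP.<-irrefl refl j<p

    -- Elements whose coordinate `p` is at least 1 correspond to elements one level lower, and the
    -- remaining ones have one more small coordinate. This is exactly the recursion of a partial
    -- sum.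
    peel-suc : ∀ p n → size (small (toℕ p) (suc n)) ≡ size (small (toℕ p) n) ℕ.+ size (small (suc (toℕ p)) (suc n))
    peel-suc p n = trans (size-restrict (small (toℕ p) (suc n)) (big? p (suc n))) (cong₂ ℕ._+_ bigs smalls)
      where
      up-small : ∀ {x y} → Shift p n x y → Small (toℕ p) n x → Small (toℕ p) (suc n) y
      up-small sh s j j<p b = s j j<p (big-down sh j (≢-lt j<p) b)
      down-small : ∀ {x y} → Shift p n x y → Small (toℕ p) (suc n) y → Small (toℕ p) n x
      down-small sh s j j<p b = s j j<p (big-up sh j (≢-lt j<p) b)
      bigs : size (restrict (small (toℕ p) (suc n)) (big? p (suc n))) ≡ size (small (toℕ p) n)
      bigs = ℕP.≤-antisym
        (size-≤ (restrict (small (toℕ p) (suc n)) (big? p (suc n))) (small (toℕ p) n) (λ y x → Shift p n x y)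
          (λ ((y , s) , b) → let x , Xx , sh = down p y b in x , (Xx , down-small sh s) , sh)
          (λ _ _ → functional))
        (size-≤ (small (toℕ p) n) (restrict (small (toℕ p) (suc n)) (big? p (suc n))) (Shift p n)
          (λ (x , s) → let y , Xy , b , sh = up p x in y , ((Xy , up-small sh s) , b) , sh)
          (λ _ _ → injective))
      smalls : size (restrict (small (toℕ p) (suc n)) (λ x → ¬? (big? p (suc n) x))) ≡ size (small (suc (toℕ p)) (suc n))
      smalls = size-cong (restrict (small (toℕ p) (suc n)) (λ x → ¬? (big? p (suc n) x))) (small (suc (toℕ p)) (suc n))
        (λ ((x , s) , ¬b) → x , grow s ¬b)
        (λ (x , s) → (x , λ j j<p → s j (ℕP.m≤n⇒m≤1+n j<p)) , s p ℕP.≤-refl)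

    peel-psum : ∀ p n → size (small (toℕ p) n) ≡ psum (λ n → size (small (suc (toℕ p)) n)) n
    peel-psum p zero    = peel-zero p
    peel-psum p (suc n) = trans (peel-suc p n) (cong (ℕ._+ size (small (suc (toℕ p)) (suc n))) (peel-psum p n))

    peel-psums : ∀ t k → t ℕ.+ k ≡ r → ∀ n → size (small k n) ≡ psums t (λ n → size (box E n)) n
    peel-psums zero k refl n = size-cong (small k n) (box E n)
      (λ (x , s) → x , λ j → s j (FinP.toℕ<n j)) (λ (x , s) → x , λ j _ → s j)
    peel-psums (suc t) k t+k≡r n = trans
      (subst (λ k → size (small k n) ≡ psum (λ n → size (small (suc k) n)) n) (FinP.toℕ-fromℕ< k<r) (peel-psum (fromℕ< k<r) n))
      (psum-cong (peel-psums t (suc k) (trans (ℕP.+-suc t k) t+k≡r)) n)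
      where
      k<r : k < r
      k<r = subst (k <_) t+k≡r (s≤s (ℕP.m≤n+m k t))

    peeling : ∀ n → size (E n) ≡ psums r (λ n → size (box E n)) n
    peeling n = trans (size-cong (E n) (small 0 n) (λ x → x , λ _ ()) proj₁) (peel-psums r 0 (ℕP.+-identityʳ r) n)

-- Peeling the lattice points of a perturbed cone

_+ᵛ_ _-ᵛ_ : ∀ {d} → Vec ℤ d → Vec ℤ d → Vec ℤ d
_+ᵛ_ = Vec.zipWith ℤ._+_
_-ᵛ_ = Vec.zipWith ℤ._-_

-+ᵛ-cancel : ∀ {d} (x y : Vec ℤ d) → (x -ᵛ y) +ᵛ y ≡ x
-+ᵛ-cancel []      []      = refl
-+ᵛ-cancel (x ∷ xs) (y ∷ ys) = cong₂ _∷_ (eq x y) (-+ᵛ-cancel xs ys)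
  where
  eq : ∀ x y → x ℤ.- y ℤ.+ y ≡ x
  eq = solve-∀ ℤ-ring

+ᵛ-cancelʳ : ∀ {d} (x x′ y : Vec ℤ d) → x +ᵛ y ≡ x′ +ᵛ y → x ≡ x′
+ᵛ-cancelʳ []      []        []      _ = refl
+ᵛ-cancelʳ (x ∷ xs) (x′ ∷ xs′) (y ∷ ys) e =
  cong₂ _∷_ (ℤ-+-cancelʳ y x x′ (VecP.∷-injectiveˡ e)) (+ᵛ-cancelʳ xs xs′ ys (VecP.∷-injectiveʳ e))

-- The lattice point x of the n-th dilate, placed at height n over the polytope.
pt : ∀ {d} → ℕ → Vec ℤ d → Fin (suc d) → ℚ
pt n x zero    = ι (ℤ.+ n)
pt n x (suc j) = ι (lookup x j)

-- The tuple of x + Σ ε^(k+1) q_k, with the lattice point as its finite part.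
perturb : ∀ {d N} → (Fin N → Fin (suc d) → ℚ) → ℕ → Vec ℤ d → Fin (suc N) → Fin (suc d) → ℚ
perturb q n x zero    = pt n x
perturb q n x (suc k) = q k

one : ∀ {N} → Fin (suc N) → ℚ
one zero    = 1#
one (suc k) = 0#

one-nonneg : ∀ {N} → NonNeg (one {N})
one-nonneg = inj₂ (inj₁ 0<1)

nonneg-head : ∀ {N} {w : Fin (suc N) → ℚ} → NonNeg w → 0# ≤ᵣ w zero
nonneg-head (inj₁ z)              = ℚP.≤-reflexive (sym (z zero))
nonneg-head (inj₂ (inj₁ p))       = ℚP.<⇒≤ p
nonneg-head (inj₂ (inj₂ (z , _))) = ℚP.≤-reflexive (sym z)

pt-+ : ∀ {d} n x (v : Vec ℤ d) j → pt (suc n) (x +ᵛ v) j ≡ pt n x j + pt 1 v j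
pt-+ n x v zero    = trans (cong ι (cong ℤ.+_ (ℕP.+-comm 1 n))) (ι-+ (ℤ.+ n) (ℤ.+ 1))
pt-+ n x v (suc j) = trans (cong ι (VecP.lookup-zipWith ℤ._+_ j x v)) (ι-+ (lookup x j) (lookup v j))

_∩_ : ∀ {m} → Vec Bool m → Vec Bool m → Vec Bool m
_∩_ = Vec.zipWith _∧_

∩-∈ : ∀ {m} (S F : Vec Bool m) i → lookup S i ≡ true → lookup F i ≡ true → lookup (S ∩ F) i ≡ true
∩-∈ S F i p q = trans (VecP.lookup-zipWith _∧_ i S F) (cong₂ _∧_ p q)

∈-∩ : ∀ {m} (S F : Vec Bool m) i → lookup (S ∩ F) i ≡ true → lookup S i ≡ true × lookup F i ≡ true
∈-∩ S F i p with lookup S i | lookup F i | trans (sym (VecP.lookup-zipWith _∧_ i S F)) p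
... | true | true | _ = refl , refl

count-≡ : ∀ {m} (S S′ : Vec Bool m) → (∀ i → lookup S′ i ≡ true → lookup S i ≡ true) → count S′ ≡ count S → S′ ≡ S
count-≡ S S′ sub e = lookup-injective S′ S same
  where
  same : ∀ i → lookup S′ i ≡ lookup S i
  same i with lookup S′ i in p | lookup S i in q
  ... | true  | true  = refl
  ... | false | false = refl
  ... | true  | false = contradiction (trans (sym (sub i p)) q) λ ()
  ... | false | true  = contradiction e (ℕP.<⇒≢ (count-strict S S′ sub i q p))

-- `F` marks generators that are lattice points at height 1 and may be peeled. `Y` restricts the
-- coefficients but depends only on those outside `F`, so peeling preserves it; for boundary points
-- it will make the finite part of the apex coefficient vanish.
module PeelCone {m d N : ℕ} (b : Fin m → Fin (suc d) → ℚ) (b>0 : ∀ i → 0# <ᵣ b i zero)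
  (F : Vec Bool m) (v : Fin m → Vec ℤ d) (b≡v : ∀ i → lookup F i ≡ true → ∀ j → b i j ≡ pt 1 (v i) j)
  (q : Fin N → Fin (suc d) → ℚ)
  (Y : (Fin m → Fin (suc N) → ℚ) → Set) (Y? : ∀ c → Dec (Y c))
  (Y-resp : ∀ {c c′} → (∀ i → lookup F i ≡ false → ∀ k → c i k ≡ c′ i k) → Y c → Y c′)
  (r : ℕ) (r-size : ∀ n x (K : Cone.Canonical b (perturb q n x)) → Y (Cone.Canonical.coeff K) → count (Cone.Canonical.support K ∩ F) ≡ r) where

  open Cone b
  open Existence zero b>0
  open Canonical

  X : ℕ → Vec ℤ d → Set
  X n x = Σ (Canonical (perturb q n x)) λ K → Y (coeff K)

  rays : ∀ {n x} → X n x → Vec Bool m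
  rays (K , _) = support K ∩ F

  size-rays : ∀ {n x} (K : X n x) → r ≡ count (rays K)
  size-rays {n} {x} (K , y) = sym (r-size n x K y)

  σ : ∀ {n x} → X n x → Fin r → Fin m
  σ K p = enum (rays K) (cast (size-rays K) p)

  σ-∈ : ∀ {n x} (K : X n x) p → lookup (support (proj₁ K)) (σ K p) ≡ true × lookup F (σ K p) ≡ true
  σ-∈ K p = ∈-∩ (support (proj₁ K)) F (σ K p) (enum-∈ (rays K) (cast (size-rays K) p))

  σ-onto : ∀ {n x} (K : X n x) i → lookup (rays K) i ≡ true → ∃[ p ] σ K p ≡ i
  σ-onto K i i∈ = let k , e = enum-onto (rays K) i i∈ in
    cast (sym (size-rays K)) k , trans (cong (enum (rays K)) (FinP.cast-involutive (size-rays K) (sym (size-rays K)) k)) e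

  σ-injective : ∀ {n x} (K : X n x) {p p′} → σ K p ≡ σ K p′ → p ≡ p′
  σ-injective K {p} {p′} e = trans (sym (FinP.cast-involutive (sym (size-rays K)) (size-rays K) p))
    (trans (cong (cast (sym (size-rays K))) (enum-injective (rays K) e)) (FinP.cast-involutive (sym (size-rays K)) (size-rays K) p′))

  σ-cong : ∀ {n x n′ x′} (K : X n x) (K′ : X n′ x′) → rays K ≡ rays K′ → ∀ p → σ K p ≡ σ K′ p
  σ-cong K K′ e p = go (rays K) (rays K′) e (size-rays K) (size-rays K′)
    where
    go : ∀ R R′ → R ≡ R′ → (e : r ≡ count R) (e′ : r ≡ count R′) → enum R (cast e p) ≡ enum R′ (cast e′ p)
    go R .R refl e e′ = refl

  σ-unique : ∀ {n x} (K K′ : X n x) p → σ K p ≡ σ K′ p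
  σ-unique K K′ = σ-cong K K′ (cong (_∩ F) (support-unique (λ _ _ → refl) (proj₁ K) (proj₁ K′)))

  -- The support cannot shrink because genericity fixes its size.
  modify : ∀ {n x n′ x′} (K : X n x) (c : Fin m → Fin (suc N) → ℚ) → IsRep (perturb q n′ x′) c →
           (∀ i → lookup (support (proj₁ K)) i ≡ false → IsZero (c i)) →
           (∀ i → lookup F i ≡ false → ∀ k → coeff (proj₁ K) i k ≡ c i k) →
           Σ (X n′ x′) λ K′ → rays K ≡ rays K′ × (∀ i k → coeff (proj₁ K′) i k ≡ c i k)
  modify {n′ = n′} {x′} (K , y) c rc off same = (K′ , y′) , sym T≡ , λ _ _ → refl
    where
    supp-⊆ : ∀ i → lookup (supp c) i ≡ true → lookup (support K) i ≡ true
    supp-⊆ i p with lookup (support K) i in e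
    ... | true  = refl
    ... | false = contradiction (off i e) (pos-≢0 (supp-true c i p))
    off-supp : ∀ i → lookup (support K) i ≡ false → lookup (supp c) i ≡ false
    off-supp i e with lookup (supp c) i in p
    ... | false = refl
    ... | true  = contradiction (trans (sym (supp-⊆ i p)) e) λ ()
    K′ : Canonical (perturb q n′ x′)
    K′ = record { support = supp c ; coeff = c ; rep = sums rc
                ; good = λ ζ dep o → good K ζ dep λ i e → o i (off-supp i e)
                ; inside = supp-true c ; outside = supp-zero (nonneg rc) }
    y′ : Y c
    y′ = Y-resp same y
    T≡ : supp c ∩ F ≡ support K ∩ F
    T≡ = count-≡ (support K ∩ F) (supp c ∩ F)
      (λ i p → let s , f = ∈-∩ (supp c) F i p in ∩-∈ (support K) F i (supp-⊆ i s) f)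
      (trans (r-size n′ x′ K′ y′) (size-rays (K , y)))

  at-least-one : ∀ {n x} → X n x → Fin r → Set
  at-least-one K p = NonNeg (λ k → coeff (proj₁ K) (σ K p) k - one k)

  -- The increment `one` has a finite part only: it translates the lattice point by a generator and
  -- leaves the perturbation in place.
  add : ∀ {n x} (K : X n x) p → Σ (X (suc n) (x +ᵛ v (σ K p))) λ K′ →
        rays K ≡ rays K′ × (∀ i k → coeff (proj₁ K′) i k ≡ coeff (proj₁ K) i k + one k * δ (σ K p) i)
  add {n} {x} K₀@(K , y) p = modify K₀ c (isRep nonneg-c sums-c) off same
    where
    i₀ = σ K₀ p
    c : Fin m → Fin (suc N) → ℚ
    c i k = coeff K i k + one k * δ i₀ i
    δ-nonneg : ∀ i → 0# ≤ᵣ δ i₀ i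
    δ-nonneg i with i₀ Fin.≟ i
    ... | yes refl = subst (0# ≤ᵣ_) (sym (δ-refl i₀)) (ℚP.<⇒≤ 0<1)
    ... | no ne    = ℚP.≤-reflexive (sym (δ-≢ ne))
    nonneg-c : ∀ i → NonNeg (c i)
    nonneg-c i = nonneg-+ (coeff-nonneg K i) (nonneg-* (δ-nonneg i) one-nonneg)
    total : ∀ k j → comb (λ i → c i k) b j ≡ perturb q n x k j + one k * b i₀ j
    total k j = trans (comb-+ (λ i → coeff K i k) (λ i → one k * δ i₀ i) b j)
      (cong₂ _+_ (rep K k j) (trans (comb-* (one k) (δ i₀) b j) (cong (one k *_) (sum-δ i₀ λ i → b i j))))
    sums-c : ∀ k j → comb (λ i → c i k) b j ≡ perturb q (suc n) (x +ᵛ v i₀) k j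
    sums-c zero    j = trans (total zero j) (trans (cong (pt n x j +_) (trans (*-identityˡ _) (b≡v i₀ (proj₂ (σ-∈ K₀ p)) j))) (sym (pt-+ n x (v i₀) j)))
    sums-c (suc k) j = trans (total (suc k) j) (trans (cong (q k j +_) (zeroˡ _)) (+-identityʳ _))
    unchanged : ∀ i → i₀ ≢ i → ∀ k → coeff K i k ≡ c i k
    unchanged i ne k = sym (trans (cong (λ e → coeff K i k + one k * e) (δ-≢ ne)) (trans (cong (coeff K i k +_) (zeroʳ _)) (+-identityʳ _)))
    off : ∀ i → lookup (support K) i ≡ false → IsZero (c i)
    off i e k = trans (sym (unchanged i (λ { refl → contradiction (trans (sym (proj₁ (σ-∈ K₀ p))) e) λ () }) k)) (outside K i e k)
    same : ∀ i → lookup F i ≡ false → ∀ k → coeff K i k ≡ c i k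
    same i e = unchanged i λ { refl → contradiction (trans (sym (proj₂ (σ-∈ K₀ p))) e) λ () }

  -- A coefficient of exactly 1 would seem to leave the support here, but then fewer than `r`
  -- peelable generators would remain, which `modify` excludes by counting.
  remove : ∀ {n y} (K : X (suc n) y) p → at-least-one K p → Σ (X n (y -ᵛ v (σ K p))) λ K′ → rays K ≡ rays K′
  remove {n} {y} K₀@(K , _) p big = let K′ , e , _ = modify K₀ c (isRep nonneg-c sums-c) off same in K′ , e
    where
    i₀ = σ K₀ p
    c : Fin m → Fin (suc N) → ℚ
    c i k = coeff K i k - one k * δ i₀ i
    unchanged : ∀ i → i₀ ≢ i → ∀ k → coeff K i k ≡ c i k
    unchanged i ne k = sym (trans (cong (λ e → coeff K i k - one k * e) (δ-≢ ne)) (eq (coeff K i k) (one k)))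
      where
      opaque
        unfolding _+_
        eq : ∀ x o → x - o * 0# ≡ x
        eq = solve-∀ ℚ-ring
    nonneg-c : ∀ i → NonNeg (c i)
    nonneg-c i with i₀ Fin.≟ i
    ... | no ne    = nonneg-cong (unchanged i ne) (coeff-nonneg K i)
    ... | yes refl = nonneg-cong (λ k → cong (λ e → coeff K i₀ k - e) (sym (trans (cong (one k *_) (δ-refl i₀)) (*-identityʳ _)))) big
    total : ∀ k j → comb (λ i → c i k) b j ≡ perturb q (suc n) y k j - one k * b i₀ j
    total k j = trans (comb-- (λ i → coeff K i k) (λ i → one k * δ i₀ i) b j)
      (cong₂ _-_ (rep K k j) (trans (comb-* (one k) (δ i₀) b j) (cong (one k *_) (sum-δ i₀ λ i → b i j))))
    restore : ∀ j → pt n (y -ᵛ v i₀) j + pt 1 (v i₀) j ≡ pt (suc n) y j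
    restore j = trans (sym (pt-+ n (y -ᵛ v i₀) (v i₀) j)) (cong (λ z → pt (suc n) z j) (-+ᵛ-cancel y (v i₀)))
    sums-c : ∀ k j → comb (λ i → c i k) b j ≡ perturb q n (y -ᵛ v i₀) k j
    sums-c zero    j = trans (total zero j) (trans (cong₂ (λ s t → s - 1# * t) (sym (restore j)) (b≡v i₀ (proj₂ (σ-∈ K₀ p)) j)) (eq (pt n (y -ᵛ v i₀) j) (pt 1 (v i₀) j)))
      where
      opaque
        unfolding _+_
        eq : ∀ x t → x + t - 1# * t ≡ x
        eq = solve-∀ ℚ-ring
    sums-c (suc k) j = trans (total (suc k) j) (eq (q k j) (b i₀ j))
      where
      opaque
        unfolding _+_
        eq : ∀ x t → x - 0# * t ≡ x
        eq = solve-∀ ℚ-ring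
    off : ∀ i → lookup (support K) i ≡ false → IsZero (c i)
    off i e k = trans (sym (unchanged i (λ { refl → contradiction (trans (sym (proj₁ (σ-∈ K₀ p))) e) λ () }) k)) (outside K i e k)
    same : ∀ i → lookup F i ≡ false → ∀ k → coeff K i k ≡ c i k
    same i e = unchanged i λ { refl → contradiction (trans (sym (proj₂ (σ-∈ K₀ p))) e) λ () }

  -- Two canonical records of one point may differ as records, while their supports and coefficients
  -- agree; hence predicates quantified over a record do not depend on the one chosen.
  transport : ∀ {n x} (K K′ : X n x) p → at-least-one K p → at-least-one K′ p
  transport K K′ p = nonneg-cong λ k → cong (_- one k)
    (trans (canonical-unique (λ _ _ → refl) (proj₁ K) (proj₁ K′) (σ K p) k) (cong (λ i → coeff (proj₁ K′) i k) (σ-unique K K′ p)))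

  Big : Fin r → ℕ → Vec ℤ d → Set
  Big p n x = Σ (X n x) λ K → at-least-one K p

  X? : ∀ n x → Dec (X n x)
  X? n x with canonical? (perturb q n x)
  ... | inj₂ none = no λ (K , _) → none (coeff K) (canonical-rep K)
  ... | inj₁ K with Y? (coeff K)
  ...   | yes y = yes (K , y)
  ...   | no ¬y = no λ (K′ , y) → ¬y (Y-resp (λ i _ k → canonical-unique (λ _ _ → refl) K′ K i k) y)

  big? : ∀ p n x → Dec (Big p n x)
  big? p n x with X? n x
  ... | no ¬K = no λ (K , _) → ¬K K
  ... | yes K = map′ (K ,_) (λ (K′ , big) → transport K′ K p big) (nonneg? _)

  Shift : Fin r → ℕ → Vec ℤ d → Vec ℤ d → Set
  Shift p n x y = Σ (X n x) λ K → y ≡ x +ᵛ v (σ K p)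

  peel : Peeling X r
  peel = record
    { Big = Big
    ; big? = big?
    ; big-zero = λ {p} _ (K , big) → big-zero K p big
    ; Shift = Shift
    ; up = λ p K → let K′ , e , c≡ = add K p in _ , K′ , (K′ , big-added K p K′ e c≡) , (K , refl)
    ; down = λ p {n} {y} Ky (K , big) → let K′ , e = remove K p big in
        y -ᵛ v (σ K p) , K′ , (K′ , sym (trans (cong (λ i → (y -ᵛ v (σ K p)) +ᵛ v i) (sym (σ-cong K K′ e p))) (-+ᵛ-cancel y (v (σ K p)))))
    ; injective = injective
    ; functional = λ { {p} {x = x} (K , refl) (K′ , refl) → cong (λ i → x +ᵛ v i) (σ-unique K K′ p) }
    ; big-up = big-up
    ; big-down = big-down
    }
    where
    -- At height 0 the finite parts are nonnegative with a vanishing positively weighted sum, so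
    -- none of them reaches 1.
    big-zero : ∀ {x} (K : X 0 x) p → ¬ at-least-one K p
    big-zero {x} K₀@(K , _) p big = <⇒≱ᵣ 0<1 (nonneg-diff (subst (λ e → 0# ≤ᵣ e - 1#) zero-coeff (nonneg-head big)))
      where
      zero-coeff : coeff K (σ K₀ p) zero ≡ 0#
      zero-coeff = cancel-nonzero (λ e → ℚP.<-irrefl (sym e) (b>0 (σ K₀ p)))
        (sum-nonneg-≡0 (λ i → *-nonneg (nonneg-head (coeff-nonneg K i)) (ℚP.<⇒≤ (b>0 i))) (trans (rep K zero zero) ι-0) (σ K₀ p))
    big-added : ∀ {n x} (K : X n x) p (K′ : X (suc n) (x +ᵛ v (σ K p))) → rays K ≡ rays K′ →
                (∀ i k → coeff (proj₁ K′) i k ≡ coeff (proj₁ K) i k + one k * δ (σ K p) i) → at-least-one K′ p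
    big-added K p K′ e c≡ = nonneg-cong (λ k → sym (trans (cong (_- one k) (trans (c≡ (σ K′ p) k)
        (cong₂ (λ i δ → coeff (proj₁ K) i k + one k * δ) (sym σ≡) (trans (cong (δ (σ K p)) (sym σ≡)) (δ-refl (σ K p)))))) (eq (coeff (proj₁ K) (σ K p) k) (one k))))
        (coeff-nonneg (proj₁ K) (σ K p))
      where
      σ≡ : σ K p ≡ σ K′ p
      σ≡ = σ-cong K K′ e p
      opaque
        unfolding _+_
        eq : ∀ c o → c + o * 1# - o ≡ c
        eq = solve-∀ ℚ-ring
    -- The generator added to `x` and the one added to `x′` are both read off the canonical support
    -- of the common `y`, hence they coincide and can be cancelled.
    injective : ∀ {p n x x′ y} → Shift p n x y → Shift p n x′ y → x ≡ x′
    injective {p} {n} {x} {x′} (K , refl) (K′ , e) with add K p | add K′ p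
    ... | L , TL , _ | L′ , TL′ , _ = +ᵛ-cancelʳ x x′ (v (σ K p)) (trans e (cong (λ i → x′ +ᵛ v i) (sym σ≡)))
      where
      σ≡ : σ K p ≡ σ K′ p
      σ≡ = σ-cong K K′ (trans TL (trans (cong (_∩ F) (support-unique (λ k j → cong (λ y → perturb q (suc n) y k j) e) (proj₁ L) (proj₁ L′))) (sym TL′))) p
    other : ∀ {n x} (K : X n x) p j → j ≢ p → (K′ : X (suc n) (x +ᵛ v (σ K p))) → rays K ≡ rays K′ →
            (∀ i k → coeff (proj₁ K′) i k ≡ coeff (proj₁ K) i k + one k * δ (σ K p) i) →
            ∀ k → coeff (proj₁ K) (σ K j) k - one k ≡ coeff (proj₁ K′) (σ K′ j) k - one k
    other K p j j≢p K′ e c≡ k = cong (_- one k) (sym (trans (cong (λ i → coeff (proj₁ K′) i k) (sym (σ-cong K K′ e j)))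
      (trans (c≡ (σ K j) k) (trans (cong (λ δ → coeff (proj₁ K) (σ K j) k + one k * δ) (δ-≢ (λ σ≡ → j≢p (sym (σ-injective K σ≡)))))
        (trans (cong (coeff (proj₁ K) (σ K j) k +_) (zeroʳ _)) (+-identityʳ _))))))
    big-up : ∀ {p n x y} → Shift p n x y → ∀ j → j ≢ p → Big j n x → Big j (suc n) y
    big-up {p} (K , refl) j j≢p (K₁ , big) with add K p
    ... | K′ , e , c≡ = K′ , nonneg-cong (other K p j j≢p K′ e c≡) (transport K₁ K j big)
    big-down : ∀ {p n x y} → Shift p n x y → ∀ j → j ≢ p → Big j (suc n) y → Big j n x
    big-down {p} (K , refl) j j≢p (K₁ , big) with add K p
    ... | K′ , e , c≡ = K , nonneg-cong (λ k → sym (other K p j j≢p K′ e c≡ k)) (transport K₁ K′ j big)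

  box-intro : ∀ {n x} (K : X n x) → (∀ i → lookup (rays K) i ≡ true → Pos (λ k → one k - coeff (proj₁ K) i k)) → Peeling.Box peel n x
  box-intro K below = K , λ p (K′ , big) → pos-asym (below (σ K p) (enum-∈ (rays K) (cast (size-rays K) p)))
    (nonneg-cong (λ k → sym (neg-diff (one k) (coeff (proj₁ K) (σ K p) k))) (transport K′ K p big))

  box-elim : ∀ {n x} → ((K , _) : Peeling.Box peel n x) → ∀ i → lookup (rays K) i ≡ true → Pos (λ k → one k - coeff (proj₁ K) i k)
  box-elim (K , small) i i∈ with σ-onto K i i∈
  ... | p , refl = pos-cong (λ k → neg-diff (coeff (proj₁ K) (σ K p) k) (one k)) (¬nonneg⇒pos-neg λ big → small p (K , big))

-- Lattice polytopes

½>0 : 0ℚ ℚ.< ℚ.½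
½>0 = ℚP.positive⁻¹ ℚ.½

opaque
  unfolding _+_

  ½# : ℚ
  ½# = ℚ.½

  ½#>0 : 0# <ᵣ ½#
  ½#>0 = ½>0

  1-½#>0 : 0# <ᵣ 1# - ½#
  1-½#>0 = ½>0

  sumℚ≡sum : ∀ {n} (f : Fin n → ℚ) → sumℚ f ≡ sum f
  sumℚ≡sum {zero}  f = refl
  sumℚ≡sum {suc n} f = cong (f zero +_) (sumℚ≡sum (f ∘ suc))

  affIndep-elim : ∀ {d} {W : Fin (suc d) → Vec ℤ d} → AffIndep W → (c : Fin d → ℚ) →
                  (∀ j → sum (λ i → c i * ι (lookup (W (suc i)) j ℤ.- lookup (W zero) j)) ≡ 0#) → ∀ i → c i ≡ 0#
  affIndep-elim {d} {W} indep c h = indep c λ j → trans (sumℚ≡sum (λ i → c i * ι (lookup (W (suc i)) j ℤ.- lookup (W zero) j))) (h j)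

  inDilate-elim : ∀ {m d n x} {V : Fin m → Vec ℤ d} → InDilate V n x → Σ (Fin m → ℚ) λ c → (∀ i → 0# ≤ᵣ c i) ×
                  sum c ≡ 1# × (∀ j → sum (λ i → c i * ι (ℤ.+ n ℤ.* lookup (V i) j)) ≡ ι (lookup x j))
  inDilate-elim {n = n} {V = V} (c , c≥0 , c₁ , e) = c , c≥0 , trans (sym (sumℚ≡sum c)) c₁ ,
    λ j → trans (sym (sumℚ≡sum (λ i → c i * ι (ℤ.+ n ℤ.* lookup (V i) j)))) (e j)

  inDilate-intro : ∀ {m d n x} {V : Fin m → Vec ℤ d} (c : Fin m → ℚ) → (∀ i → 0# ≤ᵣ c i) → sum c ≡ 1# →
                   (∀ j → sum (λ i → c i * ι (ℤ.+ n ℤ.* lookup (V i) j)) ≡ ι (lookup x j)) → InDilate V n x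
  inDilate-intro {n = n} {V = V} c c≥0 c₁ e = c , c≥0 , trans (sumℚ≡sum c) c₁ ,
    λ j → trans (sumℚ≡sum (λ i → c i * ι (ℤ.+ n ℤ.* lookup (V i) j))) (e j)

ιₙ : ℕ → ℚ
ιₙ n = ι (ℤ.+ n)

ι-sum : ∀ {n} (f : Fin n → ℤ) → ι (sumℤ f) ≡ sum (ι ∘ f)
ι-sum {zero}  f = ι-0
ι-sum {suc n} f = trans (ι-+ (f zero) (sumℤ (f ∘ suc))) (cong (ι (f zero) +_) (ι-sum (f ∘ suc)))

ι-- : ∀ x y → ι (x ℤ.- y) ≡ ι x - ι y
ι-- x y = trans (ι-+ x (ℤ.- y)) (cong (ι x +_) (ι-neg y))

sum-pos : ∀ {n} {f : Fin n → ℚ} → (∀ i → 0# <ᵣ f i) → Fin n → 0# <ᵣ sum f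
sum-pos {suc n} f>0 _ = +-pos-nonneg (f>0 zero) (sum-nonneg λ i → ℚP.<⇒≤ (f>0 (suc i)))

pos-cons : ∀ {N} {w : Fin (suc N) → ℚ} → 0# ≤ᵣ w zero → Pos (w ∘ suc) → Pos w
pos-cons {w = w} h p with ℚP.<-cmp 0# (w zero)
... | tri< w₀>0 _ _ = inj₁ w₀>0
... | tri≈ _ e _    = inj₂ (sym e , p)
... | tri> _ _ w₀<0 = contradiction h (<⇒≱ᵣ w₀<0)

nonneg-entries : ∀ {N} {w : Fin N → ℚ} → (∀ k → 0# ≤ᵣ w k) → NonNeg w
nonneg-entries {zero}  h = inj₁ λ ()
nonneg-entries {suc N} {w} h with nonneg-entries (h ∘ suc)
... | inj₂ p = inj₂ (pos-cons {w = w} (h zero) p)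
... | inj₁ z with ℚP.<-cmp 0# (w zero)
...   | tri< w₀>0 _ _ = inj₂ (inj₁ w₀>0)
...   | tri≈ _ e _    = inj₁ λ { zero → sym e ; (suc k) → z k }
...   | tri> _ _ w₀<0 = contradiction (h zero) (<⇒≱ᵣ w₀<0)

pos-unit : ∀ {N} {w : Fin N → ℚ} l → (∀ k → k ≢ l → w k ≡ 0#) → 0# <ᵣ w l → Pos w
pos-unit zero    off at = inj₁ at
pos-unit (suc l) off at = inj₂ (off zero (λ ()) , pos-unit l (λ k ne → off (suc k) (ne ∘ FinP.suc-injective)) at)

homogenize : ∀ {m d} → (Fin m → Vec ℤ d) → Fin m → Fin (suc d) → ℚ
homogenize V i = pt 1 (V i)

homogenize>0 : ∀ {m d} (V : Fin m → Vec ℤ d) i → 0# <ᵣ homogenize V i zero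
homogenize>0 V i = subst (0# <ᵣ_) (sym ι-1) 0<1

-- The generators together with their sum, an interior point of the cone that is pulled first.
withApex : ∀ {m d} → (Fin m → Vec ℤ d) → Fin (suc m) → Fin (suc d) → ℚ
withApex V zero    j = sum (λ i → homogenize V i j)
withApex V (suc i) j = homogenize V i j

withApex>0 : ∀ {m d} (V : Fin m → Vec ℤ d) → Fin m → ∀ i → 0# <ᵣ withApex V i zero
withApex>0 V i₀ zero    = sum-pos (homogenize>0 V) i₀
withApex>0 V i₀ (suc i) = homogenize>0 V i

-- The height coordinate expresses z_0 as -Σ z_k, which turns the other coordinates into a relation
-- among the differences from the first vertex.
affIndep⇒independent : ∀ {d} {W : Fin (suc d) → Vec ℤ d} → AffIndep W → ∀ z → (∀ j → comb z (homogenize W) j ≡ 0#) → ∀ k → z k ≡ 0#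
affIndep⇒independent {d} {W} indep z dep = λ { zero → trans z₀≡ (trans (cong -_ (sum-0 tail≡0)) neg-0) ; (suc k) → tail≡0 k }
  where
  z₀≡ : z zero ≡ - sum (z ∘ suc)
  z₀≡ = trans (eq (z zero) (sum (z ∘ suc))) (trans (cong (_- sum (z ∘ suc))
    (trans (sum-cong {f = z} λ k → sym (trans (cong (z k *_) ι-1) (*-identityʳ (z k)))) (dep zero))) (+-identityˡ _))
    where
    opaque
      unfolding _+_
      eq : ∀ x y → x ≡ x + y - y
      eq = solve-∀ ℚ-ring
  tail≡0 : ∀ k → z (suc k) ≡ 0#
  tail≡0 = affIndep-elim {W = W} indep (z ∘ suc) λ j → trans
    (trans (sum-cong λ k → trans (cong (z (suc k) *_) (ι-- (lookup (W (suc k)) j) (lookup (W zero) j))) (eq (z (suc k)) (ι (lookup (W (suc k)) j)) (ι (lookup (W zero) j))))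
      (trans (sum-+ (λ k → z (suc k) * ι (lookup (W (suc k)) j)) (λ k → z (suc k) * - ι (lookup (W zero) j)))
        (cong (sum (λ k → z (suc k) * ι (lookup (W (suc k)) j)) +_) (sum-*ʳ (- ι (lookup (W zero) j)) (z ∘ suc)))))
    (trans (trans (eq₂ (sum (λ k → z (suc k) * ι (lookup (W (suc k)) j))) (sum (z ∘ suc)) (ι (lookup (W zero) j)))
      (cong (λ e → e * ι (lookup (W zero) j) + sum (λ k → z (suc k) * ι (lookup (W (suc k)) j))) (sym z₀≡))) (dep (suc j)))
    where
    opaque
      unfolding _+_
      eq : ∀ z x y → z * (x - y) ≡ z * x + z * - y
      eq = solve-∀ ℚ-ring
      eq₂ : ∀ s t w → s + t * - w ≡ - t * w + s
      eq₂ = solve-∀ ℚ-ring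

-- The apex is compared before all other generators, so a representation that uses it would exceed a
-- canonical one that does not.
apex∈support : ∀ {m d N} (V : Fin m → Vec ℤ d) {x : Fin N → Fin (suc d) → ℚ} (K : Cone.Canonical (withApex V) x) {c} →
               Cone.IsRep (withApex V) x c → (IsZero (Cone.Canonical.coeff K zero) → Pos (c zero)) → lookup (Cone.Canonical.support K) zero ≡ true
apex∈support V {x} K {c} r c₀>0 with lookup (Cone.Canonical.support K) zero in e
... | true  = refl
... | false = ⊥-elim (good-lex {S = support} {z = λ i k → c i k - coeff i k} good
        (λ k j → trans (comb-- (λ i → c i k) (λ i → coeff i k) (withApex V) j) (trans (cong₂ _-_ (sums r k j) (rep k j)) (+-inverseʳ (x k j))))
        (λ i e → nonneg-cong (λ k → sym (minus-zero (outside i e k))) (nonneg r i))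
        (inj₁ (pos-cong (λ k → sym (minus-zero (outside zero e k))) (c₀>0 (outside zero e)))))
  where
  open Cone (withApex V)
  open Canonical K

apex-support : ∀ {m d N} (V : Fin m → Vec ℤ d) {x : Fin N → Fin (suc d) → ℚ} (K : Cone.Canonical (withApex V) x) →
               lookup (Cone.Canonical.support K) zero ≡ true → ∃[ S ] Cone.Canonical.support K ≡ true ∷ S
apex-support V K e with Cone.Canonical.support K
apex-support V K refl | true ∷ S = S , refl

-- Perturb the apex by ε^(k+1) times the given affinely independent vertices. The canonical support
-- contains the apex, which is pulled first, and has size d + 1 by genericity; the other `d`
-- generators form S.
good-basis : ∀ {m d} (V : Fin m → Vec ℤ d) → FullDim V → ∃[ S ] count S ≡ d × Cone.Good (withApex V) (true ∷ S)
good-basis {m} {d} V (ιV , indep) = S , ℕP.suc-injective (trans (cong count (sym (proj₂ split))) size₀) , subst Good (proj₂ split) (Canonical.good K₀)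
  where
  open Cone (withApex V)
  open Existence zero (withApex>0 V (ιV zero))
  x : Fin (suc (suc d)) → Fin (suc d) → ℚ
  x zero    = withApex V zero
  x (suc k) = homogenize V (ιV k)
  c : Fin (suc m) → Fin (suc (suc d)) → ℚ
  c zero    k       = one k
  c (suc i) zero    = 0#
  c (suc i) (suc k) = δ (ιV k) i
  δ-nonneg : ∀ k i → 0# ≤ᵣ δ (ιV k) i
  δ-nonneg k i with ιV k Fin.≟ i
  ... | yes refl = subst (0# ≤ᵣ_) (sym (δ-refl (ιV k))) (ℚP.<⇒≤ 0<1)
  ... | no ne    = ℚP.≤-reflexive (sym (δ-≢ ne))
  r : IsRep x c
  r = isRep
    (λ { zero → one-nonneg ; (suc i) → nonneg-entries λ { zero → ℚP.≤-refl ; (suc k) → δ-nonneg k i } })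
    (λ { zero j → trans (cong₂ _+_ (*-identityˡ _) (sum-0 λ i → zeroˡ (homogenize V i j))) (+-identityʳ _)
       ; (suc k) j → trans (cong₂ _+_ (zeroˡ (withApex V zero j)) (sum-δ (ιV k) λ i → homogenize V i j)) (+-identityˡ _) })
  K₀ : Canonical x
  K₀ = canonical r
  apex∈ : lookup (Canonical.support K₀) zero ≡ true
  apex∈ = apex∈support V K₀ r λ _ → inj₁ 0<1
  size₀ : count (Canonical.support K₀) ≡ suc d
  size₀ = support-size K₀ suc λ z dep → affIndep⇒independent {W = V ∘ ιV} indep z dep
  split : ∃[ S ] Canonical.support K₀ ≡ true ∷ S
  split = apex-support V K₀ apex∈
  S : Vec Bool m
  S = proj₁ split

indicator : Bool → ℤ
indicator true  = ℤ.+ 1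
indicator false = ℤ.+ 0

latticeSum : ∀ {m d} → (Fin m → Vec ℤ d) → (Fin m → ℤ) → Vec ℤ d
latticeSum V u = tabulate λ j → sumℤ λ i → u i ℤ.* lookup (V i) j

pt-latticeSum : ∀ {m d} (V : Fin m → Vec ℤ d) u n → ιₙ n ≡ sum (ι ∘ u) →
                ∀ j → pt n (latticeSum V u) j ≡ comb (ι ∘ u) (homogenize V) j
pt-latticeSum V u n e zero    = trans e (sum-cong λ i → sym (trans (cong (ι (u i) *_) ι-1) (*-identityʳ _)))
pt-latticeSum V u n e (suc j) = trans (cong ι (VecP.lookup∘tabulate (λ j → sumℤ λ i → u i ℤ.* lookup (V i) j) j))
  (trans (ι-sum λ i → u i ℤ.* lookup (V i) j) (sum-cong λ i → ι-* (u i) (lookup (V i) j)))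

sum-indicator : ∀ {m} (S : Vec Bool m) → sum (λ i → ι (indicator (lookup S i))) ≡ ιₙ (count S)
sum-indicator []          = sym ι-0
sum-indicator (true  ∷ S) = trans (cong (ιₙ 1 +_) (sum-indicator S)) (sym (ι-+ (ℤ.+ 1) (ℤ.+ count S)))
sum-indicator (false ∷ S) = trans (cong₂ _+_ ι-0 (sum-indicator S)) (+-identityˡ _)

pt-- : ∀ {d n n′} (x y : Vec ℤ d) → n ≤ n′ → ∀ j → pt (n′ ∸ n) (y -ᵛ x) j ≡ pt n′ y j - pt n x j
pt-- {n = n} {n′} x y n≤n′ zero    = trans (cong ι (sym (trans (ℤP.m-n≡m⊖n n′ n) (ℤP.⊖-≥ n≤n′)))) (ι-- (ℤ.+ n′) (ℤ.+ n))
pt-- x y n≤n′ (suc j) = trans (cong ι (VecP.lookup-zipWith ℤ._-_ j y x)) (ι-- (lookup y j) (lookup x j))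

-ᵛ-cancelˡ : ∀ {d} (y x x′ : Vec ℤ d) → y -ᵛ x ≡ y -ᵛ x′ → x ≡ x′
-ᵛ-cancelˡ []      []      []        _ = refl
-ᵛ-cancelˡ (y ∷ ys) (x ∷ xs) (x′ ∷ xs′) e =
  cong₂ _∷_ (trans (eq y x) (trans (cong (λ z → y ℤ.- z) (VecP.∷-injectiveˡ e)) (sym (eq y x′)))) (-ᵛ-cancelˡ ys xs xs′ (VecP.∷-injectiveʳ e))
  where
  eq : ∀ y x → x ≡ y ℤ.- (y ℤ.- x)
  eq = solve-∀ ℤ-ring

all : ∀ {m} → Vec Bool m
all = Vec.replicate _ true

∩-all : ∀ {m} (S : Vec Bool m) → S ∩ all ≡ S
∩-all = VecP.zipWith-identityʳ BoolP.∧-identityʳ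

-- Generic perturbations and reciprocity

Generic : ∀ {m d N} → (Fin m → Vec ℤ d) → (Fin N → Fin (suc d) → ℚ) → Set
Generic {d = d} V q = ∀ n x (K : Cone.Canonical (homogenize V) (perturb q n x)) → count (Cone.Canonical.support K) ≡ suc d

module Perturbed {m d N} (V : Fin m → Vec ℤ d) (q : Fin N → Fin (suc d) → ℚ) (generic : Generic V q) where

  open PeelCone (homogenize V) (homogenize>0 V) all V (λ _ _ _ → refl) q (λ _ → ⊤) (λ _ → yes tt) (λ _ _ → tt) (suc d)
    (λ n x K _ → trans (cong count (∩-all (Cone.Canonical.support K))) (generic n x K)) public

  box-below : ∀ {n x} (B : Peeling.Box peel n x) → ∀ i → lookup (Cone.Canonical.support (proj₁ (proj₁ B))) i ≡ true →
              Pos (λ k → one k - Cone.Canonical.coeff (proj₁ (proj₁ B)) i k)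
  box-below B@((K , _) , _) i e = box-elim B i (trans (cong (λ S → lookup S i) (∩-all (Cone.Canonical.support K))) e)

-- Reciprocity: x ↦ Σ_{i ∈ S} v_i − x, where S is the support of x, exchanges the boxes for opposite perturbations.
module Reflect {m d N} (V : Fin m → Vec ℤ d) (q q⁻ : Fin N → Fin (suc d) → ℚ) (q⁻≡ : ∀ k j → q⁻ k j ≡ - q k j)
  (generic : Generic V q) (generic⁻ : Generic V q⁻) where

  private
    module P  = Perturbed V q generic
    module P⁻ = Perturbed V q⁻ generic⁻

  open Cone (homogenize V)
  open Canonical

  Reflection : ∀ n → Vec ℤ d → Vec ℤ d → Set
  Reflection n x y = Σ (Peeling.Box P.peel n x) λ ((K , _) , _) → y ≡ latticeSum V (λ i → indicator (lookup (support K) i)) -ᵛ x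

  reflect : ∀ {n x y} → n ≤ suc d → ((((K , _) , _) , _) : Reflection n x y) →
            Σ (Peeling.Box P⁻.peel (suc d ∸ n) y) λ ((K′ , _) , _) → support K′ ≡ support K
  reflect {n} {x} n≤D (B@((K , _) , _) , refl) =
    P⁻.box-intro (K′ , tt) (λ i i∈ → below i (trans (cong (λ S → lookup S i) (sym (∩-all (support K)))) i∈)) , refl
    where
    ind : Fin m → ℤ
    ind i = indicator (lookup (support K) i)
    y : Vec ℤ d
    y = latticeSum V ind -ᵛ x
    -- 1 - c_i on the support and 0 off it. Infinitesimal parts change sign, so q becomes `q⁻`;
    -- being positive and being below 1 are exchanged.
    c : Fin m → Fin (suc N) → ℚ
    c i k = one k * ι (ind i) - coeff K i k
    c-in : ∀ i → lookup (support K) i ≡ true → ∀ k → c i k ≡ one k - coeff K i k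
    c-in i e k = cong (_- coeff K i k) (trans (cong (λ s → one k * ι (indicator s)) e) (trans (cong (one k *_) ι-1) (*-identityʳ _)))
    total : ∀ k j → comb (λ i → c i k) (homogenize V) j ≡ one k * pt (suc d) (latticeSum V ind) j - perturb q n x k j
    total k j = trans (comb-- (λ i → one k * ι (ind i)) (λ i → coeff K i k) (homogenize V) j)
      (cong₂ _-_ (trans (comb-* (one k) (ι ∘ ind) (homogenize V) j)
          (cong (one k *_) (sym (pt-latticeSum V ind (suc d) (trans (cong (λ n → ιₙ n) (sym (generic n x K))) (sym (sum-indicator (support K)))) j))))
        (rep K k j))
    rep′ : ∀ k j → comb (λ i → c i k) (homogenize V) j ≡ perturb q⁻ (suc d ∸ n) y k j
    rep′ zero    j = trans (total zero j) (trans (cong (_- pt n x j) (*-identityˡ _)) (sym (pt-- x (latticeSum V ind) n≤D j)))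
    rep′ (suc k) j = trans (total (suc k) j) (trans (trans (cong (_- q k j) (zeroˡ _)) (+-identityˡ _)) (sym (q⁻≡ k j)))
    K′ : Canonical (perturb q⁻ (suc d ∸ n) y)
    K′ = record { support = support K ; coeff = c ; rep = rep′ ; good = good K
                ; inside = λ i e → pos-cong (λ k → sym (c-in i e k)) (P.box-below B i e)
                ; outside = λ i e k → trans (cong₂ (λ s c → one k * ι (indicator s) - c) e (outside K i e k))
                    (trans (cong₂ (λ z e → one k * z + e) ι-0 neg-0) (trans (cong (_+ 0#) (zeroʳ (one k))) (+-identityʳ 0#))) }
    below : ∀ i → lookup (support K) i ≡ true → Pos (λ k → one k - c i k)
    below i e = pos-cong (λ k → trans (eq (one k) (coeff K i k)) (cong (λ z → one k - z) (sym (c-in i e k)))) (inside K i e)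
      where
      opaque
        unfolding _+_
        eq : ∀ o c → c ≡ o - (o - c)
        eq = solve-∀ ℚ-ring

  -- Injectivity is enough: the opposite inequality follows by exchanging `q` with `q⁻` and n with d
  -- + 1 - n.
  reflect-≤ : ∀ {n} → n ≤ suc d → (E : Enumeration (Peeling.Box P.peel n)) (E⁻ : Enumeration (Peeling.Box P⁻.peel (suc d ∸ n))) →
              Enumeration.size E ≤ Enumeration.size E⁻
  reflect-≤ {n} n≤D E E⁻ = size-≤ E E⁻ (Reflection n) (λ B → _ , proj₁ (reflect n≤D (B , refl)) , (B , refl))
    λ { _ _ r@(((K , _) , _) , refl) r′@(((K′ , _) , _) , e) → injective r r′ }
    where
    injective : ∀ {x x′ y} → Reflection n x y → Reflection n x′ y → x ≡ x′
    injective {x} {x′} r@(((K , _) , _) , y≡) r′@(((K′ , _) , _) , y≡′) with reflect n≤D r | reflect n≤D r′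
    ... | ((L , _) , _) , eL | ((L′ , _) , _) , eL′ = -ᵛ-cancelˡ (sumOver (support K)) x x′
          (trans (sym y≡) (trans y≡′ (cong (λ S → sumOver S -ᵛ x′) (trans (sym eL′) (trans (support-unique (λ _ _ → refl) L′ L) eL)))))
      where
      sumOver : Vec Bool m → Vec ℤ d
      sumOver S = latticeSum V (λ i → indicator (lookup S i))

-- Dilates, interior and boundary under signed perturbations

low : ∀ {n} → ℕ → Fin n → Bool
low zero    _       = false
low (suc t) zero    = true
low (suc t) (suc l) = low t l

sum-low : ∀ {n} t → t ≤ n → sum {n} (λ l → ι (indicator (low t l))) ≡ ιₙ t
sum-low {n}     zero    _         = trans (sum-0 {n} λ _ → ι-0) (sym ι-0)
sum-low {suc n} (suc t) (s≤s t≤n) = trans (cong (ιₙ 1 +_) (sum-low t t≤n)) (sym (ι-+ (ℤ.+ 1) (ℤ.+ t)))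

sign : Bool → ℚ
sign true  = - 1#
sign false = 1#

pick : ∀ {m} (S : Vec Bool m) → (Fin (count S) → Bool) → Fin m → Bool
pick (true  ∷ S) b zero    = b zero
pick (true  ∷ S) b (suc i) = pick S (b ∘ suc) i
pick (false ∷ S) b zero    = false
pick (false ∷ S) b (suc i) = pick S b i

ι-pick : ∀ {m} (S : Vec Bool m) b i → ι (indicator (pick S b i)) ≡ spread S (λ l → ι (indicator (b l))) i
ι-pick (true  ∷ S) b zero    = refl
ι-pick (true  ∷ S) b (suc i) = ι-pick S (b ∘ suc) i
ι-pick (false ∷ S) b zero    = ι-0
ι-pick (false ∷ S) b (suc i) = ι-pick S b i

convert : ∀ {A : Set} {P Q : A → Set} → Enumeration P → (∀ {x} → P x → Q x) → (∀ {x} → Q x → P x) → Enumeration Q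
convert E f g = record { list = list E ; unique = unique E ; sound = f ∘ sound E ; complete = complete E ∘ g }

module _ {m d : ℕ} (V : Fin m → Vec ℤ d) where

  -- The coefficients sum to n instead of 1. Unlike a convex combination of dilated vertices, this
  -- form extends linearly to perturbed points.
  InCone : ℕ → Vec ℤ d → Set
  InCone n x = Σ (Fin m → ℚ) λ c → (∀ i → 0# ≤ᵣ c i) × (∀ j → comb c (homogenize V) j ≡ pt n x j)

  dilate⇒cone : ∀ {n x} → InDilate V n x → InCone n x
  dilate⇒cone {n} {x} w with inDilate-elim {n = n} {x} {V} w
  ... | c , c≥0 , c₁ , e = (λ i → ιₙ n * c i) , (λ i → *-nonneg (subst (_≤ᵣ ιₙ n) ι-0 (ι-mono (ℤ.+≤+ z≤n))) (c≥0 i)) , λ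
    { zero    → trans (comb-* (ιₙ n) c (homogenize V) zero)
                  (trans (cong (ιₙ n *_) (trans (sum-cong λ i → trans (cong (c i *_) ι-1) (*-identityʳ (c i))) c₁)) (*-identityʳ _))
    ; (suc j) → trans (sum-cong λ i → trans (eq (ιₙ n) (c i) (ι (lookup (V i) j))) (cong (c i *_) (sym (ι-* (ℤ.+ n) (lookup (V i) j))))) (e j) }
    where
    opaque
      unfolding _+_
      eq : ∀ n c v → n * c * v ≡ c * (n * v)
      eq = solve-∀ ℚ-ring

  cone⇒dilate : ∀ {n x} → 1 ≤ n → InCone n x → InDilate V n x
  cone⇒dilate {suc n} {x} _ (c , c≥0 , e) = inDilate-intro {n = suc n} {x} {V} (λ i → y * c i) (λ i → *-nonneg (ℚP.<⇒≤ y>0) (c≥0 i))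
    (trans (sum-*ˡ y c) (trans (cong (y *_) (trans (sum-cong λ i → sym (trans (cong (c i *_) ι-1) (*-identityʳ (c i)))) (e zero))) y*n≡1))
    λ j → trans (sum-cong λ i → trans (cong (y * c i *_) (ι-* (ℤ.+ suc n) (lookup (V i) j))) (eq y (c i) (ιₙ (suc n)) (ι (lookup (V i) j))))
      (trans (sum-*ˡ (y * ιₙ (suc n)) λ i → c i * ι (lookup (V i) j)) (trans (cong₂ _*_ y*n≡1 (e (suc j))) (*-identityˡ _)))
    where
    opaque
      unfolding _+_
      eq : ∀ y c n v → y * c * (n * v) ≡ y * n * (c * v)
      eq = solve-∀ ℚ-ring
    n>0 : 0# <ᵣ ιₙ (suc n)
    n>0 = subst (0# <ᵣ_) (sym (ι-+ (ℤ.+ 1) (ℤ.+ n))) (+-pos-nonneg (subst (0# <ᵣ_) (sym ι-1) 0<1) (subst (_≤ᵣ ιₙ n) ι-0 (ι-mono (ℤ.+≤+ z≤n))))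
    y : ℚ
    y = proj₁ (inverse-pos _ n>0)
    y*n≡1 : y * ιₙ (suc n) ≡ 1#
    y*n≡1 = proj₁ (proj₂ (inverse-pos _ n>0))
    y>0 : 0# <ᵣ y
    y>0 = proj₂ (proj₂ (inverse-pos _ n>0))

  cone-zero : ∀ {x} → InCone 0 x → x ≡ Vec.replicate d (ℤ.+ 0)
  cone-zero {x} (c , c≥0 , e) = lookup-injective x _ λ j → trans (ι-injective (trans (sym (e (suc j))) (trans (sum-0 λ i → trans (cong (_* _) (c≡0 i)) (zeroˡ _)) (sym ι-0))))
    (sym (VecP.lookup-replicate j (ℤ.+ 0)))
    where
    c≡0 : ∀ i → c i ≡ 0#
    c≡0 = sum-nonneg-≡0 c≥0 (trans (sum-cong λ i → sym (trans (cong (c i *_) ι-1) (*-identityʳ (c i)))) (trans (e zero) ι-0))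

  zero-cone : InCone 0 (Vec.replicate d (ℤ.+ 0))
  zero-cone = (λ _ → 0#) , (λ _ → ℚP.≤-refl) , λ
    { zero → trans (sum-0 {m} λ i → zeroˡ _) (sym ι-0)
    ; (suc j) → trans (sum-0 {m} λ i → zeroˡ _) (sym (trans (cong ι (VecP.lookup-replicate j (ℤ.+ 0))) ι-0)) }

  -- `IsFStar` provides lists from n = 1 on, whereas partial sums start at 0; the level n = 0 of the
  -- cone consists of the origin and is supplied by hand.
  cone-points : ∀ {f} → IsFStar V f → ∀ n → Enumeration (InCone n)
  cone-points fs zero = record
    { list     = Vec.replicate d (ℤ.+ 0) ∷ []
    ; unique   = [] ∷ []
    ; sound    = λ { (here refl) → zero-cone }
    ; complete = λ w → here (cone-zero w) }
  cone-points fs (suc n) with fs (suc n) (s≤s z≤n)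
  ... | L , u , iff , _ = record
    { list     = L
    ; unique   = u
    ; sound    = λ {x} x∈ → dilate⇒cone (Equivalence.to (iff x) x∈)
    ; complete = λ {x} w → Equivalence.from (iff x) (cone⇒dilate (s≤s z≤n) w) }

-- The polytope seen from the cone over a good basis S, perturbed by q = ε·apex + Σ_k ±ε^(k+2) v_k, where v_k runs
-- through S and the sign is negative for the first t indices.
module Dilates {m : ℕ} (S : Vec Bool m) (V : Fin m → Vec ℤ (count S)) (i₀ : Fin m)
  (goodS : Cone.Good (withApex V) (true ∷ S)) (t : ℕ) (t≤d : t ≤ count S) where

  private
    d : ℕ
    d = count S
    g : Fin m → Fin (suc d) → ℚ
    g = homogenize V
    s : Fin d → ℚ
    s k = sign (low t k)

  Tuple : Set
  Tuple = Fin (suc (suc d)) → ℚ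

  module G = Cone g
  module B = Cone (withApex V)

  q q⁻ : Fin (suc d) → Fin (suc d) → ℚ
  q zero    j = withApex V zero j
  q (suc k) j = s k * g (enum S k) j
  q⁻ k j = - q k j

  -- Coefficients of the perturbation itself: ε on every generator, which makes up ε times the apex,
  -- and ±ε^(k+2) on the k-th element of S. The ε dominates, so each entry is positive whatever the
  -- signs.
  κ : Fin m → Tuple
  κ i zero          = 0#
  κ i (suc zero)    = 1#
  κ i (suc (suc k)) = spread S (λ l → s k * δ k l) i

  κ-sum : ∀ k j → comb (λ i → κ i (suc k)) g j ≡ q k j
  κ-sum zero    j = sum-cong λ i → *-identityˡ (g i j)
  κ-sum (suc k) j = trans (sum-spread S (λ l → s k * δ k l) (λ i → g i j))
    (trans (sum-cong λ l → *-assoc (s k) (δ k l) (g (enum S l) j)) (trans (sum-*ˡ (s k) λ l → δ k l * g (enum S l) j)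
      (cong (s k *_) (sum-δ k λ l → g (enum S l) j))))

  sign≢0 : ∀ b → sign b ≢ 0#
  sign≢0 false = 1≢0
  sign≢0 true  e = 1≢0 (trans (sym (neg-involutive 1#)) (trans (cong -_ e) neg-0))

  -- Up to signs the perturbation vectors are the apex and the elements of S, and a good set is
  -- independent.
  q-independent : ∀ z → (∀ j → comb z q j ≡ 0#) → ∀ k → z k ≡ 0#
  q-independent z dep = λ { zero → ζ≡0 zero
                          ; (suc k) → cancel-nonzero (sign≢0 (low t k)) (trans (sym (spread-enum S (λ k → z (suc k) * s k) k)) (ζ≡0 (suc (enum S k)))) }
    where
    ζ : Fin (suc m) → ℚ
    ζ zero    = z zero
    ζ (suc i) = spread S (λ k → z (suc k) * s k) i
    ζ≡0 : ∀ i → ζ i ≡ 0#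
    ζ≡0 = B.good⇒independent {true ∷ S} goodS ζ
      (λ { (suc i) e → spread-off S (λ k → z (suc k) * s k) i e })
      λ j → trans (cong (z zero * withApex V zero j +_) (trans (sum-spread S (λ k → z (suc k) * s k) (λ i → g i j))
              (sum-cong λ k → *-assoc (z (suc k)) (s k) (g (enum S k) j)))) (dep j)

  generic : Generic V q
  generic n x K = G.support-size K suc q-independent

  generic⁻ : Generic V q⁻
  generic⁻ n x K = G.support-size K suc λ z dep → q-independent z λ j → trans (sym (neg-involutive _)) (trans (cong -_ (trans (sym (flip z j)) (dep j))) neg-0)
    where
    flip : ∀ z j → comb z q⁻ j ≡ - comb z q j
    flip z j = trans (sum-cong λ k → sym (negʳ (z k) (q k j))) (sum-neg λ k → z k * q k j)
      where
      opaque
        unfolding _+_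
        negʳ : ∀ x y → - (x * y) ≡ x * - y
        negʳ = solve-∀ ℚ-ring

  module P  = Perturbed V q generic
  module P⁻ = Perturbed V q⁻ generic⁻

  second-pos⇒nonneg : ∀ {w : Tuple} → 0# ≤ᵣ w zero → 0# <ᵣ w (suc zero) → NonNeg w
  second-pos⇒nonneg {w} h p = inj₂ (pos-cons {w = w} h (inj₁ p))

  -- Adding ε to every coefficient keeps them nonnegative. Conversely, finite parts of a
  -- representation of x + q represent `x`, so exactly the lattice points of nP are counted.
  cone⇒X : ∀ {n x} → InCone V n x → P.X n x
  cone⇒X {n} {x} (c , c≥0 , e) = G.Existence.canonical zero (homogenize>0 V) {c = c′}
    (G.isRep (λ i → second-pos⇒nonneg (c≥0 i) 0<1) λ { zero j → e j ; (suc k) j → κ-sum k j }) , tt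
    where
    c′ : Fin m → Tuple
    c′ i zero    = c i
    c′ i (suc k) = κ i (suc k)

  canonical⇒cone : ∀ {n x q′} → G.Canonical {suc (suc d)} (perturb q′ n x) → InCone V n x
  canonical⇒cone K = (λ i → coeff i zero) , (λ i → nonneg-head (coeff-nonneg i)) , rep zero
    where open G.Canonical K

  -- A multiple of the apex that is infinitesimal but dominated by q.
  θ : Tuple
  θ zero          = 0#
  θ (suc zero)    = ½#
  θ (suc (suc k)) = 0#

  θ-pos : Pos θ
  θ-pos = inj₂ (refl , inj₁ ½#>0)

  κ-θ-nonneg : ∀ i → NonNeg (λ k → κ i k - θ k)
  κ-θ-nonneg i = inj₂ (inj₂ (+-inverseʳ 0# , inj₁ 1-½#>0))

  -- As the apex is the sum of all generators, weight `y` on it trades against weight `y` on each of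
  -- them.
  shift-apex : ∀ (c : Fin m → ℚ) y j → y * withApex V zero j + comb (λ i → c i - y) g j ≡ comb c g j
  shift-apex c y j = trans (cong (y * withApex V zero j +_) (trans (comb-- c (λ _ → y) g j) (cong (λ e → comb c g j - e) (sum-*ˡ y λ i → g i j)))) (eq (y * withApex V zero j) (comb c g j))
    where
    opaque
      unfolding _+_
      eq : ∀ a b → a + (b - a) ≡ b
      eq = solve-∀ ℚ-ring

  -- If c represents x then c + κ represents x + q; a positive part of it is moved to the apex.
  apex-rep : ∀ {n x} {q′ q″ : Fin (suc d) → Fin (suc d) → ℚ} (c : Fin m → Tuple) → G.IsRep (perturb q′ n x) c →
             (∀ k j → q′ k j + q k j ≡ q″ k j) →
             Σ (Fin (suc m) → Tuple) λ c″ → B.IsRep (perturb q″ n x) c″ × (∀ k → c″ zero k ≡ θ k)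
  apex-rep {n} {x} {q′} {q″} c r q≡ = c″ , B.isRep nonneg″ sums″ , λ _ → refl
    where
    c″ : Fin (suc m) → Tuple
    c″ zero    k = θ k
    c″ (suc i) k = (c i k + κ i k) - θ k
    nonneg″ : ∀ i → NonNeg (c″ i)
    nonneg″ zero    = inj₂ θ-pos
    nonneg″ (suc i) = nonneg-cong (λ k → eq (c i k) (κ i k) (θ k)) (nonneg-+ (G.nonneg r i) (κ-θ-nonneg i))
      where
      opaque
        unfolding _+_
        eq : ∀ a b c → a + (b - c) ≡ (a + b) - c
        eq = solve-∀ ℚ-ring
    sums″ : ∀ k j → comb (λ i → c″ i k) (withApex V) j ≡ perturb q″ n x k j
    sums″ k j = trans (shift-apex (λ i → c i k + κ i k) (θ k) j) (trans (comb-+ (λ i → c i k) (λ i → κ i k) g j) (total k))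
      where
      total : ∀ k → comb (λ i → c i k) g j + comb (λ i → κ i k) g j ≡ perturb q″ n x k j
      total zero    = trans (cong₂ _+_ (G.sums r zero j) (sum-0 λ i → zeroˡ (g i j))) (+-identityʳ _)
      total (suc k) = trans (cong₂ _+_ (G.sums r (suc k) j) (κ-sum k j)) (q≡ k j)

  unperturbed : Fin (suc d) → Fin (suc d) → ℚ
  unperturbed _ _ = 0#

  cone-rep : ∀ {n x} → InCone V n x → Σ (Fin m → Tuple) λ c → G.IsRep (perturb unperturbed n x) c
  cone-rep {n} {x} (c , c≥0 , e) = c′ , G.isRep (λ i → nonneg-entries λ { zero → c≥0 i ; (suc k) → ℚP.≤-refl })
    λ { zero j → e j ; (suc k) j → sum-0 λ i → zeroˡ (g i j) }
    where
    c′ : Fin m → Tuple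
    c′ i zero    = c i
    c′ i (suc k) = 0#

  collapse : ∀ (c : Fin (suc m) → ℚ) j → comb (λ i → c (suc i) + c zero) g j ≡ comb c (withApex V) j
  collapse c j = trans (comb-+ (λ i → c (suc i)) (λ _ → c zero) g j) (trans (cong (comb (λ i → c (suc i)) g j +_) (sum-*ˡ (c zero) λ i → g i j)) (+-comm _ _))

  apex⇒cone : ∀ {n x q′} (K : B.Canonical {suc (suc d)} (perturb q′ n x)) → InCone V n x
  apex⇒cone K = (λ i → coeff (suc i) zero + coeff zero zero) ,
    (λ i → +-nonneg (nonneg-head (coeff-nonneg (suc i))) (nonneg-head (coeff-nonneg zero))) ,
    λ j → trans (collapse (λ i → coeff i zero) j) (rep zero j)
    where open B.Canonical K

  -- By `apex-rep` the point x + q has a representation with apex weight `θ` > 0, so the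
  -- lexicographically largest one cannot omit the apex.
  ∂-apex : ∀ {n x} (K : B.Canonical (perturb q n x)) → lookup (B.Canonical.support K) zero ≡ true
  ∂-apex {n} {x} K = apex∈support V K r λ _ → pos-cong (λ k → sym (c₀ k)) θ-pos
    where
    cr = cone-rep (apex⇒cone K)
    ar = apex-rep (proj₁ cr) (proj₂ cr) λ k j → +-identityˡ (q k j)
    r : B.IsRep (perturb q n x) (proj₁ ar)
    r = proj₁ (proj₂ ar)
    c₀ : ∀ k → proj₁ ar zero k ≡ θ k
    c₀ = proj₂ (proj₂ ar)

  ∂-size : ∀ n x (K : B.Canonical (perturb q n x)) → B.Canonical.coeff K zero zero ≡ 0# →
           count (B.Canonical.support K ∩ (false ∷ all)) ≡ d
  ∂-size n x K _ with apex-support V K (∂-apex K) | B.support-size K suc q-independent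
  ... | S′ , e | size = trans (cong (λ S → count (S ∩ (false ∷ all))) e) (trans (cong count (∩-all S′)) (ℕP.suc-injective (trans (cong count (sym e)) size)))

  -- The apex is never shifted by, so its value is arbitrary.
  shiftBy : Fin (suc m) → Vec ℤ d
  shiftBy zero    = V i₀
  shiftBy (suc i) = V i

  shiftBy-correct : ∀ i → lookup (false ∷ all) i ≡ true → ∀ j → withApex V i j ≡ pt 1 (shiftBy i) j
  shiftBy-correct (suc i) _ j = refl

  module ∂ = PeelCone (withApex V) (withApex>0 V i₀) (false ∷ all) shiftBy shiftBy-correct
    q (λ c → c zero zero ≡ 0#) (λ c → c zero zero ℚP.≟ 0#) (λ same y → trans (sym (same zero refl zero)) y) d ∂-size

  -- A positive finite apex coefficient, spread over all generators, leaves room to subtract 2q from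
  -- x + q; this would place x - q in the cone.
  boundary⇒∂ : ∀ {n x} → InCone V n x → ¬ P⁻.X n x → ∂.X n x
  boundary⇒∂ {n} {x} w ¬X⁻ = K , on-boundary
    where
    ar = apex-rep (proj₁ (cone-rep w)) (proj₂ (cone-rep w)) λ k j → +-identityˡ (q k j)
    K : B.Canonical (perturb q n x)
    K = B.Existence.canonical zero (withApex>0 V i₀) (proj₁ (proj₂ ar))
    open B.Canonical K
    on-boundary : coeff zero zero ≡ 0#
    on-boundary with ℚP.<-cmp 0# (coeff zero zero)
    ... | tri≈ _ e _ = sym e
    ... | tri> _ _ n = contradiction (nonneg-head (coeff-nonneg zero)) (<⇒≱ᵣ n)
    ... | tri< p _ _ = contradiction (G.Existence.canonical zero (homogenize>0 V) {c = c} (G.isRep nonneg′ sums′) , tt) ¬X⁻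
      where
      c : Fin m → Tuple
      c i k = (coeff (suc i) k + coeff zero k) - (κ i k + κ i k)
      nonneg′ : ∀ i → NonNeg (c i)
      nonneg′ i = inj₂ (inj₁ (subst (0# <ᵣ_) (sym (minus-zero (+-identityʳ 0#))) (+-nonneg-pos (nonneg-head (coeff-nonneg (suc i))) p)))
      total : ∀ k j → comb (λ i → c i k) g j ≡ perturb q n x k j - (comb (λ i → κ i k) g j + comb (λ i → κ i k) g j)
      total k j = trans (comb-- (λ i → coeff (suc i) k + coeff zero k) (λ i → κ i k + κ i k) g j)
        (cong₂ _-_ (trans (collapse (λ i → coeff i k) j) (rep k j)) (comb-+ (λ i → κ i k) (λ i → κ i k) g j))
      sums′ : ∀ k j → comb (λ i → c i k) g j ≡ perturb q⁻ n x k j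
      sums′ zero    j = trans (total zero j) (minus-zero (trans (cong (λ e → e + e) (sum-0 λ i → zeroˡ (g i j))) (+-identityʳ 0#)))
      sums′ (suc k) j = trans (total (suc k) j) (trans (cong (λ e → q k j - (e + e)) (κ-sum k j)) (eq (q k j)))
        where
        opaque
          unfolding _+_
          eq : ∀ x → x - (x + x) ≡ - x
          eq = solve-∀ ℚ-ring

  -- If x - q lay in the cone, adding q back would represent `x` with apex weight `θ` > 0. The
  -- finite parts `flat` represent `x` with apex weight 0 and vanish off the same good support, so
  -- `Good` forbids this improvement.
  ∂⇒boundary : ∀ {n x} → ∂.X n x → InCone V n x × ¬ P⁻.X n x
  ∂⇒boundary {n} {x} (K , y) = apex⇒cone K , λ (K⁻ , _) → impossible K⁻
    where
    open B.Canonical K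
    impossible : ¬ G.Canonical (perturb q⁻ n x)
    impossible K⁻ = B.good-lex {S = support} {z = λ i k → proj₁ ar i k - flat i k} good
      (λ k j → trans (comb-- (λ i → proj₁ ar i k) (λ i → flat i k) (withApex V) j)
        (trans (cong₂ _-_ (B.sums (proj₁ (proj₂ ar)) k j) (flat-sums k j)) (+-inverseʳ _)))
      (λ i e → nonneg-cong (λ k → sym (minus-zero (flat-outside i e k))) (B.nonneg (proj₁ (proj₂ ar)) i))
      (inj₁ (pos-cong (λ k → trans (sym (proj₂ (proj₂ ar) k)) (sym (minus-zero (flat-apex k)))) θ-pos))
      where
      ar = apex-rep {q″ = unperturbed} (G.Canonical.coeff K⁻) (G.Canonical.canonical-rep K⁻) λ k j → trans (+-comm _ _) (+-inverseʳ (q k j))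
      flat : Fin (suc m) → Tuple
      flat i zero    = coeff i zero
      flat i (suc k) = 0#
      flat-sums : ∀ k j → comb (λ i → flat i k) (withApex V) j ≡ perturb unperturbed n x k j
      flat-sums zero    j = rep zero j
      flat-sums (suc k) j = sum-0 λ i → zeroˡ (withApex V i j)
      flat-outside : ∀ i → lookup support i ≡ false → ∀ k → flat i k ≡ 0#
      flat-outside i e zero    = outside i e zero
      flat-outside i e (suc k) = refl
      flat-apex : ∀ k → flat zero k ≡ 0#
      flat-apex zero    = y
      flat-apex (suc k) = refl

  -- At height 0 all finite parts vanish, so the coefficients of ε are nonnegative, while the height
  -- of -q at order ε is minus that of the apex.
  X⁻-zero : ∀ x → ¬ P⁻.X 0 x
  X⁻-zero x (K , _) = <⇒≱ᵣ (neg-neg (withApex>0 V i₀ zero)) (subst (0# ≤ᵣ_) (rep (suc zero) zero)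
      (sum-nonneg λ i → *-nonneg (second (coeff-nonneg i) (c≡0 i)) (ℚP.<⇒≤ (homogenize>0 V i))))
    where
    open G.Canonical K
    c≡0 : ∀ i → coeff i zero ≡ 0#
    c≡0 i = cancel-nonzero (λ e → ℚP.<-irrefl (sym e) (homogenize>0 V i))
      (sum-nonneg-≡0 (λ i → *-nonneg (nonneg-head (coeff-nonneg i)) (ℚP.<⇒≤ (homogenize>0 V i))) (trans (rep zero zero) ι-0) i)
    second : ∀ {w : Tuple} → NonNeg w → w zero ≡ 0# → 0# ≤ᵣ w (suc zero)
    second (inj₁ z)              _ = ℚP.≤-reflexive (sym (z (suc zero)))
    second (inj₂ (inj₁ p))       z = contradiction p (ℚP.<-irrefl (sym z))
    second {w} (inj₂ (inj₂ (_ , p))) _ = nonneg-head {w = w ∘ suc} (inj₂ p)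

  -- The witness for h∂ t ≥ 1: the sum of the first t elements of S, those with a negative sign in q.
  corner : ∃[ x ] Peeling.Box ∂.peel t x
  corner = x , ∂.box-intro {t} (K , refl) below
    where
    u : Fin m → ℤ
    u i = indicator (pick S (low t) i)
    x : Vec ℤ d
    x = latticeSum V u
    -- The apex gets ε, the first `t` elements of S get 1 - ε^(l+2), just below 1, and the others
    -- get ε^(l+2), just above 0. The signs in q are chosen for this.
    c : Fin (suc m) → Tuple
    c zero    zero          = 0#
    c zero    (suc zero)    = 1#
    c zero    (suc (suc k)) = 0#
    c (suc i) zero          = ι (u i)
    c (suc i) (suc zero)    = 0#
    c (suc i) (suc (suc k)) = κ i (suc (suc k))
    height : ιₙ t ≡ sum (ι ∘ u)
    height = sym (trans (sum-cong λ i → trans (ι-pick S (low t) i) (sym (*-identityʳ _)))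
      (trans (sum-spread S (λ l → ι (indicator (low t l))) (λ _ → 1#)) (trans (sum-cong {d} λ l → *-identityʳ (ι (indicator (low t l)))) (sum-low t t≤d))))
    c-rep : ∀ k j → comb (λ i → c i k) (withApex V) j ≡ perturb q t x k j
    c-rep zero          j = trans (cong₂ _+_ (zeroˡ _) (sym (pt-latticeSum V u t height j))) (+-identityˡ _)
    c-rep (suc zero)    j = trans (cong₂ _+_ (*-identityˡ _) (sum-0 λ i → zeroˡ (g i j))) (+-identityʳ _)
    c-rep (suc (suc k)) j = trans (cong₂ _+_ (zeroˡ _) (κ-sum (suc k) j)) (+-identityˡ _)
    head : ∀ l → ι (u (enum S l)) ≡ ι (indicator (low t l))
    head l = trans (ι-pick S (low t) (enum S l)) (spread-enum S (λ l → ι (indicator (low t l))) l)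
    tail : ∀ l k → κ (enum S l) (suc (suc k)) ≡ s k * δ k l
    tail l k = spread-enum S (λ l → s k * δ k l) l
    tail-off : ∀ l k → k ≢ l → κ (enum S l) (suc (suc k)) ≡ 0#
    tail-off l k ne = trans (tail l k) (trans (cong (s k *_) (δ-≢ ne)) (zeroʳ (s k)))
    tail-at : ∀ l b → low t l ≡ b → κ (enum S l) (suc (suc l)) ≡ sign b
    tail-at l b e = trans (tail l l) (trans (cong₂ (λ b → sign b *_) e (δ-refl l)) (*-identityʳ (sign b)))
    inside-enum : ∀ l → Pos (c (suc (enum S l)))
    inside-enum l with low t l in e
    ... | true  = inj₁ (subst (0# <ᵣ_) (sym (trans (head l) (trans (cong (ι ∘ indicator) e) ι-1))) 0<1)
    ... | false = inj₂ (trans (head l) (trans (cong (ι ∘ indicator) e) ι-0) , inj₂ (refl ,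
                    pos-unit l (tail-off l) (subst (0# <ᵣ_) (sym (tail-at l false e)) 0<1)))
    below-enum : ∀ l → Pos (λ k → one k - c (suc (enum S l)) k)
    below-enum l with low t l in e
    ... | false = inj₁ (subst (0# <ᵣ_) (sym (minus-zero (trans (head l) (trans (cong (ι ∘ indicator) e) ι-0)))) 0<1)
    ... | true  = inj₂ (trans (cong (λ e → 1# - e) (trans (head l) (trans (cong (ι ∘ indicator) e) ι-1))) (+-inverseʳ 1#) ,
                    inj₂ (+-inverseʳ 0# , pos-unit l
                      (λ k ne → trans (cong (λ e → 0# - e) (tail-off l k ne)) (+-inverseʳ 0#))
                      (subst (0# <ᵣ_) (sym (trans (cong (λ e → 0# - e) (tail-at l true e)) (eq 1#))) 0<1)))
      where
      opaque
        unfolding _+_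
        eq : ∀ x → 0# - - x ≡ x
        eq = solve-∀ ℚ-ring
    c-inside : ∀ i → lookup (true ∷ S) i ≡ true → Pos (c i)
    c-inside zero    _ = inj₂ (refl , inj₁ 0<1)
    c-inside (suc i) e with enum-onto S i e
    ... | l , refl = inside-enum l
    c-outside : ∀ i → lookup (true ∷ S) i ≡ false → IsZero (c i)
    c-outside (suc i) e zero          = trans (ι-pick S (low t) i) (spread-off S (λ l → ι (indicator (low t l))) i e)
    c-outside (suc i) e (suc zero)    = refl
    c-outside (suc i) e (suc (suc k)) = spread-off S (λ l → s k * δ k l) i e
    K : B.Canonical (perturb q t x)
    K = record { support = true ∷ S ; coeff = c ; rep = c-rep ; good = goodS ; inside = c-inside ; outside = c-outside }
    below : ∀ i → lookup ((true ∷ S) ∩ (false ∷ all)) i ≡ true → Pos (λ k → one k - c i k)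
    below (suc i) e with enum-onto S i (trans (cong (λ S → lookup S i) (sym (∩-all S))) e)
    ... | l , refl = below-enum l

  module Counts (f : Fin (suc d) → ℤ) (fs : IsFStar V f) where

    E : ∀ n → Enumeration (P.X n)
    E n = convert (cone-points V {f} fs n) cone⇒X (canonical⇒cone ∘ proj₁)

    inner? : ∀ n x → Dec (P⁻.X n x)
    inner? n x = P⁻.X? n x

    E⁻ : ∀ n → Enumeration (P⁻.X n)
    E⁻ n = convert (restrict (cone-points V {f} fs n) (inner? n)) proj₂ (λ w → canonical⇒cone (proj₁ w) , w)

    E∂ : ∀ n → Enumeration (∂.X n)
    E∂ n = convert (restrict (cone-points V {f} fs n) (λ x → ¬? (inner? n x))) (λ (w , ¬X⁻) → boundary⇒∂ w ¬X⁻) ∂⇒boundary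

    points inner boundary h h⁻ h∂ : ℕ → ℕ
    points n   = size (cone-points V {f} fs n)
    inner n    = size (E⁻ n)
    boundary n = size (E∂ n)
    h n  = size (Peeling.box P.peel E n)
    h⁻ n = size (Peeling.box P⁻.peel E⁻ n)
    h∂ n = size (Peeling.box ∂.peel E∂ n)

    points-split : ∀ n → points n ≡ inner n ℕ.+ boundary n
    points-split n = size-restrict (cone-points V {f} fs n) (inner? n)

    points-psums : ∀ n → points n ≡ psums (suc d) h n
    points-psums = Peeling.peeling P.peel E

    inner-psums : ∀ n → inner n ≡ psums (suc d) h⁻ n
    inner-psums = Peeling.peeling P⁻.peel E⁻

    boundary-psums : ∀ n → boundary n ≡ psums d h∂ n
    boundary-psums = Peeling.peeling ∂.peel E∂

    h-reflect : ∀ {n} → n ≤ suc d → h⁻ n ≡ h (suc d ∸ n)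
    h-reflect {n} n≤D = ℕP.≤-antisym
      (Reflect.reflect-≤ V q⁻ q (λ k j → sym (neg-involutive (q k j))) generic⁻ generic n≤D (Peeling.box P⁻.peel E⁻ n) (Peeling.box P.peel E (suc d ∸ n)))
      (subst (λ n′ → h (suc d ∸ n) ≤ h⁻ n′) (ℕP.m∸[m∸n]≡n n≤D)
        (Reflect.reflect-≤ V q q⁻ (λ _ _ → refl) generic generic⁻ (ℕP.m∸n≤m (suc d) n) (Peeling.box P.peel E (suc d ∸ n)) (Peeling.box P⁻.peel E⁻ (suc d ∸ (suc d ∸ n)))))

    h⁻-zero : h⁻ 0 ≡ 0
    h⁻-zero = size-empty (Peeling.box P⁻.peel E⁻ 0) λ x (X⁻ , _) → X⁻-zero x X⁻

    h∂-pos : 1 ≤ h∂ t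
    h∂-pos = size-pos (Peeling.box ∂.peel E∂ t) (proj₂ corner)

-- From Ehrhart series to f*

psum-commute : ∀ r h n → psum (psums r h) n ≡ psums r (psum h) n
psum-commute zero    h n = refl
psum-commute (suc r) h n = psum-cong (psum-commute r h) n

psum-+ : ∀ h h′ n → psum h n ℕ.+ psum h′ n ≡ psum (λ n → h n ℕ.+ h′ n) n
psum-+ h h′ zero    = refl
psum-+ h h′ (suc n) = trans (ℕP.+-assoc (psum h n) (h (suc n)) _) (trans (cong (psum h n ℕ.+_) (swap (h (suc n)) (psum h′ n) (h′ (suc n))))
  (trans (sym (ℕP.+-assoc (psum h n) (psum h′ n) _)) (cong (ℕ._+ (h (suc n) ℕ.+ h′ (suc n))) (psum-+ h h′ n))))
  where
  swap : ∀ a b c → a ℕ.+ (b ℕ.+ c) ≡ b ℕ.+ (a ℕ.+ c)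
  swap a b c = trans (sym (ℕP.+-assoc a b c)) (trans (cong (ℕ._+ c) (ℕP.+-comm a b)) (ℕP.+-assoc b a c))

psums-+ : ∀ r h h′ n → psums r h n ℕ.+ psums r h′ n ≡ psums r (λ n → h n ℕ.+ h′ n) n
psums-+ zero    h h′ n = refl
psums-+ (suc r) h h′ n = trans (psum-+ (psums r h) (psums r h′) n) (psum-cong (psums-+ r h h′) n)

psum-injective : ∀ {h h′} → (∀ n → psum h n ≡ psum h′ n) → ∀ n → h n ≡ h′ n
psum-injective e zero    = e zero
psum-injective {h} {h′} e (suc n) = ℕP.+-cancelˡ-≡ (psum h n) (h (suc n)) (h′ (suc n)) (trans (e (suc n)) (cong (ℕ._+ h′ (suc n)) (sym (e n))))

psums-injective : ∀ r {h h′} → (∀ n → psums r h n ≡ psums r h′ n) → ∀ n → h n ≡ h′ n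
psums-injective zero    e = e
psums-injective (suc r) e = psums-injective r (psum-injective e)

psum-cong-≤ : ∀ {h h′} n → (∀ j → j ≤ n → h j ≡ h′ j) → psum h n ≡ psum h′ n
psum-cong-≤ zero    e = e zero z≤n
psum-cong-≤ (suc n) e = cong₂ ℕ._+_ (psum-cong-≤ n λ j j≤n → e j (ℕP.m≤n⇒m≤1+n j≤n)) (e (suc n) ℕP.≤-refl)

psums-zero : ∀ r h → psums r h 0 ≡ h 0
psums-zero zero    h = refl
psums-zero (suc r) h = psums-zero r h

record HStar (d : ℕ) (E : ℕ → ℕ) : Set where
  field
    h        : ℕ → ℕ
    ehrhart  : ∀ n → E n ≡ psums (suc d) h n
    top      : h (suc d) ≡ 0
    hibi     : ∀ t → t ≤ d → psum (λ j → h (suc d ∸ j)) t ℕ.+ 1 ≤ psum h t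

hStar : ∀ {m d} (V : Fin m → Vec ℤ d) (fd : FullDim V) (f : Fin (suc d) → ℤ) (fs : IsFStar V f) →
        HStar d (λ n → size (cone-points V {f} fs n))
hStar {m} {d} V fd f fs with good-basis V fd
... | S , refl , goodS = record { h = h₀ ; ehrhart = D.points-psums 0 z≤n ; top = top ; hibi = hibi }
  where
  module D (t : ℕ) (t≤d : t ≤ d) = Dilates.Counts S V (proj₁ fd zero) goodS t t≤d f fs
  -- The perturbation for t = 0 fixes h; those for other `t` are compared with it.
  h₀ : ℕ → ℕ
  h₀ = D.h 0 z≤n
  top : h₀ (suc d) ≡ 0
  top = trans (sym (D.h-reflect 0 z≤n z≤n)) (D.h⁻-zero 0 z≤n)
  hibi : ∀ t → t ≤ d → psum (λ j → h₀ (suc d ∸ j)) t ℕ.+ 1 ≤ psum h₀ t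
  hibi t t≤d = subst (psum (λ j → h₀ (suc d ∸ j)) t ℕ.+ 1 ≤_) (sym (trans (difference t) (cong (ℕ._+ h∂ t) reflected)))
    (ℕP.+-monoʳ-≤ (psum (λ j → h₀ (suc d ∸ j)) t) h∂-pos)
    where
    open D t t≤d
    -- Both vectors have the same (d + 1)-fold partial sums, namely the lattice point counts.
    same : ∀ n → h n ≡ h₀ n
    same = psums-injective (suc d) λ n → trans (sym (points-psums n)) (D.points-psums 0 z≤n n)
    -- Interior points are d + 1 partial sums of `h⁻`, boundary points only d of `h∂`; stripping d
    -- partial sums from the splitting leaves one on h and on `h⁻`.
    difference : ∀ n → psum h₀ n ≡ psum h⁻ n ℕ.+ h∂ n
    difference = psums-injective d λ n → trans (sym (psum-commute d h₀ n)) (trans (sym (D.points-psums 0 z≤n n)) (trans (points-split n)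
      (trans (cong₂ ℕ._+_ (trans (inner-psums n) (psum-commute d h⁻ n)) (boundary-psums n)) (psums-+ d (psum h⁻) h∂ n))))
    reflected : psum h⁻ t ≡ psum (λ j → h₀ (suc d ∸ j)) t
    reflected = psum-cong-≤ t λ j j≤t → trans (h-reflect (ℕP.≤-trans j≤t (ℕP.m≤n⇒m≤1+n t≤d))) (same (suc d ∸ j))

nC0≡1 : ∀ n → n C 0 ≡ 1
nC0≡1 n = trans (nCk≡nC[n∸k] {0} {n} z≤n) (nCn≡1 n)

newtonSum : ∀ {d} → (Fin d → ℤ) → ℕ → ℤ
newtonSum f n = sumℤ (λ k → f k ℤ.* ℤ.+ (n C toℕ k))

sumℤ-cong : ∀ {n} {f g : Fin n → ℤ} → (∀ i → f i ≡ g i) → sumℤ f ≡ sumℤ g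
sumℤ-cong {zero}  e = refl
sumℤ-cong {suc n} e = cong₂ ℤ._+_ (e zero) (sumℤ-cong (e ∘ suc))

sumℤ-+ : ∀ {n} (f g : Fin n → ℤ) → sumℤ (λ i → f i ℤ.+ g i) ≡ sumℤ f ℤ.+ sumℤ g
sumℤ-+ {zero}  f g = refl
sumℤ-+ {suc n} f g = trans (cong (λ z → f zero ℤ.+ g zero ℤ.+ z) (sumℤ-+ (f ∘ suc) (g ∘ suc))) (eq (f zero) (g zero) (sumℤ (f ∘ suc)) (sumℤ (g ∘ suc)))
  where
  eq : ∀ a b c d → a ℤ.+ b ℤ.+ (c ℤ.+ d) ≡ a ℤ.+ c ℤ.+ (b ℤ.+ d)
  eq = solve-∀ ℤ-ring

newtonSum-zero : ∀ {d} (f : Fin (suc d) → ℤ) → newtonSum f 0 ≡ f zero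
newtonSum-zero {d} f = trans (cong₂ ℤ._+_ (trans (cong (λ c → f zero ℤ.* ℤ.+ c) (nC0≡1 0)) (ℤP.*-identityʳ (f zero)))
    (trans (sumℤ-cong λ k → trans (cong (λ c → f (suc k) ℤ.* ℤ.+ c) (k>n⇒nCk≡0 {0} {suc (toℕ k)} (s≤s z≤n))) (ℤP.*-zeroʳ (f (suc k)))) (zeros d)))
  (ℤP.+-identityʳ (f zero))
  where
  zeros : ∀ n → sumℤ {n} (λ _ → 0ℤ) ≡ 0ℤ
  zeros zero    = refl
  zeros (suc n) = trans (ℤP.+-identityˡ _) (zeros n)

newtonSum-suc : ∀ {d} (f : Fin (suc d) → ℤ) n → newtonSum f (suc n) ≡ newtonSum f n ℤ.+ newtonSum (f ∘ suc) n
newtonSum-suc f n = trans (cong₂ ℤ._+_ (cong (λ c → f zero ℤ.* ℤ.+ c) (trans (nC0≡1 (suc n)) (sym (nC0≡1 n))))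
    (trans (sumℤ-cong pascal) (sumℤ-+ (λ k → f (suc k) ℤ.* ℤ.+ (n C suc (toℕ k))) (λ k → f (suc k) ℤ.* ℤ.+ (n C toℕ k)))))
  (sym (ℤP.+-assoc (f zero ℤ.* ℤ.+ (n C 0)) (sumℤ (λ k → f (suc k) ℤ.* ℤ.+ (n C suc (toℕ k)))) (newtonSum (f ∘ suc) n)))
  where
  pascal : ∀ k → f (suc k) ℤ.* ℤ.+ (suc n C suc (toℕ k)) ≡ f (suc k) ℤ.* ℤ.+ (n C suc (toℕ k)) ℤ.+ f (suc k) ℤ.* ℤ.+ (n C toℕ k)
  pascal k = trans (cong (λ c → f (suc k) ℤ.* ℤ.+ c) (sym (trans (ℕP.+-comm (n C suc (toℕ k)) (n C toℕ k)) (nCk+nC[k+1]≡[n+1]C[k+1] n (toℕ k)))))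
    (trans (cong (λ z → f (suc k) ℤ.* z) (ℤP.pos-+ (n C suc (toℕ k)) (n C toℕ k))) (ℤP.*-distribˡ-+ (f (suc k)) (ℤ.+ (n C suc (toℕ k))) (ℤ.+ (n C toℕ k))))

-- The value at n = 0 isolates `f zero`. A forward difference then drops this term from the Newton
-- series, and on the other side removes one partial sum and advances the base point `s` by 1.
newton-coefficients : ∀ {d} r s h (f : Fin (suc d) → ℤ) → d ≤ r → (∀ n → ℤ.+ psums r h (s ℕ.+ n) ≡ newtonSum f n) →
                      ∀ k → f k ≡ ℤ.+ psums (r ∸ toℕ k) h (s ℕ.+ toℕ k)
newton-coefficients r s h f d≤r e zero = trans (sym (newtonSum-zero f)) (sym (e 0))
newton-coefficients {suc d} (suc r) s h f (s≤s d≤r) e (suc k) = trans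
  (newton-coefficients r (suc s) h (f ∘ suc) d≤r step k) (cong (λ n → ℤ.+ psums (r ∸ toℕ k) h n) (sym (ℕP.+-suc s (toℕ k))))
  where
  cancel : ∀ a b c → a ℤ.+ b ≡ a ℤ.+ c → b ≡ c
  cancel a b c p = trans (eq a b) (trans (cong (λ z → z ℤ.- a) p) (sym (eq a c)))
    where
    eq : ∀ a b → b ≡ a ℤ.+ b ℤ.- a
    eq = solve-∀ ℤ-ring
  step : ∀ n → ℤ.+ psums r h (suc s ℕ.+ n) ≡ newtonSum (f ∘ suc) n
  step n = cancel (newtonSum f n) _ _ (trans (cong (λ z → z ℤ.+ ℤ.+ psums r h (suc s ℕ.+ n)) (sym (e n)))
    (trans (sym (ℤP.pos-+ (psums (suc r) h (s ℕ.+ n)) (psums r h (suc (s ℕ.+ n)))))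
      (trans (cong (λ j → ℤ.+ psums (suc r) h j) (sym (ℕP.+-suc s n))) (trans (e (suc n)) (newtonSum-suc f n)))))

-- The converse direction: the differences rebuild the partial sums, and the series stops after `d`
-- terms because the next difference vanishes identically.
newton-expansion : ∀ {d} r s h (f : Fin d → ℤ) → d ≤ r → (∀ k → f k ≡ ℤ.+ psums (r ∸ toℕ k) h (s ℕ.+ toℕ k)) →
                   (∀ n → psums (r ∸ d) h (s ℕ.+ d ℕ.+ n) ≡ 0) → ∀ n → newtonSum f n ≡ ℤ.+ psums r h (s ℕ.+ n)
newton-expansion {zero} r s h f _ _ vanish n = cong ℤ.+_ (sym (subst (λ s → psums r h (s ℕ.+ n) ≡ 0) (ℕP.+-identityʳ s) (vanish n)))
newton-expansion {suc d} (suc r) s h f (s≤s d≤r) f≡ vanish zero = trans (newtonSum-zero f) (f≡ zero)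
newton-expansion {suc d} (suc r) s h f (s≤s d≤r) f≡ vanish (suc n) = trans (newtonSum-suc f n)
  (trans (cong₂ ℤ._+_ (newton-expansion (suc r) s h f (s≤s d≤r) f≡ vanish n)
      (newton-expansion r (suc s) h (f ∘ suc) d≤r (λ k → trans (f≡ (suc k)) (cong (λ m → ℤ.+ psums (r ∸ toℕ k) h m) (ℕP.+-suc s (toℕ k))))
        (λ n → trans (cong (λ m → psums (r ∸ d) h (m ℕ.+ n)) (sym (ℕP.+-suc s d))) (vanish n)) n))
    (trans (sym (ℤP.pos-+ (psums (suc r) h (s ℕ.+ n)) (psums r h (suc (s ℕ.+ n))))) (cong (λ m → ℤ.+ psums (suc r) h m) (sym (ℕP.+-suc s n)))))

-- Linear forms in h₀, h₁, …

-- Linear forms are kept as coefficient vectors so that nonnegativity for all natural h can be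
-- decided by inspecting signs.
Form : ℕ → Set
Form = Vec ℤ

⟦_⟧ : ∀ {n} → Form n → (ℕ → ℤ) → ℤ
⟦ [] ⟧     h = ℤ.+ 0
⟦ c ∷ cs ⟧ h = c ℤ.* h 0 ℤ.+ ⟦ cs ⟧ (h ∘ suc)

infixl 6 _⊞_ _⊟_
infixr 7 _⊡_

_⊞_ _⊟_ : ∀ {n} → Form n → Form n → Form n
_⊞_ = Vec.zipWith ℤ._+_
_⊟_ = Vec.zipWith ℤ._-_

_⊡_ : ∀ {n} → ℤ → Form n → Form n
a ⊡ u = Vec.map (a ℤ.*_) u

⟦⊞⟧ : ∀ {n} (u v : Form n) h → ⟦ u ⊞ v ⟧ h ≡ ⟦ u ⟧ h ℤ.+ ⟦ v ⟧ h
⟦⊞⟧ []      []      h = refl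
⟦⊞⟧ (x ∷ u) (y ∷ v) h = trans (cong (λ z → (x ℤ.+ y) ℤ.* h 0 ℤ.+ z) (⟦⊞⟧ u v (h ∘ suc))) (eq x y (h 0) (⟦ u ⟧ (h ∘ suc)) (⟦ v ⟧ (h ∘ suc)))
  where
  eq : ∀ x y z a b → (x ℤ.+ y) ℤ.* z ℤ.+ (a ℤ.+ b) ≡ x ℤ.* z ℤ.+ a ℤ.+ (y ℤ.* z ℤ.+ b)
  eq = solve-∀ ℤ-ring

⟦⊟⟧ : ∀ {n} (u v : Form n) h → ⟦ u ⊟ v ⟧ h ≡ ⟦ u ⟧ h ℤ.- ⟦ v ⟧ h
⟦⊟⟧ []      []      h = refl
⟦⊟⟧ (x ∷ u) (y ∷ v) h = trans (cong (λ z → (x ℤ.- y) ℤ.* h 0 ℤ.+ z) (⟦⊟⟧ u v (h ∘ suc))) (eq x y (h 0) (⟦ u ⟧ (h ∘ suc)) (⟦ v ⟧ (h ∘ suc)))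
  where
  eq : ∀ x y z a b → (x ℤ.- y) ℤ.* z ℤ.+ (a ℤ.- b) ≡ x ℤ.* z ℤ.+ a ℤ.- (y ℤ.* z ℤ.+ b)
  eq = solve-∀ ℤ-ring

⟦⊡⟧ : ∀ {n} a (u : Form n) h → ⟦ a ⊡ u ⟧ h ≡ a ℤ.* ⟦ u ⟧ h
⟦⊡⟧ a []      h = sym (ℤP.*-zeroʳ a)
⟦⊡⟧ a (x ∷ u) h = trans (cong (λ z → a ℤ.* x ℤ.* h 0 ℤ.+ z) (⟦⊡⟧ a u (h ∘ suc))) (eq a x (h 0) (⟦ u ⟧ (h ∘ suc)))
  where
  eq : ∀ a x z b → a ℤ.* x ℤ.* z ℤ.+ a ℤ.* b ≡ a ℤ.* (x ℤ.* z ℤ.+ b)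
  eq = solve-∀ ℤ-ring

zeroForm : ∀ n → Form n
zeroForm n = Vec.replicate n (ℤ.+ 0)

⟦zeroForm⟧ : ∀ n h → ⟦ zeroForm n ⟧ h ≡ ℤ.+ 0
⟦zeroForm⟧ zero    h = refl
⟦zeroForm⟧ (suc n) h = cong₂ ℤ._+_ (ℤP.*-zeroˡ (h 0)) (⟦zeroForm⟧ n (h ∘ suc))

-- The index `n`, one past the last variable, gives the zero form; this encodes h_{d+1} = 0.
variableForm : ∀ n → ℕ → Form n
variableForm zero    j       = []
variableForm (suc n) zero    = ℤ.+ 1 ∷ zeroForm n
variableForm (suc n) (suc j) = ℤ.+ 0 ∷ variableForm n j

⟦variableForm⟧ : ∀ n j h → j < n → ⟦ variableForm n j ⟧ h ≡ h j
⟦variableForm⟧ (suc n) zero    h _         = trans (cong₂ ℤ._+_ (ℤP.*-identityˡ (h 0)) (⟦zeroForm⟧ n (h ∘ suc))) (ℤP.+-identityʳ (h 0))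
⟦variableForm⟧ (suc n) (suc j) h (s≤s j<n) = trans (cong₂ ℤ._+_ (ℤP.*-zeroˡ (h 0)) (⟦variableForm⟧ n j (h ∘ suc) j<n)) (ℤP.+-identityˡ (h (suc j)))

⟦variableForm⟧-end : ∀ n h → ⟦ variableForm n n ⟧ h ≡ ℤ.+ 0
⟦variableForm⟧-end zero    h = refl
⟦variableForm⟧-end (suc n) h = cong₂ ℤ._+_ (ℤP.*-zeroˡ (h 0)) (⟦variableForm⟧-end n (h ∘ suc))

psumForm : ∀ {n} → (ℕ → Form n) → ℕ → Form n
psumForm e zero    = e zero
psumForm e (suc j) = psumForm e j ⊞ e (suc j)

psumsForm : ∀ {n} → ℕ → (ℕ → Form n) → ℕ → Form n
psumsForm zero    e = e
psumsForm (suc r) e = psumForm (psumsForm r e)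

⟦psumForm⟧ : ∀ {n} (e : ℕ → Form n) (h : ℕ → ℤ) (g : ℕ → ℕ) M → (∀ j → j ≤ M → ⟦ e j ⟧ h ≡ ℤ.+ g j) → ∀ j → j ≤ M → ⟦ psumForm e j ⟧ h ≡ ℤ.+ psum g j
⟦psumForm⟧ e h g M eq zero    j≤M = eq zero j≤M
⟦psumForm⟧ e h g M eq (suc j) j<M = trans (⟦⊞⟧ (psumForm e j) (e (suc j)) h)
  (trans (cong₂ ℤ._+_ (⟦psumForm⟧ e h g M eq j (ℕP.<⇒≤ j<M)) (eq (suc j) j<M)) (sym (ℤP.pos-+ (psum g j) (g (suc j)))))

⟦psumsForm⟧ : ∀ {n} r (e : ℕ → Form n) (h : ℕ → ℤ) (g : ℕ → ℕ) M → (∀ j → j ≤ M → ⟦ e j ⟧ h ≡ ℤ.+ g j) → ∀ j → j ≤ M → ⟦ psumsForm r e j ⟧ h ≡ ℤ.+ psums r g j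
⟦psumsForm⟧ zero    e h g M eq = eq
⟦psumsForm⟧ (suc r) e h g M eq = ⟦psumForm⟧ (psumsForm r e) h (psums r g) M (⟦psumsForm⟧ r e h g M eq)

isNonNegᵇ : ℤ → Bool
isNonNegᵇ (ℤ.+ _)   = true
isNonNegᵇ -[1+ _ ] = false

nonNegForm : ∀ {n} → Form n → Bool
nonNegForm []       = true
nonNegForm (c ∷ cs) = isNonNegᵇ c ∧ nonNegForm cs

∧-elim : ∀ {a b} → a ∧ b ≡ true → a ≡ true × b ≡ true
∧-elim {true} {true} _ = refl , refl

⟦nonNeg⟧ : ∀ {n} (u : Form n) (g : ℕ → ℕ) → nonNegForm u ≡ true → ℤ.+ 0 ℤ.≤ ⟦ u ⟧ (λ j → ℤ.+ g j)
⟦nonNeg⟧ []       g _ = ℤP.≤-refl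
⟦nonNeg⟧ (c ∷ cs) g p with ∧-elim {isNonNegᵇ c} p
⟦nonNeg⟧ (ℤ.+ c ∷ cs) g p | _ , q = ℤP.+-mono-≤ (subst (ℤ.+ 0 ℤ.≤_) (ℤP.pos-* c (g 0)) (ℤ.+≤+ z≤n)) (⟦nonNeg⟧ cs (g ∘ suc) q)

allᵇ : ∀ {n} → (Fin n → Bool) → Bool
allᵇ {zero}  p = true
allᵇ {suc n} p = p zero ∧ allᵇ (p ∘ suc)

allᵇ-elim : ∀ {n} (p : Fin n → Bool) → allᵇ p ≡ true → ∀ i → p i ≡ true
allᵇ-elim {suc n} p e zero    = proj₁ (∧-elim e)
allᵇ-elim {suc n} p e (suc i) = allᵇ-elim (p ∘ suc) (proj₂ (∧-elim {p zero} e)) i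

-- Nonnegative integers α, β, γ₁, γ₂, … such that α (f_k − f_{k−1}) − β (f_l − f_{l−1}) is Σ γ_i s_i plus a nonnegative
-- combination of the h_j, where s_i = Σ_{1 ≤ j ≤ i} (h_j − h_{d+1−j}); found by linear programming.
Multipliers : Set
Multipliers = ℕ × ℕ × List ℕ

-- At d - l = 1, 2, 3 the form f_{l-1} - f_l becomes nonnegative after removing s_2, 2 s_4 or 5 s_6;
-- at l = d it already is.
descent : ℕ → List ℕ
descent 1 = 0 ∷ 1 ∷ []
descent 2 = 0 ∷ 0 ∷ 0 ∷ 2 ∷ []
descent 3 = 0 ∷ 0 ∷ 0 ∷ 0 ∷ 0 ∷ 5 ∷ []
descent _ = []

-- The listed rows weigh the differences at k and l against each other; every other pair reaching
-- this table is settled by a descent at l alone.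
middle : ℕ → ℕ → ℕ → Multipliers
middle 7  4 5 = 2 , 1 , 0 ∷ 1 ∷ []
middle 8  5 6 = 8 , 7 , 0 ∷ 1 ∷ 6 ∷ []
middle 9  5 6 = 15 , 7 , 0 ∷ 0 ∷ 1 ∷ 6 ∷ []
middle 10 6 7 = 5 , 4 , 0 ∷ 0 ∷ 0 ∷ 7 ∷ []
middle 11 6 7 = 9 , 4 , 0 ∷ 0 ∷ 0 ∷ 0 ∷ 7 ∷ []
middle 11 6 8 = 25 , 12 , 0 ∷ 0 ∷ 0 ∷ 1 ∷ 35 ∷ []
middle 11 7 8 = 25 , 27 , 0 ∷ 0 ∷ 0 ∷ 21 ∷ 35 ∷ []
middle 12 7 8 = 4 , 3 , 0 ∷ 0 ∷ 0 ∷ 0 ∷ 1 ∷ 7 ∷ []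
middle 12 7 9 = 1 , 1 , 0 ∷ 0 ∷ 0 ∷ 0 ∷ 4 ∷ []
middle 12 8 9 = 3 , 4 , 0 ∷ 0 ∷ 0 ∷ 1 ∷ 8 ∷ []
middle 13 7 8 = 7 , 3 , 0 ∷ 0 ∷ 0 ∷ 0 ∷ 0 ∷ 8 ∷ []
middle 13 7 9 = 7 , 3 , 0 ∷ 0 ∷ 0 ∷ 0 ∷ 0 ∷ 20 ∷ []
middle 13 8 9 = 1 , 1 , 0 ∷ 0 ∷ 0 ∷ 0 ∷ 0 ∷ 4 ∷ []
middle d  k l = 0 , 1 , descent (d ∸ l)

-- For 2k ≤ d the form f_k - f_{k-1} has nonnegative coefficients, which excludes a descent at k
-- whatever follows.
multipliers : ℕ → ℕ → ℕ → Multipliers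
multipliers d k l = if (k ℕ.+ k) ℕ.≤ᵇ d then (1 , 0 , []) else middle d k l

module Certificate (d : ℕ) where

  e : ℕ → Form (suc d)
  e = variableForm (suc d)

  fForm : Fin (suc d) → Form (suc d)
  fForm k = psumsForm (suc d ∸ toℕ k) e (suc (toℕ k))

  -- Subtracting `e 0`, whose value is h_0 = 1, absorbs the extra 1 of Hibi's inequality while the
  -- form stays homogeneous.
  sForm : ℕ → Form (suc d)
  sForm i = (psumForm e i ⊟ psumForm (λ j → e (suc d ∸ j)) i) ⊟ e 0

  hibiForm : ℕ → List ℕ → Form (suc d)
  hibiForm i []      = zeroForm (suc d)
  hibiForm i (c ∷ γ) = (ℤ.+ c ⊡ sForm i) ⊞ hibiForm (suc i) γ

  difference : Vec (Form (suc d)) (suc d) → Fin d → Form (suc d)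
  difference F i = lookup F (suc i) ⊟ lookup F (inject₁ i)

  gap : Vec (Form (suc d)) (suc d) → Fin d → Fin d → Multipliers → Form (suc d)
  gap F i j (α , β , γ) = ((ℤ.+ α ⊡ difference F i) ⊟ (ℤ.+ β ⊡ difference F j)) ⊟ hibiForm 1 γ

  -- The bound on α + β keeps the certificate from being vacuous; the bound on the length keeps the
  -- indices of the s_i at most `d`, where Hibi's inequality is available.
  valid : Vec (Form (suc d)) (suc d) → Fin d → Fin d → Multipliers → Bool
  valid F i j μ@(α , β , γ) = ((1 ℕ.≤ᵇ α ℕ.+ β) ∧ (length γ ℕ.≤ᵇ d)) ∧ nonNegForm (gap F i j μ)

  validPair : Vec (Form (suc d)) (suc d) → Fin d → Fin d → Bool
  validPair F i j = if toℕ i ℕ.<ᵇ toℕ j then valid F i j (multipliers d (suc (toℕ i)) (suc (toℕ j))) else true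

  validAll : Vec (Form (suc d)) (suc d) → Bool
  validAll F = allᵇ λ i → allᵇ (validPair F i)

  certified : Bool
  certified = validAll (tabulate fForm)

-- The index runs through d = 0, ..., 13. All coefficients are closed integers, so evaluation
-- decides every pair.
all-certified : allᵇ {14} (λ d → Certificate.certified (toℕ d)) ≡ true
all-certified = refl

-- From certificates to unimodality

nonneg-*ℤ : ∀ c {x} → 0ℤ ℤ.≤ x → 0ℤ ℤ.≤ ℤ.+ c ℤ.* x
nonneg-*ℤ c {x} x≥0 = subst (ℤ._≤ ℤ.+ c ℤ.* x) (ℤP.*-zeroʳ (ℤ.+ c)) (ℤP.*-monoˡ-≤-nonNeg (ℤ.+ c) x≥0)

-- For a strict descent `x` and a strict ascent `y` neither term is positive, and the one with a
-- positive multiplier is negative.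
opposite-signs : ∀ α β {x y} → 1 ≤ α ℕ.+ β → x ℤ.< 0ℤ → 0ℤ ℤ.< y → ¬ (0ℤ ℤ.≤ ℤ.+ α ℤ.* x ℤ.- ℤ.+ β ℤ.* y)
opposite-signs zero (suc β) {x} {y} _ x<0 y>0 h = ℤP.<⇒≱ {0ℤ ℤ.* x ℤ.- ℤ.+ suc β ℤ.* y}
  (subst₂ ℤ._<_ (sym (cong (λ z → z ℤ.- ℤ.+ suc β ℤ.* y) (ℤP.*-zeroˡ x))) (trans (ℤP.+-identityˡ _) (cong ℤ.-_ (ℤP.*-zeroʳ (ℤ.+ suc β))))
    (ℤP.+-monoʳ-< (ℤ.+ 0) (ℤP.neg-mono-< (ℤP.*-monoˡ-<-pos (ℤ.+ suc β) y>0)))) h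
opposite-signs (suc α) β {x} {y} _ x<0 y>0 h = ℤP.<⇒≱
  (ℤP.+-mono-<-≤ (subst (ℤ.+ suc α ℤ.* x ℤ.<_) (ℤP.*-zeroʳ (ℤ.+ suc α)) (ℤP.*-monoˡ-<-pos (ℤ.+ suc α) x<0))
    (ℤP.neg-mono-≤ (nonneg-*ℤ β (ℤP.<⇒≤ y>0)))) h

first-failure : ∀ {n} {P : Fin n → Set} → (∀ i → Dec (P i)) → (∀ i → P i) ⊎ ∃[ i ] ¬ P i × (∀ j → toℕ j < toℕ i → P j)
first-failure {zero}  P? = inj₁ λ ()
first-failure {suc n} P? with P? zero | first-failure (P? ∘ suc)
... | no ¬p | _                    = inj₂ (zero , ¬p , λ _ ())
... | yes p | inj₁ all-P           = inj₁ λ { zero → p ; (suc i) → all-P i }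
... | yes p | inj₂ (i , ¬q , before) = inj₂ (suc i , ¬q , λ { zero _ → p ; (suc j) (s≤s j<i) → before j j<i })

NoValley : ∀ {d} → (Fin (suc d) → ℤ) → Set
NoValley {d} f = ∀ (i j : Fin d) → toℕ i < toℕ j → f (suc i) ℤ.< f (inject₁ i) → ¬ f (inject₁ j) ℤ.< f (suc j)

-- The peak sits at the first strict descent, or at the last index if there is none; an ascent after
-- it would complete a valley.
noValley⇒unimodal : ∀ {d} (f : Fin (suc d) → ℤ) → NoValley f → Unimodal f
noValley⇒unimodal {d} f nv with first-failure (λ i → f (inject₁ i) ℤP.≤? f (suc i))
... | inj₁ up = Fin.fromℕ d , (λ i _ → up i) , λ i d≤i → contradiction (subst (_≤ toℕ i) (FinP.toℕ-fromℕ d) d≤i) (ℕP.<⇒≱ (FinP.toℕ<n i))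
... | inj₂ (i , ¬up , before) = inject₁ i , (λ j j<i → before j (subst (toℕ j <_) (FinP.toℕ-inject₁ i) j<i)) , down
  where
  i-down : f (suc i) ℤ.< f (inject₁ i)
  i-down = ℤP.≰⇒> ¬up
  down : ∀ j → toℕ (inject₁ i) ≤ toℕ j → f (suc j) ℤ.≤ f (inject₁ j)
  down j i≤j with ℕP.m≤n⇒m<n∨m≡n (subst (_≤ toℕ j) (FinP.toℕ-inject₁ i) i≤j)
  ... | inj₁ i<j = ℤP.≮⇒≥ (nv i j i<j i-down)
  ... | inj₂ i≡j with FinP.toℕ-injective i≡j
  ...   | refl = ℤP.<⇒≤ i-down

module CertificateSound (d : ℕ) (h : ℕ → ℕ) (h-zero : h 0 ≡ 1) (h-top : h (suc d) ≡ 0)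
  (hibi : ∀ t → t ≤ d → psum (λ j → h (suc d ∸ j)) t ℕ.+ 1 ≤ psum h t)
  (f : Fin (suc d) → ℤ) (f≡ : ∀ k → f k ≡ ℤ.+ psums (suc d ∸ toℕ k) h (suc (toℕ k))) where

  open Certificate d

  hℤ : ℕ → ℤ
  hℤ j = ℤ.+ h j

  ⟦e⟧ : ∀ j → j ≤ suc d → ⟦ e j ⟧ hℤ ≡ ℤ.+ h j
  ⟦e⟧ j j≤D with ℕP.m≤n⇒m<n∨m≡n j≤D
  ... | inj₁ j<D  = ⟦variableForm⟧ (suc d) j hℤ j<D
  ... | inj₂ refl = trans (⟦variableForm⟧-end (suc d) hℤ) (cong ℤ.+_ (sym h-top))

  ⟦fForm⟧ : ∀ k → ⟦ fForm k ⟧ hℤ ≡ f k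
  ⟦fForm⟧ k = trans (⟦psumsForm⟧ (suc d ∸ toℕ k) e hℤ h (suc d) ⟦e⟧ (suc (toℕ k)) (FinP.toℕ<n k)) (sym (f≡ k))

  0≤sForm : ∀ t → t ≤ d → 0ℤ ℤ.≤ ⟦ sForm t ⟧ hℤ
  0≤sForm t t≤d = subst (0ℤ ℤ.≤_) (sym value) (ℤP.i≤j⇒0≤j-i {ℤ.+ (psum r t ℕ.+ 1)} (ℤ.+≤+ (hibi t t≤d)))
    where
    r : ℕ → ℕ
    r j = h (suc d ∸ j)
    t≤D : t ≤ suc d
    t≤D = ℕP.m≤n⇒m≤1+n t≤d
    regroup : ∀ a b c → a ℤ.- b ℤ.- c ≡ a ℤ.- (b ℤ.+ c)
    regroup = solve-∀ ℤ-ring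
    value : ⟦ sForm t ⟧ hℤ ≡ ℤ.+ psum h t ℤ.- ℤ.+ (psum r t ℕ.+ 1)
    value = trans (⟦⊟⟧ (psumForm e t ⊟ psumForm (λ j → e (suc d ∸ j)) t) (e 0) hℤ)
      (trans (cong₂ ℤ._-_ (trans (⟦⊟⟧ (psumForm e t) (psumForm (λ j → e (suc d ∸ j)) t) hℤ)
          (cong₂ ℤ._-_ (⟦psumForm⟧ e hℤ h (suc d) ⟦e⟧ t t≤D)
            (⟦psumForm⟧ (λ j → e (suc d ∸ j)) hℤ r (suc d) (λ j _ → ⟦e⟧ (suc d ∸ j) (ℕP.m∸n≤m (suc d) j)) t t≤D)))
        (trans (⟦e⟧ 0 z≤n) (cong ℤ.+_ h-zero)))
      (trans (regroup (ℤ.+ psum h t) (ℤ.+ psum r t) (ℤ.+ 1)) (cong (λ z → ℤ.+ psum h t ℤ.- z) (sym (ℤP.pos-+ (psum r t) 1)))))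

  0≤hibiForm : ∀ i γ → i ℕ.+ length γ ≤ suc d → 0ℤ ℤ.≤ ⟦ hibiForm i γ ⟧ hℤ
  0≤hibiForm i []      _ = ℤP.≤-reflexive (sym (⟦zeroForm⟧ (suc d) hℤ))
  0≤hibiForm i (c ∷ γ) l = subst (0ℤ ℤ.≤_) (sym (trans (⟦⊞⟧ (ℤ.+ c ⊡ sForm i) (hibiForm (suc i) γ) hℤ)
      (cong (λ z → z ℤ.+ ⟦ hibiForm (suc i) γ ⟧ hℤ) (⟦⊡⟧ (ℤ.+ c) (sForm i) hℤ))))
    (ℤP.+-mono-≤ (nonneg-*ℤ c (0≤sForm i (ℕP.≤-trans (ℕP.m≤m+n i (length γ)) (ℕP.≤-pred l′)))) (0≤hibiForm (suc i) γ l′))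
    where
    l′ : suc i ℕ.+ length γ ≤ suc d
    l′ = subst (_≤ suc d) (ℕP.+-suc i (length γ)) l

  F : Vec (Form (suc d)) (suc d)
  F = tabulate fForm

  ⟦difference⟧ : ∀ i → ⟦ difference F i ⟧ hℤ ≡ f (suc i) ℤ.- f (inject₁ i)
  ⟦difference⟧ i = trans (⟦⊟⟧ (lookup F (suc i)) (lookup F (inject₁ i)) hℤ) (cong₂ ℤ._-_ (value (suc i)) (value (inject₁ i)))
    where
    value : ∀ k → ⟦ lookup F k ⟧ hℤ ≡ f k
    value k = trans (cong (λ u → ⟦ u ⟧ hℤ) (VecP.lookup∘tabulate fForm k)) (⟦fForm⟧ k)

  valid⇒ : ∀ i j α β γ → valid F i j (α , β , γ) ≡ true →
           1 ≤ α ℕ.+ β × 0ℤ ℤ.≤ ℤ.+ α ℤ.* (f (suc i) ℤ.- f (inject₁ i)) ℤ.- ℤ.+ β ℤ.* (f (suc j) ℤ.- f (inject₁ j))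
  valid⇒ i j α β γ v with ∧-elim {(1 ℕ.≤ᵇ α ℕ.+ β) ∧ (length γ ℕ.≤ᵇ d)} v
  ... | bounds , nn with ∧-elim {1 ℕ.≤ᵇ α ℕ.+ β} bounds
  ...   | αβ , lγ = ≤ᵇ⇒≤′ 1 (α ℕ.+ β) αβ , subst (0ℤ ℤ.≤_) (undo _ _)
            (ℤP.+-mono-≤ (subst (0ℤ ℤ.≤_) value (⟦nonNeg⟧ (gap F i j (α , β , γ)) h nn)) (0≤hibiForm 1 γ (s≤s (≤ᵇ⇒≤′ (length γ) d lγ))))
    where
    ≤ᵇ⇒≤′ : ∀ m n → (m ℕ.≤ᵇ n) ≡ true → m ≤ n
    ≤ᵇ⇒≤′ m n e = ℕP.≤ᵇ⇒≤ m n (subst T (sym e) tt)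
    undo : ∀ a b → a ℤ.- b ℤ.+ b ≡ a
    undo = solve-∀ ℤ-ring
    scaled : ∀ c i → ⟦ ℤ.+ c ⊡ difference F i ⟧ hℤ ≡ ℤ.+ c ℤ.* (f (suc i) ℤ.- f (inject₁ i))
    scaled c i = trans (⟦⊡⟧ (ℤ.+ c) (difference F i) hℤ) (cong (λ z → ℤ.+ c ℤ.* z) (⟦difference⟧ i))
    value : ⟦ gap F i j (α , β , γ) ⟧ hℤ ≡
            ℤ.+ α ℤ.* (f (suc i) ℤ.- f (inject₁ i)) ℤ.- ℤ.+ β ℤ.* (f (suc j) ℤ.- f (inject₁ j)) ℤ.- ⟦ hibiForm 1 γ ⟧ hℤ
    value = trans (⟦⊟⟧ ((ℤ.+ α ⊡ difference F i) ⊟ (ℤ.+ β ⊡ difference F j)) (hibiForm 1 γ) hℤ)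
      (cong (λ z → z ℤ.- ⟦ hibiForm 1 γ ⟧ hℤ) (trans (⟦⊟⟧ (ℤ.+ α ⊡ difference F i) (ℤ.+ β ⊡ difference F j) hℤ) (cong₂ ℤ._-_ (scaled α i) (scaled β j))))

  certified⇒noValley : certified ≡ true → NoValley f
  certified⇒noValley ok i j i<j i-down j-up with multipliers d (suc (toℕ i)) (suc (toℕ j)) | pair
    where
    pair : valid F i j (multipliers d (suc (toℕ i)) (suc (toℕ j))) ≡ true
    pair = if-true (ℕP.<⇒<ᵇ i<j) (allᵇ-elim (validPair F i) (allᵇ-elim (λ i → allᵇ (validPair F i)) ok i) j)
      where
      if-true : ∀ {b c} → T b → (if b then c else true) ≡ true → c ≡ true
      if-true {true} _ e = e
  ... | α , β , γ | v with valid⇒ i j α β γ v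
  ...   | αβ , gap≥0 = opposite-signs α β αβ
            (subst (f (suc i) ℤ.- f (inject₁ i) ℤ.<_) (ℤP.+-inverseʳ (f (inject₁ i))) (ℤP.+-monoˡ-< (ℤ.- f (inject₁ i)) i-down))
            (subst (ℤ._< f (suc j) ℤ.- f (inject₁ j)) (ℤP.+-inverseʳ (f (inject₁ j))) (ℤP.+-monoˡ-< (ℤ.- f (inject₁ j)) j-up)) gap≥0

unimodal-≤13 : (d : ℕ) → d ≤ 13 → (m : ℕ) (V : Fin m → Vec ℤ d) → FullDim V → (f : Fin (suc d) → ℤ) → IsFStar V f → Unimodal f
unimodal-≤13 d d≤13 m V fd f fs = noValley⇒unimodal f (CertificateSound.certified⇒noValley d h h-zero top hibi f coefficients certified)
  where
  open HStar (hStar V fd f fs)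
  h-zero : h 0 ≡ 1
  h-zero = trans (sym (psums-zero (suc d) h)) (sym (ehrhart 0))
  values : ∀ n → ℤ.+ psums (suc d) h (suc n) ≡ newtonSum f n
  values n = trans (cong ℤ.+_ (sym (ehrhart (suc n)))) (proj₂ (proj₂ (proj₂ (fs (suc n) (s≤s z≤n)))))
  coefficients : ∀ k → f k ≡ ℤ.+ psums (suc d ∸ toℕ k) h (suc (toℕ k))
  -- The base point is 1 because the binomials are taken in n - 1.
  coefficients = newton-coefficients (suc d) 1 h f (ℕP.n≤1+n d) values
  certified : Certificate.certified d ≡ true
  certified = subst (λ d → Certificate.certified d ≡ true) (FinP.toℕ-fromℕ< (s≤s d≤13)) (allᵇ-elim {14} (λ d → Certificate.certified (toℕ d)) all-certified (fromℕ< (s≤s d≤13)))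

-- A simplex with h*-vector 1 + (q − 1) z^(a+1)

opaque
  unfolding _+_

  affIndep-intro : ∀ {d} {W : Fin (suc d) → Vec ℤ d} →
                   (∀ (c : Fin d → ℚ) → (∀ j → sum (λ i → c i * ι (lookup (W (suc i)) j ℤ.- lookup (W zero) j)) ≡ 0#) → ∀ i → c i ≡ 0#) → AffIndep W
  affIndep-intro {W = W} h c e = h c λ j → trans (sym (sumℚ≡sum (λ i → c i * ι (lookup (W (suc i)) j ℤ.- lookup (W zero) j)))) (e j)

δℤ : ∀ {n} → Fin n → Fin n → ℤ
δℤ zero    zero    = ℤ.+ 1
δℤ zero    (suc j) = 0ℤ
δℤ (suc i) zero    = 0ℤ
δℤ (suc i) (suc j) = δℤ i j

ι-δℤ : ∀ {n} (i j : Fin n) → ι (δℤ i j) ≡ δ i j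
ι-δℤ zero    zero    = ι-1
ι-δℤ zero    (suc j) = ι-0
ι-δℤ (suc i) zero    = ι-0
ι-δℤ (suc i) (suc j) = ι-δℤ i j

unique-map : ∀ {A B : Set} (f : A → B) {xs} → (∀ {x y} → x ∈ xs → y ∈ xs → f x ≡ f y → x ≡ y) → Unique xs → Unique (List.map f xs)
unique-map f {[]}     inj _          = []
unique-map f {x ∷ xs} inj (x∉xs ∷ u) = AllP.map⁺ (All.tabulate λ {y} y∈ e → All.lookup x∉xs y∈ (inj (here refl) (there y∈) e))
  ∷ unique-map f (λ p q → inj (there p) (there q)) u

weight : ∀ {r} → Vec ℕ r → ℕ
weight []       = 0
weight (k ∷ ks) = k ℕ.+ weight ks

-- Lattice points of the dilates of a half-open simplex: r multiplicities on top of a box point of prescribed height.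
module Compositions {A : Set} (ht : A → ℕ) (start : ∀ n → Enumeration (λ s → ht s ≡ n)) where

  total : ∀ {r} → Vec ℕ r × A → ℕ
  total (ks , s) = weight ks ℕ.+ ht s

  increment : ∀ {r} → Vec ℕ (suc r) × A → Vec ℕ (suc r) × A
  increment (k ∷ ks , s) = suc k ∷ ks , s

  prepend : ∀ {r} → Vec ℕ r × A → Vec ℕ (suc r) × A
  prepend (ks , s) = 0 ∷ ks , s

  increment-injective : ∀ {r} {x y : Vec ℕ (suc r) × A} → increment x ≡ increment y → x ≡ y
  increment-injective {x = k ∷ ks , s} {.k ∷ .ks , .s} refl = refl

  prepend-injective : ∀ {r} {x y : Vec ℕ r × A} → prepend x ≡ prepend y → x ≡ y
  prepend-injective refl = refl

  Composition : ℕ → ℕ → Set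
  Composition r n = Enumeration (λ (x : Vec ℕ r × A) → total x ≡ n)

  no-multiplicities : ∀ {n} → Enumeration (λ s → ht s ≡ n) → Composition 0 n
  no-multiplicities E = record
    { list     = List.map ([] ,_) (list E)
    ; unique   = UniqueP.map⁺ (λ { refl → refl }) (unique E)
    ; sound    = λ x∈ → let s , s∈ , e = MemP.∈-map⁻ ([] ,_) x∈ in trans (cong total e) (sound E s∈)
    ; complete = λ { {[] , s} e → MemP.∈-map⁺ ([] ,_) (complete E e) } }

  first-row : ∀ {r} → Composition r 0 → Composition (suc r) 0
  first-row E = record
    { list     = List.map prepend (list E)
    ; unique   = UniqueP.map⁺ prepend-injective (unique E)
    ; sound    = λ x∈ → let y , y∈ , e = MemP.∈-map⁻ prepend x∈ in trans (cong total e) (sound E y∈)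
    ; complete = λ { {zero ∷ ks , s} e → MemP.∈-map⁺ prepend (complete E e) } }

  next-row : ∀ {r n} → Composition (suc r) n → Composition r (suc n) → Composition (suc r) (suc n)
  next-row {r} {n} E F = record
    { list     = List.map increment (list E) ++ List.map prepend (list F)
    ; unique   = UniqueP.++⁺ (UniqueP.map⁺ increment-injective (unique E)) (UniqueP.map⁺ prepend-injective (unique F)) disjoint
    ; sound    = sound′
    ; complete = complete′ }
    where
    disjoint : ∀ {x} → ¬ (x ∈ List.map increment (list E) × x ∈ List.map prepend (list F))
    disjoint (p , q) with MemP.∈-map⁻ increment p | MemP.∈-map⁻ prepend q
    ... | (k ∷ ks , s) , _ , refl | _ , _ , ()
    sound′ : ∀ {x} → x ∈ List.map increment (list E) ++ List.map prepend (list F) → total x ≡ suc n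
    sound′ x∈ with MemP.∈-++⁻ (List.map increment (list E)) x∈
    sound′ x∈ | inj₁ p with MemP.∈-map⁻ increment p
    ... | (k ∷ ks , s) , y∈ , refl = cong suc (sound E y∈)
    sound′ x∈ | inj₂ p with MemP.∈-map⁻ prepend p
    ... | y , y∈ , refl = sound F y∈
    complete′ : ∀ {x} → total x ≡ suc n → x ∈ List.map increment (list E) ++ List.map prepend (list F)
    complete′ {zero  ∷ ks , s} e = MemP.∈-++⁺ʳ (List.map increment (list E)) (MemP.∈-map⁺ prepend (complete F e))
    complete′ {suc k ∷ ks , s} e = MemP.∈-++⁺ˡ (MemP.∈-map⁺ increment (complete E (ℕP.suc-injective e)))

  compositions : ∀ r n → Composition r n
  compositions zero    n       = no-multiplicities (start n)
  compositions (suc r) zero    = first-row (compositions r zero)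
  compositions (suc r) (suc n) = next-row (compositions (suc r) n) (compositions r (suc n))

  size-compositions : ∀ r n → size (compositions r n) ≡ psums r (λ n → size (start n)) n
  size-compositions zero    n       = ListP.length-map ([] ,_) (list (start n))
  size-compositions (suc r) zero    = trans (ListP.length-map prepend (list (compositions r 0))) (size-compositions r 0)
  size-compositions (suc r) (suc n) = trans (ListP.length-++ (List.map increment (list (compositions (suc r) n))))
    (cong₂ ℕ._+_ (trans (ListP.length-map increment (list (compositions (suc r) n))) (size-compositions (suc r) n))
                 (trans (ListP.length-map prepend (list (compositions r (suc n)))) (size-compositions r (suc n))))

-- The vertices are 0, (q, w) and (0, e_j), where w_j = −1 for ν_j = true and w_j = 1 for ν_j = false. The lattice is
-- generated over the vertices by one point with barycentric coordinates 1/q and −1/q, each a + 1 times modulo 1.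
module CyclicSimplex (p a q′ : ℕ) (ν : Vec Bool p) (trues : count ν ≡ a) (falses : count (Vec.map not ν) ≡ a) where

  q : ℕ
  q = suc q′

  w : Bool → ℤ
  w true  = -[1+ 0 ]
  w false = ℤ.+ 1

  V : Fin (suc (suc p)) → Vec ℤ (suc p)
  V zero          = Vec.replicate (suc p) (ℤ.+ 0)
  V (suc zero)    = ℤ.+ q ∷ Vec.map w ν
  V (suc (suc i)) = 0ℤ ∷ tabulate (λ j → δℤ j i)

  -- A nonzero multiple s of the generating point has a + 1 barycentric coordinates s/q and a + 1
  -- coordinates 1 - s/q, so its height is a + 1 for every such s.
  ht : Fin q → ℕ
  ht zero    = 0
  ht (suc _) = suc a

  start : ∀ n → Enumeration (λ s → ht s ≡ n)
  start zero = record
    { list = zero ∷ [] ; unique = [] ∷ []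
    ; sound = λ { (here refl) → refl }
    ; complete = λ { {zero} _ → here refl } }
  start (suc n) with n ℕ.≟ a
  ... | yes refl = record
    { list = List.map suc (List.allFin q′)
    ; unique = UniqueP.map⁺ FinP.suc-injective (UniqueP.allFin⁺ q′)
    ; sound = λ x∈ → let s , _ , e = MemP.∈-map⁻ suc x∈ in cong ht e
    ; complete = λ { {suc s} _ → MemP.∈-map⁺ suc (MemP.∈-allFin s) } }
  ... | no n≢a = record
    { list = [] ; unique = []
    ; sound = λ ()
    ; complete = λ { {suc s} e → contradiction (sym (ℕP.suc-injective e)) n≢a } }

  hStarVector : ℕ → ℕ
  hStarVector n = size (start n)

  open Compositions ht start

  -- This is s/q rounded up, so that `jump s` minus s/q is the fractional part of -s/q also at s =
  -- 0.
  jump : Fin q → ℕ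
  jump zero    = 0
  jump (suc _) = 1

  -- The value of (κ + s/q) w_j plus the multiplicity and fractional part at the j-th unit vertex;
  -- the sign w_j makes the fractions cancel.
  coord : Bool → ℕ → ℕ → ℕ → ℤ
  coord true  κ b k = ℤ.+ k ℤ.- ℤ.+ κ
  coord false κ b k = ℤ.+ k ℤ.+ ℤ.+ κ ℤ.+ ℤ.+ b

  coords : ℕ → Fin q → Vec ℕ p → Fin p → ℤ
  coords κ s ks j = coord (lookup ν j) κ (jump s) (lookup ks j)

  -- The first coordinate stores κ as quotient and s as remainder modulo q, which makes the
  -- parametrisation invertible.
  point : Vec ℕ (suc (suc p)) × Fin q → Vec ℤ (suc p)
  point (k₀ ∷ κ ∷ ks , s) = ℤ.+ (toℕ s ℕ.+ κ ℕ.* q) ∷ tabulate (coords κ s ks)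

  q⁻¹ : ∃[ u ] u * ιₙ q ≡ 1# × 0# <ᵣ u
  q⁻¹ = inverse-pos (ιₙ q) (subst (_<ᵣ ιₙ q) ι-0 (ℚP.≰⇒> λ h → contradiction (ι-cancel-≤ h) λ { (ℤ.+≤+ ()) }))

  q≢0 : ιₙ q ≢ 0#
  q≢0 e with ι-injective {ℤ.+ q} {0ℤ} (trans e (sym ι-0))
  ... | ()

  ρ β : Fin q → ℚ
  ρ s = ιₙ (toℕ s) * proj₁ q⁻¹
  β s = ιₙ (jump s)

  ι≥0 : ∀ n → 0# ≤ᵣ ιₙ n
  ι≥0 n = subst (_≤ᵣ ιₙ n) ι-0 (ι-mono (ℤ.+≤+ z≤n))

  ρ≥0 : ∀ s → 0# ≤ᵣ ρ s
  ρ≥0 s = *-nonneg (ι≥0 (toℕ s)) (ℚP.<⇒≤ (proj₂ (proj₂ q⁻¹)))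

  ρ*q : ∀ s → ρ s * ιₙ q ≡ ιₙ (toℕ s)
  ρ*q s = trans (*-assoc (ιₙ (toℕ s)) (proj₁ q⁻¹) (ιₙ q)) (trans (cong (ιₙ (toℕ s) *_) (proj₁ (proj₂ q⁻¹))) (*-identityʳ _))

  ρ<1 : ∀ s → ρ s <ᵣ 1#
  ρ<1 s = subst₂ _<ᵣ_ (+-identityʳ (ρ s)) (trans (cong (ρ s +_) (eq (ιₙ q) (ιₙ (toℕ s)) (proj₁ q⁻¹)))
      (trans (cancel (ρ s) _) (trans (*-comm _ _) (proj₁ (proj₂ q⁻¹)))))
    (+-mono-≤-< (ℚP.≤-refl {ρ s}) (*-pos (diff-pos (ℚP.≰⇒> λ h → ℕP.<⇒≱ (FinP.toℕ<n s) (ℤ.drop‿+≤+ (ι-cancel-≤ h)))) (proj₂ (proj₂ q⁻¹))))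
    where
    opaque
      unfolding _+_
      eq : ∀ x y u → (x - y) * u ≡ x * u - y * u
      eq = solve-∀ ℚ-ring
      cancel : ∀ x y → x + (y - x) ≡ y
      cancel = solve-∀ ℚ-ring

  ρ≤β : ∀ s → 0# ≤ᵣ β s - ρ s
  ρ≤β zero    = ℚP.≤-reflexive (sym (trans (cong₂ _-_ ι-0 (trans (cong (_* proj₁ q⁻¹) ι-0) (zeroˡ _))) (+-inverseʳ 0#)))
  ρ≤β (suc s) = diff-nonneg (ℚP.<⇒≤ (subst (ρ (suc s) <ᵣ_) (sym ι-1) (ρ<1 (suc s))))

  frac : Bool → Fin q → ℚ
  frac true  s = ρ s
  frac false s = β s - ρ s

  frac≥0 : ∀ b s → 0# ≤ᵣ frac b s
  frac≥0 true  = ρ≥0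
  frac≥0 false = ρ≤β

  sum-frac : ∀ s → sum (λ j → frac (lookup ν j) s) ≡ ιₙ a * β s
  sum-frac s = trans (go ν) (trans (cong₂ (λ t f → ιₙ t * ρ s + ιₙ f * (β s - ρ s)) trues falses) (eq (ιₙ a) (ρ s) (β s)))
    where
    opaque
      unfolding _+_
      eq : ∀ x r b → x * r + x * (b - r) ≡ x * b
      eq = solve-∀ ℚ-ring
      add₁ : ∀ r t f g → r + (t * r + f * g) ≡ (1# + t) * r + f * g
      add₁ = solve-∀ ℚ-ring
      add₂ : ∀ r t f g → g + (t * r + f * g) ≡ t * r + (1# + f) * g
      add₂ = solve-∀ ℚ-ring
    ι-suc : ∀ n → 1# + ιₙ n ≡ ιₙ (suc n)
    ι-suc n = trans (cong (_+ ιₙ n) (sym ι-1)) (sym (ι-+ (ℤ.+ 1) (ℤ.+ n)))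
    go : ∀ {p} (ν : Vec Bool p) → sum (λ j → frac (lookup ν j) s) ≡ ιₙ (count ν) * ρ s + ιₙ (count (Vec.map not ν)) * (β s - ρ s)
    go []          = sym (trans (cong₂ _+_ (trans (cong (_* ρ s) ι-0) (zeroˡ _)) (trans (cong (_* (β s - ρ s)) ι-0) (zeroˡ _))) (+-identityʳ 0#))
    go (true  ∷ ν) = trans (cong (ρ s +_) (go ν)) (trans (add₁ (ρ s) _ _ _) (cong (λ t → t * ρ s + ιₙ (count (Vec.map not ν)) * (β s - ρ s)) (ι-suc (count ν))))
    go (false ∷ ν) = trans (cong (β s - ρ s +_) (go ν)) (trans (add₂ (ρ s) _ _ (β s - ρ s)) (cong (λ f → ιₙ (count ν) * ρ s + f * (β s - ρ s)) (ι-suc (count (Vec.map not ν)))))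

  -- The barycentric coordinates of a point, multiplied by its height.
  bary : Vec ℕ (suc (suc p)) × Fin q → Fin (suc (suc p)) → ℚ
  bary (k₀ ∷ κ ∷ ks , s) zero          = ιₙ k₀ + (β s - ρ s)
  bary (k₀ ∷ κ ∷ ks , s) (suc zero)    = ιₙ κ + ρ s
  bary (k₀ ∷ κ ∷ ks , s) (suc (suc j)) = ιₙ (lookup ks j) + frac (lookup ν j) s

  ι-weight : ∀ {r} (ks : Vec ℕ r) → sum (λ j → ιₙ (lookup ks j)) ≡ ιₙ (weight ks)
  ι-weight []       = sym ι-0
  ι-weight (k ∷ ks) = trans (cong (ιₙ k +_) (ι-weight ks)) (sym (ι-+ (ℤ.+ k) (ℤ.+ weight ks)))

  ι-ht : ∀ s → ιₙ a * β s + β s ≡ ιₙ (ht s)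
  ι-ht zero    = trans (cong (λ b → ιₙ a * b + b) ι-0) (trans (+-identityʳ _) (trans (zeroʳ _) (sym ι-0)))
  ι-ht (suc s) = trans (cong (λ b → ιₙ a * b + b) ι-1) (trans (cong (_+ 1#) (*-identityʳ _)) (trans (+-comm _ _) (trans (cong (_+ ιₙ a) (sym ι-1)) (sym (ι-+ (ℤ.+ 1) (ℤ.+ a))))))

  sum-bary : ∀ x → sum (bary x) ≡ ιₙ (total x)
  sum-bary (k₀ ∷ κ ∷ ks , s) = trans
    (cong (λ e → ιₙ k₀ + (β s - ρ s) + (ιₙ κ + ρ s + e)) (trans (sum-+ (λ j → ιₙ (lookup ks j)) (λ j → frac (lookup ν j) s)) (cong₂ _+_ (ι-weight ks) (sum-frac s))))
    (trans (eq (ιₙ k₀) (ιₙ κ) (β s) (ρ s) (ιₙ (weight ks)) (ιₙ a))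
      (trans (cong₂ _+_ (trans (cong (ιₙ k₀ +_) (sym (ι-+ (ℤ.+ κ) (ℤ.+ weight ks)))) (sym (ι-+ (ℤ.+ k₀) (ℤ.+ (κ ℕ.+ weight ks))))) (ι-ht s))
        (sym (ι-+ (ℤ.+ (k₀ ℕ.+ (κ ℕ.+ weight ks))) (ℤ.+ ht s)))))
    where
    opaque
      unfolding _+_
      eq : ∀ k κ b r w a → k + (b - r) + (κ + r + (w + a * b)) ≡ (k + (κ + w)) + (a * b + b)
      eq = solve-∀ ℚ-ring

  V-comb : ∀ c j → comb c (homogenize V) (suc j) ≡ c (suc zero) * ι (lookup (V (suc zero)) j) + sum (λ i → c (suc (suc i)) * ι (lookup (V (suc (suc i))) j))
  V-comb c j = trans (cong (_+ (c (suc zero) * ι (lookup (V (suc zero)) j) + sum (λ i → c (suc (suc i)) * ι (lookup (V (suc (suc i))) j)))) (trans (cong (c zero *_) (trans (cong ι (VecP.lookup-replicate j (ℤ.+ 0))) ι-0)) (zeroʳ _))) (+-identityˡ _)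

  V-comb-zero : ∀ c → comb c (homogenize V) (suc zero) ≡ c (suc zero) * ιₙ q
  V-comb-zero c = trans (V-comb c zero) (trans (cong (c (suc zero) * ιₙ q +_) (sum-0 {p} λ i → trans (cong (c (suc (suc i)) *_) ι-0) (zeroʳ _))) (+-identityʳ _))

  V-comb-suc : ∀ c j → comb c (homogenize V) (suc (suc j)) ≡ c (suc zero) * ι (w (lookup ν j)) + c (suc (suc j))
  V-comb-suc c j = trans (V-comb c (suc j)) (cong₂ _+_ (cong (λ z → c (suc zero) * ι z) (VecP.lookup-map j w ν))
    (trans (sum-cong λ i → trans (cong (λ z → c (suc (suc i)) * ι z) (VecP.lookup∘tabulate (λ j → δℤ j i) j)) (trans (cong (c (suc (suc i)) *_) (ι-δℤ j i)) (*-comm _ _)))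
      (sum-δ j λ i → c (suc (suc i)))))

  ι-coord : ∀ b κ s k → (ιₙ κ + ρ s) * ι (w b) + (ιₙ k + frac b s) ≡ ι (coord b κ (jump s) k)
  ι-coord true  κ s k = trans (cong (λ e → (ιₙ κ + ρ s) * e + (ιₙ k + ρ s)) (trans (ι-neg (ℤ.+ 1)) (cong -_ ι-1)))
    (trans (eq (ιₙ κ) (ρ s) (ιₙ k)) (sym (ι-- (ℤ.+ k) (ℤ.+ κ))))
    where
    opaque
      unfolding _+_
      eq : ∀ κ r k → (κ + r) * - 1# + (k + r) ≡ k - κ
      eq = solve-∀ ℚ-ring
  ι-coord false κ s k = trans (cong (λ e → (ιₙ κ + ρ s) * e + (ιₙ k + (β s - ρ s))) ι-1)
    (trans (eq (ιₙ κ) (ρ s) (ιₙ k) (β s)) (sym (trans (ι-+ (ℤ.+ k ℤ.+ ℤ.+ κ) (ℤ.+ jump s)) (cong (_+ β s) (ι-+ (ℤ.+ k) (ℤ.+ κ))))))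
    where
    opaque
      unfolding _+_
      eq : ∀ κ r k b → (κ + r) * 1# + (k + (b - r)) ≡ (k + κ) + b
      eq = solve-∀ ℚ-ring

  ι-first : ∀ κ s → (ιₙ κ + ρ s) * ιₙ q ≡ ιₙ (toℕ s ℕ.+ κ ℕ.* q)
  ι-first κ s = trans (distribʳ (ιₙ q) (ιₙ κ) (ρ s)) (trans (+-comm _ _) (trans (cong₂ _+_ (ρ*q s) (trans (sym (ι-* (ℤ.+ κ) (ℤ.+ q))) (cong ι (sym (ℤP.pos-* κ q)))))
    (sym (ι-+ (ℤ.+ toℕ s) (ℤ.+ (κ ℕ.* q))))))

  sum-heights : ∀ (c : Fin (suc (suc p)) → ℚ) → comb c (homogenize V) zero ≡ sum c
  sum-heights c = sum-cong λ i → trans (cong (c i *_) ι-1) (*-identityʳ (c i))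

  point-in-cone : ∀ x {n} → total x ≡ n → InCone V n (point x)
  point-in-cone x@(k₀ ∷ κ ∷ ks , s) refl = bary x ,
    (λ { zero → +-nonneg (ι≥0 k₀) (ρ≤β s) ; (suc zero) → +-nonneg (ι≥0 κ) (ρ≥0 s) ; (suc (suc j)) → +-nonneg (ι≥0 (lookup ks j)) (frac≥0 (lookup ν j) s) }) ,
    λ { zero → trans (sum-heights (bary x)) (sum-bary x)
      ; (suc zero) → trans (V-comb-zero (bary x)) (ι-first κ s)
      ; (suc (suc j)) → trans (V-comb-suc (bary x) j) (trans (ι-coord (lookup ν j) κ s (lookup ks j))
          (cong ι (sym (VecP.lookup∘tabulate (coords κ s ks) j)))) }

  coord-injective : ∀ b κ c {k k′} → coord b κ c k ≡ coord b κ c k′ → k ≡ k′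
  coord-injective true  κ c {k} {k′} e = ℤP.+-injective (ℤ-+-cancelʳ (ℤ.- (ℤ.+ κ)) (ℤ.+ k) (ℤ.+ k′) e)
  coord-injective false κ c {k} {k′} e = ℤP.+-injective (ℤ-+-cancelʳ (ℤ.+ κ) (ℤ.+ k) (ℤ.+ k′) (ℤ-+-cancelʳ (ℤ.+ c) (ℤ.+ k ℤ.+ ℤ.+ κ) (ℤ.+ k′ ℤ.+ ℤ.+ κ) e))

  remainder : ∀ (s : Fin q) κ → (toℕ s ℕ.+ κ ℕ.* q) ℕ.% q ≡ toℕ s
  remainder s κ = trans (DivMod.[m+kn]%n≡m%n (toℕ s) κ q) (DivMod.m<n⇒m%n≡m (FinP.toℕ<n s))

  point-injective : ∀ {x y} → total x ≡ total y → point x ≡ point y → x ≡ y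
  point-injective {k₀ ∷ κ ∷ ks , s} {k₀′ ∷ κ′ ∷ ks′ , s′} totals e = go s≡ κ≡ ks≡ k₀≡
    where
    e₀ : toℕ s ℕ.+ κ ℕ.* q ≡ toℕ s′ ℕ.+ κ′ ℕ.* q
    e₀ = ℤP.+-injective (VecP.∷-injectiveˡ e)
    s≡ : s ≡ s′
    s≡ = FinP.toℕ-injective (trans (sym (remainder s κ)) (trans (cong (ℕ._% q) e₀) (remainder s′ κ′)))
    κ≡ : κ ≡ κ′
    κ≡ = ℕP.*-cancelʳ-≡ κ κ′ q (ℕP.+-cancelˡ-≡ (toℕ s) (κ ℕ.* q) (κ′ ℕ.* q) (trans e₀ (cong (λ s → toℕ s ℕ.+ κ′ ℕ.* q) (sym s≡))))
    ks≡ : ks ≡ ks′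
    ks≡ = lookup-injective ks ks′ λ j → coord-injective (lookup ν j) κ (jump s)
      (trans (sym (VecP.lookup∘tabulate (coords κ s ks) j))
        (trans (cong (λ v → lookup v j) (VecP.∷-injectiveʳ e)) (trans (VecP.lookup∘tabulate (coords κ′ s′ ks′) j)
          (cong₂ (λ κ s → coord (lookup ν j) κ (jump s) (lookup ks′ j)) (sym κ≡) (sym s≡)))))
    -- The vertex at the origin leaves no trace in the coordinates; its multiplicity is recovered
    -- from the height.
    k₀≡ : k₀ ≡ k₀′
    k₀≡ = ℕP.+-cancelʳ-≡ (κ ℕ.+ weight ks) k₀ k₀′ (ℕP.+-cancelʳ-≡ (ht s) _ _
      (trans totals (cong₂ (λ w s → k₀′ ℕ.+ w ℕ.+ ht s) (sym (cong₂ (λ κ ks → κ ℕ.+ weight ks) κ≡ ks≡)) (sym s≡))))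
    go : s ≡ s′ → κ ≡ κ′ → ks ≡ ks′ → k₀ ≡ k₀′ → (k₀ ∷ κ ∷ ks , s) ≡ (k₀′ ∷ κ′ ∷ ks′ , s′)
    go refl refl refl refl = refl

  -- An integer greater than -1 is nonnegative.
  integral : ∀ z r → r <ᵣ 1# → 0# ≤ᵣ ι z + r → 0ℤ ℤ.≤ z
  integral (ℤ.+ n)    r r<1 h = ℤ.+≤+ z≤n
  integral -[1+ n ] r r<1 h = contradiction h (<⇒≱ᵣ (subst (ι -[1+ n ] + r <ᵣ_) (trans (+-comm _ _) (+-inverseʳ 1#)) (+-mono-≤-< below r<1)))
    where
    below : ι -[1+ n ] ≤ᵣ - 1#
    below = subst (ι -[1+ n ] ≤ᵣ_) (trans (ι-neg (ℤ.+ 1)) (cong -_ ι-1)) (ι-mono (ℤ.-≤- z≤n))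

  -- Rounding up: an integer that is at least s/q is at least its ceiling `jump s`.
  integral-jump : ∀ z s → 0# ≤ᵣ ι z - ρ s → 0ℤ ℤ.≤ z ℤ.- ℤ.+ jump s
  integral-jump z zero    h = integral (z ℤ.- ℤ.+ 0) 0# 0<1
    (subst (0# ≤ᵣ_) (trans (cong (λ r → ι z - r) (trans (cong (_* proj₁ q⁻¹) ι-0) (zeroˡ _)))
      (trans (cong (ι z +_) neg-0) (cong (λ z → ι z + 0#) (sym (ℤP.+-identityʳ z))))) h)
  integral-jump z (suc s) h = integral (z ℤ.- ℤ.+ 1) (1# - ρ (suc s))
    (subst (1# - ρ (suc s) <ᵣ_) (trans (cong (1# +_) neg-0) (+-identityʳ 1#)) (+-mono-≤-< (ℚP.≤-refl {1#}) (subst (- ρ (suc s) <ᵣ_) (sym neg-0) (neg-neg ρ>0))))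
    (subst (0# ≤ᵣ_) (trans (eq (ι z) (ρ (suc s))) (cong (_+ (1# - ρ (suc s))) (sym (trans (ι-- z (ℤ.+ 1)) (cong (λ o → ι z - o) ι-1))))) h)
    where
    opaque
      unfolding _+_
      eq : ∀ z r → z - r ≡ (z - 1#) + (1# - r)
      eq = solve-∀ ℚ-ring
    ρ>0 : 0# <ᵣ ρ (suc s)
    ρ>0 = *-pos (ℚP.≰⇒> λ h → contradiction (ι-cancel-≤ (subst (ιₙ (suc (toℕ s)) ≤ᵣ_) (sym ι-0) h)) λ { (ℤ.+≤+ ()) }) (proj₂ (proj₂ q⁻¹))

  preimage : Bool → ℕ → Fin q → ℤ → ℤ
  preimage true  κ s x = x ℤ.+ ℤ.+ κ
  preimage false κ s x = x ℤ.- ℤ.+ κ ℤ.- ℤ.+ jump s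

  coord-preimage : ∀ b κ s x k → ℤ.+ k ≡ preimage b κ s x → coord b κ (jump s) k ≡ x
  coord-preimage true  κ s x k e = trans (cong (λ z → z ℤ.- ℤ.+ κ) e) (eq x (ℤ.+ κ))
    where
    eq : ∀ x k → x ℤ.+ k ℤ.- k ≡ x
    eq = solve-∀ ℤ-ring
  coord-preimage false κ s x k e = trans (cong (λ z → z ℤ.+ ℤ.+ κ ℤ.+ ℤ.+ jump s) e) (eq x (ℤ.+ κ) (ℤ.+ jump s))
    where
    eq : ∀ x k b → x ℤ.- k ℤ.- b ℤ.+ k ℤ.+ b ≡ x
    eq = solve-∀ ℤ-ring

  preimage-coeff : ∀ b κ s x {c} → (ιₙ κ + ρ s) * ι (w b) + c ≡ ι x → 0# ≤ᵣ c →
                   0ℤ ℤ.≤ preimage b κ s x × c ≡ ι (preimage b κ s x) + frac b s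
  preimage-coeff true κ s x {c} e c≥0 = integral (x ℤ.+ ℤ.+ κ) (ρ s) (ρ<1 s) (subst (0# ≤ᵣ_) c≡ c≥0) , c≡
    where
    opaque
      unfolding _+_
      eq : ∀ κ r c → c ≡ ((κ + r) * - 1# + c) + κ + r
      eq = solve-∀ ℚ-ring
    c≡ : c ≡ ι (x ℤ.+ ℤ.+ κ) + ρ s
    c≡ = trans (eq (ιₙ κ) (ρ s) c) (cong (_+ ρ s) (trans (cong (_+ ιₙ κ)
      (trans (cong (λ o → (ιₙ κ + ρ s) * o + c) (sym (trans (ι-neg (ℤ.+ 1)) (cong -_ ι-1)))) e)) (sym (ι-+ x (ℤ.+ κ)))))
  preimage-coeff false κ s x {c} e c≥0 = integral-jump (x ℤ.- ℤ.+ κ) s (subst (0# ≤ᵣ_) c≡ c≥0) ,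
    trans c≡ (trans (eq₂ (ι (x ℤ.- ℤ.+ κ)) (ρ s) (β s)) (cong (_+ (β s - ρ s)) (sym (ι-- (x ℤ.- ℤ.+ κ) (ℤ.+ jump s)))))
    where
    opaque
      unfolding _+_
      eq : ∀ κ r c → c ≡ (((κ + r) * 1# + c) - κ) - r
      eq = solve-∀ ℚ-ring
      eq₂ : ∀ y r b → y - r ≡ (y - b) + (b - r)
      eq₂ = solve-∀ ℚ-ring
    c≡ : c ≡ ι (x ℤ.- ℤ.+ κ) - ρ s
    c≡ = trans (eq (ιₙ κ) (ρ s) c) (cong (_- ρ s) (trans (cong (_- ιₙ κ)
      (trans (cong (λ o → (ιₙ κ + ρ s) * o + c) (sym ι-1)) e)) (sym (ι-- x (ℤ.+ κ)))))

  ht-jump : ∀ s → ℤ.+ ht s ≡ ℤ.+ a ℤ.* ℤ.+ jump s ℤ.+ ℤ.+ jump s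
  ht-jump zero    = sym (trans (ℤP.+-identityʳ _) (ℤP.*-zeroʳ (ℤ.+ a)))
  ht-jump (suc s) = trans (ℤP.+-comm (ℤ.+ 1) (ℤ.+ a)) (cong (λ z → z ℤ.+ ℤ.+ 1) (sym (ℤP.*-identityʳ (ℤ.+ a))))

  -- Dividing the first coordinate by q yields κ and s. Every other coefficient is then an integer
  -- plus a prescribed fraction, and its nonnegativity makes the integer a multiplicity.
  cone-point : ∀ {n x} → InCone V n x → ∃[ k ] total k ≡ n × point k ≡ x
  cone-point {n} {y ∷ xs} (c , c≥0 , e) = (k₀ ∷ κ ∷ ks , s) , total≡ , cong₂ _∷_ (trans (cong ℤ.+_ (sym y-div)) y-abs)
      (lookup-injective _ xs λ j → trans (VecP.lookup∘tabulate (coords κ s ks) j)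
        (coord-preimage (lookup ν j) κ s (lookup xs j) (lookup ks j) (ks≡ j)))
    where
    y-eq : c (suc zero) * ιₙ q ≡ ι y
    y-eq = trans (sym (V-comb-zero c)) (e (suc zero))
    y-abs : ℤ.+ ℤ.∣ y ∣ ≡ y
    y-abs = ℤP.0≤i⇒+∣i∣≡i (ι-cancel-≤ (subst₂ _≤ᵣ_ (sym ι-0) y-eq (*-nonneg (c≥0 (suc zero)) (ι≥0 q))))
    κ : ℕ
    κ = ℤ.∣ y ∣ ℕ./ q
    s : Fin q
    s = fromℕ< (DivMod.m%n<n ℤ.∣ y ∣ q)
    y-div : ℤ.∣ y ∣ ≡ toℕ s ℕ.+ κ ℕ.* q
    y-div = trans (DivMod.m≡m%n+[m/n]*n ℤ.∣ y ∣ q) (cong (ℕ._+ κ ℕ.* q) (sym (FinP.toℕ-fromℕ< (DivMod.m%n<n ℤ.∣ y ∣ q))))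
    c₁≡ : c (suc zero) ≡ ιₙ κ + ρ s
    c₁≡ = diff≡0 (cancel-nonzero q≢0 (trans (eq (c (suc zero)) (ιₙ κ + ρ s) (ιₙ q))
      (trans (cong₂ _-_ y-eq (trans (ι-first κ s) (cong ι (trans (cong ℤ.+_ (sym y-div)) y-abs)))) (+-inverseʳ (ι y)))))
      where
      opaque
        unfolding _+_
        eq : ∀ x y z → (x - y) * z ≡ x * z - y * z
        eq = solve-∀ ℚ-ring
    pre : Fin p → ℤ
    pre j = preimage (lookup ν j) κ s (lookup xs j)
    pre-coeff : ∀ j → 0ℤ ℤ.≤ pre j × c (suc (suc j)) ≡ ι (pre j) + frac (lookup ν j) s
    pre-coeff j = preimage-coeff (lookup ν j) κ s (lookup xs j) (trans (cong (λ c₁ → c₁ * ι (w (lookup ν j)) + c (suc (suc j))) (sym c₁≡))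
      (trans (sym (V-comb-suc c j)) (e (suc (suc j))))) (c≥0 (suc (suc j)))
    ks : Vec ℕ p
    ks = tabulate λ j → ℤ.∣ pre j ∣
    ks≡ : ∀ j → ℤ.+ lookup ks j ≡ pre j
    ks≡ j = trans (cong ℤ.+_ (VecP.lookup∘tabulate (λ j → ℤ.∣ pre j ∣) j)) (ℤP.0≤i⇒+∣i∣≡i (proj₁ (pre-coeff j)))
    rest : sum (λ j → c (suc (suc j))) ≡ ιₙ (weight ks) + ιₙ a * β s
    rest = trans (sum-cong λ j → trans (proj₂ (pre-coeff j)) (cong (λ z → ι z + frac (lookup ν j) s) (sym (ks≡ j))))
      (trans (sum-+ (λ j → ιₙ (lookup ks j)) (λ j → frac (lookup ν j) s)) (cong₂ _+_ (ι-weight ks) (sum-frac s)))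
    -- The height determines the coefficient of the origin as z - s/q; rounding s/q up leaves the
    -- multiplicity `k₀`.
    z : ℤ
    z = ℤ.+ n ℤ.- (ℤ.+ (κ ℕ.+ weight ks) ℤ.+ ℤ.+ a ℤ.* ℤ.+ jump s)
    c₀≡ : c zero ≡ ι z - ρ s
    c₀≡ = trans (eq (c zero) (ιₙ κ) (ρ s) (ιₙ (weight ks)) (ιₙ a * β s)) (cong (_- ρ s)
      (trans (cong₂ _-_ (trans (cong (c zero +_) (sym (cong₂ _+_ c₁≡ rest))) (trans (sym (sum-heights c)) (e zero)))
          (trans (cong₂ _+_ (sym (ι-+ (ℤ.+ κ) (ℤ.+ weight ks))) (sym (ι-* (ℤ.+ a) (ℤ.+ jump s)))) (sym (ι-+ (ℤ.+ (κ ℕ.+ weight ks)) (ℤ.+ a ℤ.* ℤ.+ jump s)))))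
        (sym (ι-- (ℤ.+ n) (ℤ.+ (κ ℕ.+ weight ks) ℤ.+ ℤ.+ a ℤ.* ℤ.+ jump s)))))
      where
      opaque
        unfolding _+_
        eq : ∀ c κ r w b → c ≡ ((c + ((κ + r) + (w + b))) - ((κ + w) + b)) - r
        eq = solve-∀ ℚ-ring
    k₀ : ℕ
    k₀ = ℤ.∣ z ℤ.- ℤ.+ jump s ∣
    k₀≡ : ℤ.+ k₀ ≡ z ℤ.- ℤ.+ jump s
    k₀≡ = ℤP.0≤i⇒+∣i∣≡i (integral-jump z s (subst (0# ≤ᵣ_) c₀≡ (c≥0 zero)))
    total≡ : k₀ ℕ.+ (κ ℕ.+ weight ks) ℕ.+ ht s ≡ n
    total≡ = ℤP.+-injective (trans (ℤP.pos-+ (k₀ ℕ.+ (κ ℕ.+ weight ks)) (ht s)) (trans (cong₂ ℤ._+_ (trans (ℤP.pos-+ k₀ (κ ℕ.+ weight ks)) (cong (λ z → z ℤ.+ ℤ.+ (κ ℕ.+ weight ks)) k₀≡)) (ht-jump s))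
      (eq (ℤ.+ n) (ℤ.+ (κ ℕ.+ weight ks)) (ℤ.+ a ℤ.* ℤ.+ jump s) (ℤ.+ jump s))))
      where
      eq : ∀ n k b j → n ℤ.- (k ℤ.+ b) ℤ.- j ℤ.+ k ℤ.+ (b ℤ.+ j) ≡ n
      eq = solve-∀ ℤ-ring

  hStarVector-vanishes : ∀ n → a < n → hStarVector (suc n) ≡ 0
  hStarVector-vanishes n a<n with n ℕ.≟ a
  ... | yes refl = contradiction a<n (ℕP.<-irrefl refl)
  ... | no _     = refl

  count-≤ : ∀ {p} (ν : Vec Bool p) → count ν ≤ p
  count-≤ []          = z≤n
  count-≤ (true  ∷ ν) = s≤s (count-≤ ν)
  count-≤ (false ∷ ν) = ℕP.m≤n⇒m≤1+n (count-≤ ν)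

  fStar : Fin (suc (suc p)) → ℤ
  fStar k = ℤ.+ psums (suc (suc p) ∸ toℕ k) hStarVector (suc (toℕ k))

  isFStar : IsFStar V fStar
  isFStar (suc n) n≥1 = List.map point (list E) ,
    unique-map point (λ x∈ y∈ → point-injective (trans (sound E x∈) (sym (sound E y∈)))) (unique E) ,
    (λ x → mk⇔
      (λ x∈ → let k , k∈ , e = MemP.∈-map⁻ point x∈ in cone⇒dilate V n≥1 (subst (InCone V (suc n)) (sym e) (point-in-cone k (sound E k∈))))
      (λ w → let k , e , point≡ = cone-point (dilate⇒cone V w) in subst (_∈ List.map point (list E)) point≡ (MemP.∈-map⁺ point (complete E e)))) ,
    trans (cong ℤ.+_ (trans (ListP.length-map point (list E)) (size-compositions (suc (suc p)) (suc n))))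
      (sym (newton-expansion (suc (suc p)) 1 hStarVector fStar ℕP.≤-refl (λ _ → refl) vanish n))
    where
    E : Composition (suc (suc p)) (suc n)
    E = compositions (suc (suc p)) (suc n)
    -- After p + 2 differences no partial sum is left, and h* is supported at 0 and at a + 1 ≤ p +
    -- 1.
    vanish : ∀ n → psums (suc (suc p) ∸ suc (suc p)) hStarVector (suc (suc (suc p)) ℕ.+ n) ≡ 0
    vanish n = subst (λ r → psums r hStarVector (suc (suc (suc p)) ℕ.+ n) ≡ 0) (sym (ℕP.n∸n≡0 (suc (suc p))))
      (hStarVector-vanishes (suc (suc p) ℕ.+ n) (ℕP.≤-trans (s≤s (subst (_≤ p) trues (count-≤ ν))) (ℕP.≤-trans (ℕP.n≤1+n (suc p)) (ℕP.m≤m+n (suc (suc p)) n))))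

  -- Relative to the origin the vertices are triangular: only (q, w) has a nonzero first coordinate,
  -- and the others are unit vectors.
  affIndep : AffIndep V
  affIndep = affIndep-intro {W = V} λ c h → independent c λ j → trans (sum-cong λ i → cong (λ z → c i * ι z)
      (trans (sym (ℤP.+-identityʳ (lookup (V (suc i)) j))) (cong (λ z → lookup (V (suc i)) j ℤ.- z) (sym (VecP.lookup-replicate j (ℤ.+ 0)))))) (h j)
    where
    independent : ∀ (c : Fin (suc p) → ℚ) → (∀ j → sum (λ i → c i * ι (lookup (V (suc i)) j)) ≡ 0#) → ∀ i → c i ≡ 0#
    independent c h = λ { zero → c₀≡0 ; (suc j) → trans (sym (trans (cong (λ e → e * ι (w (lookup ν j)) + c (suc j)) c₀≡0)
        (trans (cong (_+ c (suc j)) (zeroˡ _)) (+-identityˡ _)))) (trans (sym (V-comb-suc c⁺ j)) (trans (V-comb c⁺ (suc j)) (h (suc j)))) }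
      where
      c⁺ : Fin (suc (suc p)) → ℚ
      c⁺ zero    = 0#
      c⁺ (suc i) = c i
      c₀≡0 : c zero ≡ 0#
      c₀≡0 = cancel-nonzero q≢0 (trans (sym (V-comb-zero c⁺)) (trans (V-comb c⁺ zero) (h zero)))

-- The example in dimension 15

signs : Vec Bool 14
signs = Vec.replicate 7 true Vec.++ Vec.replicate 7 false

-- With h* = 1 + 191 z⁸ in dimension 15, (f*₇, f*₈, f*₉) = (13061, 12968, 13356).
module Example = CyclicSimplex 14 7 191 signs refl refl

-- A peak beyond 8 would need f*₇ ≤ f*₈, and a peak at or before 8 would need f*₉ ≤ f*₈.
example-not-unimodal : ¬ Unimodal Example.fStar
example-not-unimodal (p , up , down) with 8 ℕ.<? toℕ p
... | yes 8<p = ℕP.<⇒≱ (ℕP.<ᵇ⇒< _ _ tt) (ℤ.drop‿+≤+ (up (fromℕ< {7} (ℕP.<ᵇ⇒< 7 15 tt)) (ℕP.<-trans (ℕP.<ᵇ⇒< 7 8 tt) 8<p)))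
... | no 8≮p  = ℕP.<⇒≱ (ℕP.<ᵇ⇒< _ _ tt) (ℤ.drop‿+≤+ (down (fromℕ< {8} (ℕP.<ᵇ⇒< 8 15 tt)) (ℕP.≮⇒≥ 8≮p)))

theorem1p5 : ((d : ℕ) → 1 ≤ d → d ≤ 13 →
    (m : ℕ) (V : Fin m → Vec ℤ d) → FullDim V →
    (f : Fin (suc d) → ℤ) → IsFStar V f → Unimodal f)
    × (Σ (Fin 16 → Vec ℤ 15) λ V → AffIndep V ×
    Σ (Fin 16 → ℤ) λ f → IsFStar V f × ¬ Unimodal f)
theorem1p5 = (λ d _ d≤13 → unimodal-≤13 d d≤13) , Example.V , Example.affIndep , Example.fStar , Example.isFStar , example-not-unimodal
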